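{- Let $q\ge5$ be an odd prime power and let $p$ be the prime dividing $q$. Let $G=\mathrm{SL}(2,q)$, let $t=-I\in G$, and let $S$ be the set of elements of $G$ of order $p$ or $2p$. Then the graph $\mathrm{Cay}(G,\{t\}\cup S)$ is not a Cayley graph of any abelian group.
   Context: For a group $G$ and an inverse-closed subset $C\subseteq G\setminus\{1_G\}$, $\mathrm{Cay}(G,C)$ is the graph with vertex set $G$ in which $g\sim h$ if and only if $hg^{ -1}\in C$. A graph $X$ is a Cayley graph of a group $K$ if $X\cong\mathrm{Cay}(K,C')$ for some inverse-closed $C'\subseteq K\setminus\{1_K\}$; equivalently, $\mathrm{Aut}(X)$ contains a regular subgroup isomorphic to $K$. -}

module Defs where

open import Algebra.Bundles using (CommutativeRing; Group)
import Algebra.Properties.CommutativeMonoid.Sum as Sum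
import Algebra.Properties.Group as GroupProperties
import Algebra.Properties.Monoid.Mult as Mult
import Algebra.Properties.Ring as RingProperties
import Algebra.Solver.Ring.NaturalCoefficients.Default as SemiringSolver
open import Data.Fin using (Fin)
open import Data.Fin.Permutation using (Permutation; permutation)
open import Data.Nat as ℕ using (ℕ; zero; suc; z≤n; s≤s; nonTrivial⇒n>1)
open import Data.Nat.Divisibility using (_∣_; m%n≡0⇒n∣m)
import Data.Nat.DivMod as DivMod
open import Data.Nat.Primality using (Prime; prime⇒nonTrivial)
open import Data.Nat.Properties using (≤-trans; <-irrefl; m≤n*m)
open import Data.Product using (Σ-syntax; ∃; ∃₂; _×_; _,_; proj₁)
open import Data.Sum using (_⊎_; inj₁; inj₂; [_,_])
open import Function using (_⇔_; _∘_)
open import Function.Bundles using (Inverse)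
open import Level using (Level; _⊔_) renaming (suc to lsuc)
open import Relation.Binary.Bundles using (Setoid)
open import Relation.Binary.Core using (Rel)
open import Relation.Binary.Definitions using (Symmetric; Irreflexive; _Respects₂_)
import Relation.Binary.PropositionalEquality as ≡
open ≡ using (_≡_)
import Relation.Binary.Reasoning.Setoid as SetoidReasoning
open import Relation.Nullary using (¬_; contradiction)
open import Relation.Unary using (Pred; _∪_)

IsPrimePower : ℕ → Set
IsPrimePower q = ∃₂ λ r k → Prime r × 1 ℕ.≤ k × q ≡ r ℕ.^ k

-- A field with exactly q elements, up to its setoid equality.  It is unique up
-- to isomorphism, so a statement about 𝔽_q is made for every such field.
record FiniteField (c ℓ : Level) (q : ℕ) : Set (lsuc (c ⊔ ℓ)) where
  field
    commutativeRing : CommutativeRing c ℓ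
  open CommutativeRing commutativeRing public
  field
    0≉1         : ¬ 0# ≈ 1#
    invertible  : ∀ x → ¬ x ≈ 0# → ∃ λ y → x * y ≈ 1#
    cardinality : Inverse setoid (≡.setoid (Fin q))

module _ {c ℓ} (G : Group c ℓ) where
  open Group G
  -- the library's additively written multiple n × g is the power gⁿ here
  open Mult monoid using (×-congʳ) renaming (_×_ to _×ᴳ_)
  open GroupProperties G

  infixr 8 _^ᴳ_
  _^ᴳ_ : Carrier → ℕ → Carrier
  g ^ᴳ n = n ×ᴳ g

  HasOrder : Carrier → ℕ → Set ℓ
  HasOrder g n = 1 ℕ.≤ n × g ^ᴳ n ≈ ε × (∀ m → 1 ℕ.≤ m → g ^ᴳ m ≈ ε → n ℕ.≤ m)

  private
    ^-comm : ∀ g n → g ∙ g ^ᴳ n ≈ g ^ᴳ n ∙ g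
    ^-comm g zero    = trans (identityʳ g) (sym (identityˡ g))
    ^-comm g (suc n) = trans (∙-congˡ (^-comm g n)) (sym (assoc g (g ^ᴳ n) g))

    ^-⁻¹ : ∀ g n → (g ⁻¹) ^ᴳ n ≈ (g ^ᴳ n) ⁻¹
    ^-⁻¹ g zero    = sym ε⁻¹≈ε
    ^-⁻¹ g (suc n) = trans (∙-congˡ (^-⁻¹ g n))
      (trans (sym (⁻¹-anti-homo-∙ (g ^ᴳ n) g)) (⁻¹-cong (sym (^-comm g n))))

  HasOrder-resp : ∀ {n g h} → g ≈ h → HasOrder g n → HasOrder h n
  HasOrder-resp {n} g≈h (0<n , gⁿ≈ε , min) =
    0<n , trans (×-congʳ n (sym g≈h)) gⁿ≈ε ,
    λ m 0<m hᵐ≈ε → min m 0<m (trans (×-congʳ m g≈h) hᵐ≈ε)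

  HasOrder-⁻¹ : ∀ {n g} → HasOrder g n → HasOrder (g ⁻¹) n
  HasOrder-⁻¹ {n} {g} (0<n , gⁿ≈ε , min) =
    0<n , trans (^-⁻¹ g n) (trans (⁻¹-cong gⁿ≈ε) ε⁻¹≈ε) ,
    λ m 0<m eq → min m 0<m
      (⁻¹-injective (trans (sym (^-⁻¹ g m)) (trans eq (sym ε⁻¹≈ε))))

  HasOrder-ε : ∀ {n} → HasOrder ε n → n ℕ.≤ 1
  HasOrder-ε (_ , _ , min) = min 1 (s≤s z≤n) (identityˡ ε)

record Graph (v e a : Level) : Set (lsuc (v ⊔ e ⊔ a)) where
  field
    vertices : Setoid v e
  open Setoid vertices public using () renaming (Carrier to Vertex; _≈_ to _≈ᵛ_)
  infix 4 _~_
  field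
    _~_      : Rel Vertex a
    ~-resp   : _~_ Respects₂ _≈ᵛ_
    ~-sym    : Symmetric _~_
    ~-irrefl : Irreflexive _≈ᵛ_ _~_

infix 4 _≅_
record _≅_ {v₁ e₁ a₁ v₂ e₂ a₂} (X : Graph v₁ e₁ a₁) (Y : Graph v₂ e₂ a₂)
           : Set (v₁ ⊔ e₁ ⊔ a₁ ⊔ v₂ ⊔ e₂ ⊔ a₂) where
  private
    module X = Graph X
    module Y = Graph Y
  field
    bijection : Inverse X.vertices Y.vertices
  open Inverse bijection public
  field
    adjacency : ∀ x y → x X.~ y ⇔ to x Y.~ to y

record ConnectionSet {c ℓ} (G : Group c ℓ) (d : Level) : Set (c ⊔ ℓ ⊔ lsuc d) where
  open Group G
  field
    member         : Pred Carrier d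
    respects       : ∀ {g h} → g ≈ h → member g → member h
    inverse-closed : ∀ {g} → member g → member (g ⁻¹)
    ε∉             : ¬ member ε

Cay : ∀ {c ℓ d} (G : Group c ℓ) → ConnectionSet G d → Graph c ℓ d
Cay G C = record
  { vertices = setoid
  ; _~_      = λ g h → member (h ∙ g ⁻¹)
  ; ~-resp   = (λ h≈h′ → respects (∙-congʳ h≈h′))
             , (λ g≈g′ → respects (∙-congˡ (⁻¹-cong g≈g′)))
  ; ~-sym    = λ {g} {h} g~h → respects (⁻¹-anti-homo-// h g) (inverse-closed g~h)
  ; ~-irrefl = λ g≈h g~h → ε∉ (respects (x≈y⇒x∙y⁻¹≈ε (sym g≈h)) g~h)
  }
  where
  open Group G
  open ConnectionSet C
  open GroupProperties G

-- The universe level d of the connection set is arbitrary.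
IsCayleyGraphOf : ∀ {v e a c ℓ} → Graph v e a → Group c ℓ → (d : Level) → Set _
IsCayleyGraphOf X K d = Σ[ C ∈ ConnectionSet K d ] X ≅ Cay K C

module _ {c ℓ} (R : CommutativeRing c ℓ) where
  open CommutativeRing R
  open RingProperties ring
  open SetoidReasoning setoid
  open SemiringSolver commutativeSemiring using (solve; _:=_; _:+_; _:*_; con)

  record Matrix₂ : Set c where
    constructor mat
    field
      m₁₁ m₁₂ m₂₁ m₂₂ : Carrier

  open Matrix₂

  infix 4 _≈ᴹ_
  record _≈ᴹ_ (A B : Matrix₂) : Set ℓ where
    constructor mat≈
    field
      ≈₁₁ : m₁₁ A ≈ m₁₁ B
      ≈₁₂ : m₁₂ A ≈ m₁₂ B
      ≈₂₁ : m₂₁ A ≈ m₂₁ B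
      ≈₂₂ : m₂₂ A ≈ m₂₂ B

  det : Matrix₂ → Carrier
  det (mat a b c d) = a * d - b * c

  infixl 7 _*ᴹ_
  _*ᴹ_ : Matrix₂ → Matrix₂ → Matrix₂
  mat a b c d *ᴹ mat e f g h =
    mat (a * e + b * g) (a * f + b * h)
        (c * e + d * g) (c * f + d * h)

  Iᴹ : Matrix₂
  Iᴹ = mat 1# 0# 0# 1#

  -ᴹ_ : Matrix₂ → Matrix₂
  -ᴹ mat a b c d = mat (- a) (- b) (- c) (- d)

  adj : Matrix₂ → Matrix₂
  adj (mat a b c d) = mat d (- b) (- c) a

  private
    x-y≈z⇒x≈z+y : ∀ {x y z} → x - y ≈ z → x ≈ z + y
    x-y≈z⇒x≈z+y {x} {y} {z} eq = begin
      x           ≈⟨ x≈z//y x y (x + y) refl ⟩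
      x + y - y   ≈⟨ +-assoc x y (- y) ⟩
      x + (y - y) ≈⟨ +-congˡ (+-comm y (- y)) ⟩
      x + (- y + y) ≈⟨ +-assoc x (- y) y ⟨
      x - y + y   ≈⟨ +-congʳ eq ⟩
      z + y       ∎

    expand₁ : ∀ a b c d e f g h →
      (a * e + b * g) * (c * f + d * h) ≈
      (a * d) * (e * h) + (b * c) * (f * g) + (a * e * (c * f) + b * g * (d * h))
    expand₁ = solve 8 (λ a b c d e f g h →
      (a :* e :+ b :* g) :* (c :* f :+ d :* h) :=
      (a :* d) :* (e :* h) :+ (b :* c) :* (f :* g) :+ (a :* e :* (c :* f) :+ b :* g :* (d :* h))) refl

    expand₂ : ∀ a b c d e f g h →
      (1# + b * c) * (1# + f * g) + (b * c) * (f * g) + (a * e * (c * f) + b * g * (d * h)) ≈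
      1# + ((1# + b * c) * (f * g) + (b * c) * (1# + f * g) + (a * e * (c * f) + b * g * (d * h)))
    expand₂ = solve 8 (λ a b c d e f g h →
      (con 1 :+ b :* c) :* (con 1 :+ f :* g) :+ (b :* c) :* (f :* g) :+ (a :* e :* (c :* f) :+ b :* g :* (d :* h)) :=
      con 1 :+ ((con 1 :+ b :* c) :* (f :* g) :+ (b :* c) :* (con 1 :+ f :* g) :+ (a :* e :* (c :* f) :+ b :* g :* (d :* h)))) refl

    expand₃ : ∀ a b c d e f g h →
      (a * d) * (f * g) + (b * c) * (e * h) + (a * e * (c * f) + b * g * (d * h)) ≈
      (a * f + b * h) * (c * e + d * g)
    expand₃ = solve 8 (λ a b c d e f g h →
      (a :* d) :* (f :* g) :+ (b :* c) :* (e :* h) :+ (a :* e :* (c :* f) :+ b :* g :* (d :* h)) :=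
      (a :* f :+ b :* h) :* (c :* e :+ d :* g)) refl

  det-* : ∀ A B → det A ≈ 1# → det B ≈ 1# → det (A *ᴹ B) ≈ 1#
  det-* (mat a b c d) (mat e f g h) detA detB = sym (x≈z//y _ _ _ (sym (begin
    (a * e + b * g) * (c * f + d * h)
      ≈⟨ expand₁ a b c d e f g h ⟩
    (a * d) * (e * h) + (b * c) * (f * g) + (a * e * (c * f) + b * g * (d * h))
      ≈⟨ +-congʳ (+-congʳ (*-cong ad≈ eh≈)) ⟩
    (1# + b * c) * (1# + f * g) + (b * c) * (f * g) + (a * e * (c * f) + b * g * (d * h))
      ≈⟨ expand₂ a b c d e f g h ⟩
    1# + ((1# + b * c) * (f * g) + (b * c) * (1# + f * g) + (a * e * (c * f) + b * g * (d * h)))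
      ≈⟨ +-congˡ (+-congʳ (+-cong (*-congʳ ad≈) (*-congˡ eh≈))) ⟨
    1# + ((a * d) * (f * g) + (b * c) * (e * h) + (a * e * (c * f) + b * g * (d * h)))
      ≈⟨ +-congˡ (expand₃ a b c d e f g h) ⟩
    1# + (a * f + b * h) * (c * e + d * g) ∎)))
    where
    ad≈ = x-y≈z⇒x≈z+y detA
    eh≈ = x-y≈z⇒x≈z+y detB

  det-I : det Iᴹ ≈ 1#
  det-I = begin
    1# * 1# - 0# * 0# ≈⟨ +-cong (*-identityˡ 1#) (-‿cong (zeroˡ 0#)) ⟩
    1# - 0#           ≈⟨ +-congˡ -0#≈0# ⟩
    1# + 0#           ≈⟨ +-identityʳ 1# ⟩
    1#                ∎

  private
    neg*neg : ∀ x y → - x * - y ≈ x * y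
    neg*neg x y = begin
      - x * - y     ≈⟨ -‿distribˡ-* x (- y) ⟨
      - (x * - y)   ≈⟨ -‿cong (-‿distribʳ-* x y) ⟨
      - (- (x * y)) ≈⟨ -‿involutive (x * y) ⟩
      x * y         ∎

  det-neg : ∀ A → det (-ᴹ A) ≈ det A
  det-neg (mat a b c d) = +-cong (neg*neg a d) (-‿cong (neg*neg b c))

  det-adj : ∀ A → det (adj A) ≈ det A
  det-adj (mat a b c d) = +-cong (*-comm d a) (-‿cong (neg*neg b c))

  private
    diag₁ : ∀ a b c d → d * a + - b * c ≈ a * d - b * c
    diag₁ a b c d = +-cong (*-comm d a) (sym (-‿distribˡ-* b c))

    diag₂ : ∀ a b c d → - c * b + a * d ≈ a * d - b * c
    diag₂ a b c d = trans (+-comm _ _)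
      (+-congˡ (trans (sym (-‿distribˡ-* c b)) (-‿cong (*-comm c b))))

    diag₃ : ∀ a b c d → a * d + b * - c ≈ a * d - b * c
    diag₃ a b c d = +-congˡ (sym (-‿distribʳ-* b c))

    diag₄ : ∀ a b c d → c * - b + d * a ≈ a * d - b * c
    diag₄ a b c d = trans (+-cong (sym (-‿distribʳ-* c b)) (*-comm d a))
      (trans (+-comm _ _) (+-congˡ (-‿cong (*-comm c b))))

    off : ∀ x y → x * - y + y * x ≈ 0#
    off x y = begin
      x * - y + y * x   ≈⟨ +-cong (-‿distribʳ-* x y) (*-comm x y) ⟨
      - (x * y) + x * y ≈⟨ -‿inverseˡ (x * y) ⟩
      0#                ∎

    off′ : ∀ x y → x * y + y * - x ≈ 0#
    off′ x y = begin
      x * y + y * - x ≈⟨ +-comm _ _ ⟩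
      y * - x + x * y ≈⟨ off y x ⟩
      0#              ∎

    off₂ : ∀ x y → x * y + - y * x ≈ 0#
    off₂ x y = trans (+-congˡ (*-comm (- y) x))
                     (trans (sym (distribˡ x y (- y)))
                            (trans (*-congˡ (-‿inverseʳ y)) (zeroʳ x)))

    off₂′ : ∀ x y → - x * y + y * x ≈ 0#
    off₂′ x y = trans (+-congʳ (*-comm (- x) y))
                     (trans (sym (distribˡ y (- x) x))
                            (trans (*-congˡ (-‿inverseˡ x)) (zeroʳ y)))

    entry-assoc : ∀ a b e f g h x y →
      (a * e + b * g) * x + (a * f + b * h) * y ≈
      a * (e * x + f * y) + b * (g * x + h * y)
    entry-assoc = solve 8 (λ a b e f g h x y →
      (a :* e :+ b :* g) :* x :+ (a :* f :+ b :* h) :* y :=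
      a :* (e :* x :+ f :* y) :+ b :* (g :* x :+ h :* y)) refl

    1x+0y : ∀ x y → 1# * x + 0# * y ≈ x
    1x+0y x y = trans (+-cong (*-identityˡ x) (zeroˡ y)) (+-identityʳ x)

    0x+1y : ∀ x y → 0# * x + 1# * y ≈ y
    0x+1y x y = trans (+-cong (zeroˡ x) (*-identityˡ y)) (+-identityˡ y)

    x1+y0 : ∀ x y → x * 1# + y * 0# ≈ x
    x1+y0 x y = trans (+-cong (*-identityʳ x) (zeroʳ y)) (+-identityʳ x)

    x0+y1 : ∀ x y → x * 0# + y * 1# ≈ y
    x0+y1 x y = trans (+-cong (zeroʳ x) (*-identityʳ y)) (+-identityˡ y)

  SL₂ : Group (c ⊔ ℓ) ℓ
  SL₂ = record
    { Carrier = Σ[ A ∈ Matrix₂ ] det A ≈ 1#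
    ; _≈_     = λ A B → proj₁ A ≈ᴹ proj₁ B
    ; _∙_     = λ (A , detA) (B , detB) → A *ᴹ B , det-* A B detA detB
    ; ε       = Iᴹ , det-I
    ; _⁻¹     = λ (A , detA) → adj A , trans (det-adj A) detA
    ; isGroup = record
      { isMonoid = record
        { isSemigroup = record
          { isMagma = record
            { isEquivalence = record
              { refl  = mat≈ refl refl refl refl
              ; sym   = λ (mat≈ p q r s) → mat≈ (sym p) (sym q) (sym r) (sym s)
              ; trans = λ (mat≈ p q r s) (mat≈ p′ q′ r′ s′) →
                  mat≈ (trans p p′) (trans q q′) (trans r r′) (trans s s′)
              }
            ; ∙-cong = λ (mat≈ p q r s) (mat≈ p′ q′ r′ s′) → mat≈
                (+-cong (*-cong p p′) (*-cong q r′)) (+-cong (*-cong p q′) (*-cong q s′))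
                (+-cong (*-cong r p′) (*-cong s r′)) (+-cong (*-cong r q′) (*-cong s s′))
            }
          ; assoc = λ (mat a b c d , _) (mat e f g h , _) (mat i j k l , _) → mat≈
              (entry-assoc a b e f g h i k) (entry-assoc a b e f g h j l)
              (entry-assoc c d e f g h i k) (entry-assoc c d e f g h j l)
          }
        ; identity = (λ (mat a b c d , _) → mat≈ (1x+0y a c) (1x+0y b d) (0x+1y a c) (0x+1y b d))
                   , (λ (mat a b c d , _) → mat≈ (x1+y0 a b) (x0+y1 a b) (x1+y0 c d) (x0+y1 c d))
        }
      ; inverse = (λ (mat a b c d , detA) → mat≈
                      (trans (diag₁ a b c d) detA) (off₂ d b)
                      (off₂′ c a) (trans (diag₂ a b c d) detA))
                , (λ (mat a b c d , detA) → mat≈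
                      (trans (diag₃ a b c d) detA) (off a b)
                      (off′ c d) (trans (diag₄ a b c d) detA))
      ; ⁻¹-cong = λ (mat≈ p q r s) → mat≈ s (-‿cong q) (-‿cong r) p
      }
    }

  -I : Group.Carrier SL₂
  -I = -ᴹ Iᴹ , trans (det-neg Iᴹ) det-I

module _ {c ℓ q} (F : FiniteField c ℓ q) where
  open FiniteField F
  open RingProperties ring
  open Mult +-monoid using (×-congʳ; ×-homo-1; ×-homo-+; ×-assocˡ) renaming (_×_ to _×ᶠ_)
  open Sum +-commutativeMonoid
  open SetoidReasoning setoid
  private
    module E = Inverse cardinality

    shift : Permutation q q
    shift = permutation
      (λ i → E.to (E.from i + 1#))
      (λ i → E.to (E.from i - 1#))
      (λ i → cancel i (- 1#) 1# (-‿inverseˡ 1#))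
      (λ i → cancel i 1# (- 1#) (-‿inverseʳ 1#))
      where
      cancel : ∀ i x y → x + y ≈ 0# → E.to (E.from (E.to (E.from i + x)) + y) ≡ i
      cancel i x y x+y≈0 = E.inverseˡ (begin
        E.from (E.to (E.from i + x)) + y ≈⟨ +-congʳ (E.inverseʳ ≡.refl) ⟩
        E.from i + x + y                 ≈⟨ +-assoc _ _ _ ⟩
        E.from i + (x + y)               ≈⟨ +-congˡ x+y≈0 ⟩
        E.from i + 0#                    ≈⟨ +-identityʳ _ ⟩
        E.from i                         ∎)

  -- Translation by 1 permutes the field, so it fixes the sum of all elements.
  q×1≈0 : q ×ᶠ 1# ≈ 0#
  q×1≈0 = +-identityʳ-unique (∑[ i < q ] E.from i) (q ×ᶠ 1#) (begin
    ∑[ i < q ] E.from i + q ×ᶠ 1#                  ≈⟨ +-congˡ (sum-replicate q) ⟨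
    ∑[ i < q ] E.from i + ∑[ i < q ] 1#            ≈⟨ ∑-distrib-+ E.from (λ _ → 1#) ⟨
    ∑[ i < q ] (E.from i + 1#)                     ≈⟨ sum-cong-≋ {q} (λ i → E.inverseʳ {E.from i + 1#} ≡.refl) ⟨
    ∑[ i < q ] E.from (E.to (E.from i + 1#))       ≈⟨ ∑-permute E.from shift ⟨
    ∑[ i < q ] E.from i                            ∎)

  odd⇒-1≉1 : ¬ 2 ∣ q → ¬ - 1# ≈ 1#
  odd⇒-1≉1 2∤q -1≈1 = 0≉1 (begin
    0#                                 ≈⟨ q×1≈0 ⟨
    q ×ᶠ 1#                            ≡⟨ ≡.cong (_×ᶠ 1#) q≡1+k*2 ⟩
    1# + (k ℕ.* 2) ×ᶠ 1#               ≈⟨ +-congˡ (×-assocˡ 1# k 2) ⟨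
    1# + k ×ᶠ (2 ×ᶠ 1#)                ≈⟨ +-congˡ (×-congʳ k 2×1≈0) ⟩
    1# + k ×ᶠ 0#                       ≈⟨ +-congˡ (trans (sym (sum-replicate k)) (sum-replicate-zero k)) ⟩
    1# + 0#                            ≈⟨ +-identityʳ 1# ⟩
    1#                                 ∎)
    where
    k = q ℕ./ 2

    q≡1+k*2 : q ≡ 1 ℕ.+ k ℕ.* 2
    q≡1+k*2 with q ℕ.% 2 in eq | DivMod.m%n<n q 2 | DivMod.m≡m%n+[m/n]*n q 2
    ... | 0 | _ | _ = contradiction (m%n≡0⇒n∣m q 2 eq) 2∤q
    ... | 1 | _ | q≡ = q≡
    ... | suc (suc _) | s≤s (s≤s ()) | _

    2×1≈0 : 2 ×ᶠ 1# ≈ 0#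
    2×1≈0 = begin
      1# + (1# + 0#) ≈⟨ +-congˡ (+-identityʳ 1#) ⟩
      1# + 1#        ≈⟨ +-congˡ -1≈1 ⟨
      1# - 1#        ≈⟨ -‿inverseʳ 1# ⟩
      0#             ∎

  SL₂F : Group (c ⊔ ℓ) ℓ
  SL₂F = SL₂ commutativeRing

  open Group SL₂F using () renaming
    (Carrier to SL; _≈_ to _≈ˢ_; _⁻¹ to _⁻¹ˢ; sym to symˢ; trans to transˢ; ⁻¹-cong to ⁻¹ˢ-cong)

  t : SL
  t = -I commutativeRing

  S : ℕ → Pred SL ℓ
  S p g = HasOrder SL₂F g p ⊎ HasOrder SL₂F g (2 ℕ.* p)

  private
    t⁻¹≈t : t ⁻¹ˢ ≈ˢ t
    t⁻¹≈t = mat≈ refl -‿cong-0 -‿cong-0 refl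
      where -‿cong-0 = -‿cong -0#≈0#

  t∪S : ∀ {p} → ¬ 2 ∣ q → Prime p → ConnectionSet SL₂F ℓ
  t∪S {p} 2∤q p-prime = record
    { member         = (_≈ˢ t) ∪ S p
    ; respects       = λ {g} {h} g≈h →
                       [ (λ g≈t → inj₁ (transˢ {h} {g} {t} (symˢ {g} {h} g≈h) g≈t))
                       , [ inj₂ ∘ inj₁ ∘ HasOrder-resp SL₂F {g = g} {h} g≈h
                         , inj₂ ∘ inj₂ ∘ HasOrder-resp SL₂F {g = g} {h} g≈h ] ]
    ; inverse-closed = λ {g} →
                       [ (λ g≈t → inj₁ (transˢ {g ⁻¹ˢ} {t ⁻¹ˢ} {t} (⁻¹ˢ-cong {g} {t} g≈t) t⁻¹≈t))
                       , [ inj₂ ∘ inj₁ ∘ HasOrder-⁻¹ SL₂F {g = g}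
                         , inj₂ ∘ inj₂ ∘ HasOrder-⁻¹ SL₂F {g = g} ] ]
    ; ε∉             = [ (λ I≈t → odd⇒-1≉1 2∤q (sym (_≈ᴹ_.≈₁₁ I≈t)))
                       , [ (λ ord → <-irrefl ≡.refl (≤-trans 1<p (HasOrder-ε SL₂F ord)))
                         , (λ ord → <-irrefl ≡.refl
                             (≤-trans 1<p (≤-trans (m≤n*m p 2) (HasOrder-ε SL₂F ord)))) ] ]
    }
    where 1<p = nonTrivial⇒n>1 p {{prime⇒nonTrivial p-prime}}

{-# OPTIONS --safe #-}
-- Modulo ±1 the graph has vertex set PSL(2,q), with x and y adjacent when y x⁻¹ is unipotent up to sign.
-- Its lines are the cosets U x of the root groups U.  They are recognised inside cliques, so an abelian
-- regular group K of automorphisms permutes them.  Counting the q + 1 lines through 1 yields an element a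
-- of K that preserves the line ℓ through 1 and a(1).  Comparing ℓ and any other line with their images
-- (two rulings of a quadric) shows that a is a left or a right translation by a unipotent; inverting the
-- group, say left.  Then the whole root group of ℓ acts by left translations, and K commutes with it.  So K
-- preserves, up to a common sign, the lower left entry and the trace of x y⁻¹ for all x and y, which is
-- incompatible with commutativity: compare the elements of K sending 1 to diag(λ⁻¹, λ) and to w.
module Submission where

open import Defs hiding (t; S; det; _≈ᴹ_; _*ᴹ_; adj; Iᴹ)
open import Algebra.Bundles using (AbelianGroup; CommutativeRing; Group; Semiring)
import Algebra.Properties.Group as GroupProperties
import Algebra.Properties.Ring as RingProperties
import Algebra.Properties.Semiring.Binomial as Binomial
import Algebra.Properties.Semiring.Exp as Exp
import Algebra.Properties.Semiring.Mult as Mult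
import Algebra.Properties.Semiring.Mult.TCOptimised as Mult′
import Algebra.Properties.Semiring.Sum as Sum
import Algebra.Solver.Ring as RingSolver
open import Algebra.Solver.Ring.AlmostCommutativeRing using (fromCommutativeRing; _-Raw-AlmostCommutative⟶_)
open import Data.Empty using (⊥; ⊥-elim)
open import Data.Fin as Fin using (Fin; zero; suc)
import Data.Fin.Properties as Finₚ
open import Data.Integer as ℤ using (ℤ; +_; -[1+_]; _⊖_)
import Data.Integer.Properties as ℤₚ
open import Data.List using (List; []; _∷_; length; lookup)
open import Data.List.Relation.Unary.All as All using (All; []; _∷_)
import Data.List.Relation.Unary.All.Properties as Allₚ
open import Data.List.Relation.Unary.Any as Any using (Any)
import Data.List.Relation.Unary.Any.Properties as Anyₚ
open import Data.Maybe using (Maybe; just; nothing)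
open import Data.Nat as ℕ using (ℕ; zero; suc; _≤_; z≤n; s≤s; _!; nonTrivial⇒n>1)
open import Data.Nat.Combinatorics using (nCk≡n!/k![n-k]!; k![n∸k]!∣n!; nCn≡1) renaming (_C_ to infixl 6.5 _choose_)
open import Data.Nat.Divisibility using (_∣_; divides; ∣⇒≤; m∣m*n; ∣-refl; ∣m∣n⇒∣m+n; ∣-trans; *-monoˡ-∣; _∣0)
open import Data.Nat.DivMod using (m/n*n≡m)
import Data.Nat.GCD as GCD
open import Data.Nat.Primality using (Prime; euclidsLemma; prime[2]; prime⇒irreducible; prime⇒nonTrivial; prime⇒nonZero)
import Data.Nat.Properties as ℕₚ
open import Data.Product using (∃; ∃₂; _×_; _,_; proj₁; proj₂)
open import Data.Sum using (_⊎_; inj₁; inj₂; [_,_]′)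
open import Function using (_∘_; Equivalence)
open import Function.Bundles using (Inverse)
open import Level using (Level; _⊔_)
open import Relation.Binary.PropositionalEquality as ≡ using (_≡_)
import Relation.Binary.Reasoning.Setoid as SetoidReasoning
open import Relation.Nullary using (¬_; Dec; yes; no)
open import Relation.Nullary.Decidable using (¬?; decidable-stable; map′)

-- Working modulo ±1 loses nothing: two vertices have the same closed neighbourhood exactly when
-- they agree up to sign, so every automorphism respects the pairs ±x. One trace governs the
-- geometry: `u v r ∙ x` and `u w s ∙ x` are adjacent iff k = r s ω(v,w)² satisfies (2 + k)² = 4,
-- that is k = 0 or k = -4. Commutativity enters as rigidity: maps commuting with a transitive
-- abelian family are determined by a single value (`agree`). The obstacle is that left and right
-- translations are both automorphisms, and each neighbour of a point only tells that a acts on it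
-- in one of the two ways. Non-commuting directions separate the two ways, apart from coincidences
-- up to sign at trace 0; these are excluded by playing the parameters s and -s against each other.
-- The choice made at one neighbour then has to be propagated to the whole group. The bound q ≥ 5
-- makes lines larger than the competing cliques and provides a λ different from 0, 1 and -1 at the
-- end.

-- Polynomial identities with integer coefficients.

module IntegerSolver {c ℓ} (R : CommutativeRing c ℓ) where
  open CommutativeRing R
  open RingProperties ring
  open Mult′ semiring using (×-homo-+; ×1-homo-*) renaming (_×_ to _⨯_)
  open SetoidReasoning setoid

  ⟦_⟧ℤ : ℤ → Carrier
  ⟦ + n ⟧ℤ      = n ⨯ 1#
  ⟦ -[1+ n ] ⟧ℤ = - (suc n ⨯ 1#)

  ⟦⊖⟧ : ∀ m n → ⟦ m ⊖ n ⟧ℤ ≈ m ⨯ 1# - n ⨯ 1#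
  ⟦⊖⟧ m n with m ℕ.<? n
  ... | no m≮n = begin
    ⟦ m ⊖ n ⟧ℤ                             ≡⟨ ≡.cong ⟦_⟧ℤ (ℤₚ.⊖-≥ (ℕₚ.≮⇒≥ m≮n)) ⟩
    (m ℕ.∸ n) ⨯ 1#                         ≈⟨ x≈z//y _ _ _ (begin
      (m ℕ.∸ n) ⨯ 1# + n ⨯ 1#              ≈⟨ ×-homo-+ 1# (m ℕ.∸ n) n ⟨
      (m ℕ.∸ n ℕ.+ n) ⨯ 1#                 ≡⟨ ≡.cong (_⨯ 1#) (ℕₚ.m∸n+n≡m (ℕₚ.≮⇒≥ m≮n)) ⟩
      m ⨯ 1#                               ∎) ⟩
    m ⨯ 1# - n ⨯ 1#                        ∎
  ... | yes m<n with n ℕ.∸ m | ℤₚ.⊖-< m<n | ℕₚ.m∸n+n≡m (ℕₚ.<⇒≤ m<n) | ℕₚ.m<n⇒0<n∸m m<n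
  ...   | suc k | m⊖n≡ | k+m≡n | _ = begin
    ⟦ m ⊖ n ⟧ℤ                 ≡⟨ ≡.cong ⟦_⟧ℤ m⊖n≡ ⟩
    - (suc k ⨯ 1#)             ≈⟨ -‿cong (x≈z//y _ _ _ (begin
      suc k ⨯ 1# + m ⨯ 1#      ≈⟨ ×-homo-+ 1# (suc k) m ⟨
      (suc k ℕ.+ m) ⨯ 1#       ≡⟨ ≡.cong (_⨯ 1#) k+m≡n ⟩
      n ⨯ 1#                   ∎)) ⟩
    - (n ⨯ 1# - m ⨯ 1#)        ≈⟨ ⁻¹-anti-homo‿- (n ⨯ 1#) (m ⨯ 1#) ⟩
    m ⨯ 1# - n ⨯ 1#            ∎

  +-homo : ∀ i j → ⟦ i ℤ.+ j ⟧ℤ ≈ ⟦ i ⟧ℤ + ⟦ j ⟧ℤ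
  +-homo (+ m)    (+ n)    = ×-homo-+ 1# m n
  +-homo (+ m)    -[1+ n ] = ⟦⊖⟧ m (suc n)
  +-homo -[1+ m ] (+ n)    = trans (⟦⊖⟧ n (suc m)) (+-comm _ _)
  +-homo -[1+ m ] -[1+ n ] = begin
    - (suc (suc (m ℕ.+ n)) ⨯ 1#)       ≡⟨ ≡.cong (λ k → - (suc k ⨯ 1#)) (≡.sym (ℕₚ.+-suc m n)) ⟩
    - ((suc m ℕ.+ suc n) ⨯ 1#)         ≈⟨ -‿cong (×-homo-+ 1# (suc m) (suc n)) ⟩
    - (suc m ⨯ 1# + suc n ⨯ 1#)        ≈⟨ -‿+-comm _ _ ⟨
    - (suc m ⨯ 1#) + - (suc n ⨯ 1#)    ∎

  -‿homo : ∀ i → ⟦ ℤ.- i ⟧ℤ ≈ - ⟦ i ⟧ℤ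
  -‿homo (+ zero)  = sym -0#≈0#
  -‿homo (+ suc n) = refl
  -‿homo -[1+ n ]  = sym (-‿involutive _)

  *-homo : ∀ i j → ⟦ i ℤ.* j ⟧ℤ ≈ ⟦ i ⟧ℤ * ⟦ j ⟧ℤ
  *-homo (+ m)    (+ n)    = trans (reflexive (≡.cong ⟦_⟧ℤ (≡.sym (ℤₚ.pos-* m n)))) (×1-homo-* m n)
  *-homo (+ m)    -[1+ n ] = begin
    ⟦ + m ℤ.* -[1+ n ] ⟧ℤ        ≡⟨ ≡.cong ⟦_⟧ℤ (≡.trans (≡.sym (ℤₚ.neg-distribʳ-* (+ m) (+ suc n))) (≡.cong ℤ.-_ (≡.sym (ℤₚ.pos-* m (suc n))))) ⟩
    ⟦ ℤ.- (+ (m ℕ.* suc n)) ⟧ℤ   ≈⟨ -‿homo (+ (m ℕ.* suc n)) ⟩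
    - ((m ℕ.* suc n) ⨯ 1#)       ≈⟨ -‿cong (×1-homo-* m (suc n)) ⟩
    - ((m ⨯ 1#) * (suc n ⨯ 1#))  ≈⟨ -‿distribʳ-* _ _ ⟩
    (m ⨯ 1#) * - (suc n ⨯ 1#)    ∎
  *-homo -[1+ m ] (+ n)    = begin
    ⟦ -[1+ m ] ℤ.* + n ⟧ℤ        ≡⟨ ≡.cong ⟦_⟧ℤ (≡.trans (≡.sym (ℤₚ.neg-distribˡ-* (+ suc m) (+ n))) (≡.cong ℤ.-_ (≡.sym (ℤₚ.pos-* (suc m) n)))) ⟩
    ⟦ ℤ.- (+ (suc m ℕ.* n)) ⟧ℤ   ≈⟨ -‿homo (+ (suc m ℕ.* n)) ⟩
    - ((suc m ℕ.* n) ⨯ 1#)       ≈⟨ -‿cong (×1-homo-* (suc m) n) ⟩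
    - ((suc m ⨯ 1#) * (n ⨯ 1#))  ≈⟨ -‿distribˡ-* _ _ ⟩
    - (suc m ⨯ 1#) * (n ⨯ 1#)    ∎
  *-homo -[1+ m ] -[1+ n ] = begin
    (suc m ℕ.* suc n) ⨯ 1#            ≈⟨ ×1-homo-* (suc m) (suc n) ⟩
    (suc m ⨯ 1#) * (suc n ⨯ 1#)       ≈⟨ -‿involutive _ ⟨
    - - ((suc m ⨯ 1#) * (suc n ⨯ 1#)) ≈⟨ -‿cong (-‿distribˡ-* _ _) ⟩
    - (- (suc m ⨯ 1#) * (suc n ⨯ 1#)) ≈⟨ -‿distribʳ-* _ _ ⟩
    - (suc m ⨯ 1#) * - (suc n ⨯ 1#)   ∎

  _coeff≟_ : ∀ i j → Maybe (⟦ i ⟧ℤ ≈ ⟦ j ⟧ℤ)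
  i coeff≟ j with i ℤₚ.≟ j
  ... | yes ≡.refl = just refl
  ... | no _       = nothing

  morphism : ℤ.+-*-rawRing -Raw-AlmostCommutative⟶ fromCommutativeRing R
  morphism = record
    { ⟦_⟧ = ⟦_⟧ℤ ; +-homo = +-homo ; *-homo = *-homo ; -‿homo = -‿homo ; 0-homo = refl ; 1-homo = refl }

  open RingSolver ℤ.+-*-rawRing (fromCommutativeRing R) morphism _coeff≟_ public

-- Elementary algebra in the finite field.

module FieldTheory {c ℓ q} (F : FiniteField c ℓ q) where
  open FiniteField F
  open RingProperties ring
  open SetoidReasoning setoid
  open IntegerSolver commutativeRing public using (solve; Polynomial; con; _:+_; _:*_; :-_; _:-_; _:=_)
  private module E = Inverse cardinality

  E-injective : ∀ {x y} → E.to x ≡ E.to y → x ≈ y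
  E-injective {x} {y} eq = trans (sym (E.inverseʳ ≡.refl)) (E.inverseʳ eq)

  infix 4 _≟_
  _≟_ : ∀ x y → Dec (x ≈ y)
  x ≟ y = map′ E-injective E.to-cong (E.to x Finₚ.≟ E.to y)

  abstract
    -- If every element occurred in xs, its index in xs would inject 𝔽_q into a smaller set.
    fresh : ∀ xs → length xs ℕ.< q → ∃ λ y → All (λ x → ¬ y ≈ x) xs
    fresh xs n<q = main (Finₚ.any? (λ i → ¬? (listed? i)))
      where
      listed? : ∀ i → Dec (Any (E.from i ≈_) xs)
      listed? i = Any.any? (E.from i ≟_) xs
      main : Dec (∃ λ i → ¬ Any (E.from i ≈_) xs) → ∃ λ y → All (λ x → ¬ y ≈ x) xs
      main (yes (i , i∉xs)) = E.from i , Allₚ.¬Any⇒All¬ xs i∉xs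
      main (no ¬∃) = ⊥-elim (collide (Finₚ.pigeonhole n<q (λ i → Any.index (listed i))))
        where
        listed : ∀ i → Any (E.from i ≈_) xs
        listed i = decidable-stable (listed? i) (λ i∉xs → ¬∃ (i , i∉xs))
        from-injective : ∀ {i j} → E.from i ≈ E.from j → i ≡ j
        from-injective e = ≡.trans (≡.sym (E.inverseˡ refl)) (≡.trans (E.to-cong e) (E.inverseˡ refl))
        collide : (∃₂ λ i j → i Fin.< j × Any.index (listed i) ≡ Any.index (listed j)) → ⊥
        collide (i , j , i<j , eq) = Finₚ.<-irrefl (from-injective (trans (Anyₚ.lookup-index (listed i))
          (trans (reflexive (≡.cong (lookup xs) eq)) (sym (Anyₚ.lookup-index (listed j)))))) i<j

  2# 4# : Carrier
  2# = 1# + 1#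
  4# = 2# + 2#

  inv : ∀ {x} → ¬ x ≈ 0# → Carrier
  inv x≉0 = proj₁ (invertible _ x≉0)

  inv-inverse : ∀ {x} (x≉0 : ¬ x ≈ 0#) → x * inv x≉0 ≈ 1#
  inv-inverse x≉0 = proj₂ (invertible _ x≉0)

  xy≈0⇒x≈0⊎y≈0 : ∀ {x y} → x * y ≈ 0# → x ≈ 0# ⊎ y ≈ 0#
  xy≈0⇒x≈0⊎y≈0 {x} {y} xy≈0 with x ≟ 0#
  ... | yes x≈0 = inj₁ x≈0
  ... | no  x≉0 = inj₂ (begin
    y               ≈⟨ *-identityˡ y ⟨
    1# * y          ≈⟨ *-congʳ (inv-inverse x≉0) ⟨
    x * inv x≉0 * y ≈⟨ solve 3 (λ x i y → x :* i :* y := i :* (x :* y)) refl x (inv x≉0) y ⟩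
    inv x≉0 * (x * y) ≈⟨ *-congˡ xy≈0 ⟩
    inv x≉0 * 0#    ≈⟨ zeroʳ _ ⟩
    0#              ∎)

  *-≉0 : ∀ {x y} → ¬ x ≈ 0# → ¬ y ≈ 0# → ¬ x * y ≈ 0#
  *-≉0 x≉0 y≉0 xy≈0 = [ x≉0 , y≉0 ]′ (xy≈0⇒x≈0⊎y≈0 xy≈0)

  inv≉0 : ∀ {x} (x≉0 : ¬ x ≈ 0#) → ¬ inv x≉0 ≈ 0#
  inv≉0 x≉0 i≈0 = 0≉1 (trans (sym (zeroʳ _)) (trans (*-congˡ (sym i≈0)) (inv-inverse x≉0)))

  diff : ∀ {x y} → x ≈ y → x - y ≈ 0#
  diff {x} {y} x≈y = trans (+-congʳ x≈y) (-‿inverseʳ y)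

  undiff : ∀ {x y} → x - y ≈ 0# → x ≈ y
  undiff {x} {y} eq = x∙y⁻¹≈ε⇒x≈y x y eq

  *0 : ∀ k {x} → x ≈ 0# → k * x ≈ 0#
  *0 k x≈0 = trans (*-congˡ x≈0) (zeroʳ k)

  0+0 : ∀ {x y} → x ≈ 0# → y ≈ 0# → x + y ≈ 0#
  0+0 x≈0 y≈0 = trans (+-cong x≈0 y≈0) (+-identityˡ 0#)

  -- Equations modulo hypotheses: x - y is exhibited as a combination of the differences of the hypotheses.
  by₁ : ∀ {x y a b} k → x - y ≈ k * (a - b) → a ≈ b → x ≈ y
  by₁ k eq h = undiff (trans eq (*0 k (diff h)))

  by₂ : ∀ {x y a b a′ b′} k k′ → x - y ≈ k * (a - b) + k′ * (a′ - b′) → a ≈ b → a′ ≈ b′ → x ≈ y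
  by₂ k k′ eq h h′ = undiff (trans eq (0+0 (*0 k (diff h)) (*0 k′ (diff h′))))

  by₃ : ∀ {x y a b a′ b′ a″ b″} k k′ k″ → x - y ≈ k * (a - b) + k′ * (a′ - b′) + k″ * (a″ - b″) →
        a ≈ b → a′ ≈ b′ → a″ ≈ b″ → x ≈ y
  by₃ k k′ k″ eq h h′ h″ = undiff (trans eq (0+0 (0+0 (*0 k (diff h)) (*0 k′ (diff h′))) (*0 k″ (diff h″))))

  *-cancelˡ : ∀ {k x y} → ¬ k ≈ 0# → k * x ≈ k * y → x ≈ y
  *-cancelˡ {k} {x} {y} k≉0 eq = [ ⊥-elim ∘ k≉0 , undiff ]′ (xy≈0⇒x≈0⊎y≈0
    (trans (solve 3 (λ k x y → k :* (x :- y) := k :* x :- k :* y) refl k x y) (diff eq)))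

  x²≈y²⇒x≈±y : ∀ {x y} → x * x ≈ y * y → x ≈ y ⊎ x ≈ - y
  x²≈y²⇒x≈±y {x} {y} eq = [ inj₁ ∘ undiff , inj₂ ∘ (λ e → undiff (trans (+-congˡ (-‿involutive y)) e)) ]′ (xy≈0⇒x≈0⊎y≈0
    (trans (solve 2 (λ x y → (x :- y) :* (x :+ y) := x :* x :- y :* y) refl x y) (diff eq)))

  module Odd (2∤q : ¬ 2 ∣ q) where
    2≉0 : ¬ 2# ≈ 0#
    2≉0 2≈0 = odd⇒-1≉1 F 2∤q (by₁ (- 1#) (solve 0 (:- con (+ 1) :- con (+ 1) := :- con (+ 1) :* (con (+ 1)
      :+ con (+ 1) :- con (+ 0))) refl) 2≈0)

    4≉0 : ¬ 4# ≈ 0#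
    4≉0 4≈0 = *-≉0 2≉0 2≉0 (trans (solve 0 ((con (+ 1) :+ con (+ 1)) :* (con (+ 1) :+ con (+ 1)) := (con (+ 1)
      :+ con (+ 1)) :+ (con (+ 1) :+ con (+ 1))) refl) 4≈0)

  -- Syntactic counterparts of the matrix operations, for use with the ring solver.
  record MatP (n : ℕ) : Set where
    constructor matP
    field p₁₁ p₁₂ p₂₁ p₂₂ : Polynomial n

  infixl 7 _∙P_
  _∙P_ : ∀ {n} → MatP n → MatP n → MatP n
  matP a b c d ∙P matP e f g h =
    matP (a :* e :+ b :* g) (a :* f :+ b :* h) (c :* e :+ d :* g) (c :* f :+ d :* h)

  adjP : ∀ {n} → MatP n → MatP n
  adjP (matP a b c d) = matP d (:- b) (:- c) a

  trP detP : ∀ {n} → MatP n → Polynomial n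
  trP (matP a b c d) = a :+ d
  detP (matP a b c d) = a :* d :- b :* c

  p1 p2 p4 p0 : ∀ {n} → Polynomial n
  p0 = con (+ 0)
  p1 = con (+ 1)
  p2 = p1 :+ p1
  p4 = p2 :+ p2

  uP : ∀ {n} → Polynomial n → Polynomial n → Polynomial n → MatP n
  uP x y s = matP (p1 :- s :* (x :* y)) (s :* (x :* x)) (:- (s :* (y :* y))) (p1 :+ s :* (x :* y))

  ωP : ∀ {n} → Polynomial n → Polynomial n → Polynomial n → Polynomial n → Polynomial n
  ωP x y z w = x :* w :- y :* z

  formP : ∀ {n} → Polynomial n → Polynomial n → MatP n → Polynomial n → Polynomial n → Polynomial n
  formP a b (matP x₁ x₂ x₃ x₄) z w = a :* (x₃ :* z :+ x₄ :* w) :- b :* (x₁ :* z :+ x₂ :* w)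

-- PSL(2,q), its root groups and the projective line.

module ProjectiveSL₂ {c ℓ q} (F : FiniteField c ℓ q) (2∤q : ¬ 2 ∣ q) where
  open FiniteField F
  open RingProperties ring
  open FieldTheory F
  open Odd 2∤q
  open MatP
  open Matrix₂

  private
    module G = Group (SL₂F F)
    R = commutativeRing
    Mat = Matrix₂ R

  open Defs using () renaming (_≈ᴹ_ to ≈M)
  infix 4 _≈ᴹ_
  _≈ᴹ_ : Mat → Mat → Set ℓ
  _≈ᴹ_ = ≈M R
  infixl 7 _*ᴹ_
  _*ᴹ_ : Mat → Mat → Mat
  _*ᴹ_ = Defs._*ᴹ_ R
  adj : Mat → Mat
  adj = Defs.adj R
  Iᴹ : Mat
  Iᴹ = Defs.Iᴹ R

  SL : Set (c ⊔ ℓ)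
  SL = G.Carrier

  _₁₁ _₁₂ _₂₁ _₂₂ : SL → Carrier
  x ₁₁ = m₁₁ (proj₁ x)
  x ₁₂ = m₁₂ (proj₁ x)
  x ₂₁ = m₂₁ (proj₁ x)
  x ₂₂ = m₂₂ (proj₁ x)

  infix 30 _₁₁ _₁₂ _₂₁ _₂₂

  det₁ : ∀ x → x ₁₁ * x ₂₂ - x ₁₂ * x ₂₁ ≈ 1#
  det₁ x = proj₂ x

  -- Equality up to sign; the sign is a scalar with square 1, which avoids case distinctions.
  infix 4 _≃_
  record _≃_ (x y : SL) : Set (c ⊔ ℓ) where
    constructor ≃-intro
    field
      sgn  : Carrier
      sgn² : sgn * sgn ≈ 1#
      e₁₁  : x ₁₁ ≈ sgn * y ₁₁
      e₁₂  : x ₁₂ ≈ sgn * y ₁₂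
      e₂₁  : x ₂₁ ≈ sgn * y ₂₁
      e₂₂  : x ₂₂ ≈ sgn * y ₂₂
  open _≃_ public

  ±1 : ∀ {ε} → ε * ε ≈ 1# → ε ≈ 1# ⊎ ε ≈ - 1#
  ±1 ε²≈1 = x²≈y²⇒x≈±y (trans ε²≈1 (sym (*-identityʳ 1#)))

  ≈⇒≃ : ∀ {x y : SL} → proj₁ x ≈ᴹ proj₁ y → x ≃ y
  ≈⇒≃ (mat≈ p q r s) = ≃-intro 1# (*-identityʳ 1#) (1* p) (1* q) (1* r) (1* s)
    where 1* : ∀ {a b} → a ≈ b → a ≈ 1# * b
          1* p = trans p (sym (*-identityˡ _))

  private
    sym-entry : ∀ {ε a b} → ε * ε ≈ 1# → a ≈ ε * b → b ≈ ε * a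
    sym-entry {ε} {a} {b} ε² p = by₂ (- b) (- ε)
      (solve 3 (λ ε a b → b :- ε :* a := :- b :* (ε :* ε :- p1) :+ :- ε :* (a :- ε :* b)) refl ε a b) ε² p

    dot : ∀ {ε η a b e g a′ b′ e′ g′} → a ≈ ε * a′ → b ≈ ε * b′ → e ≈ η * e′ → g ≈ η * g′ →
          a * e + b * g ≈ ε * η * (a′ * e′ + b′ * g′)
    dot {ε} {η} {a′ = a′} {b′} {e′} {g′} p q r s = trans (+-cong (*-cong p r) (*-cong q s))
      (solve 6 (λ ε η a b e g → ε :* a :* (η :* e) :+ ε :* b :* (η :* g) := ε :* η :* (a :* e :+ b :* g))
        refl ε η a′ b′ e′ g′)

    sgn*sgn : ∀ {ε η} → ε * ε ≈ 1# → η * η ≈ 1# → ε * η * (ε * η) ≈ 1#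
    sgn*sgn {ε} {η} p q = by₂ (η * η) 1#
      (solve 2 (λ ε η → ε :* η :* (ε :* η) :- p1 := η :* η :* (ε :* ε :- p1) :+ p1 :* (η :* η :- p1)) refl ε η) p q

    -*-entry : ∀ {ε a b} → a ≈ ε * b → - a ≈ ε * - b
    -*-entry p = trans (-‿cong p) (-‿distribʳ-* _ _)

  ≃-refl : ∀ {x} → x ≃ x
  ≃-refl {x} = ≈⇒≃ (mat≈ refl refl refl refl)

  ≃-sym : ∀ {x y} → x ≃ y → y ≃ x
  ≃-sym (≃-intro ε ε² p q r s) =
    ≃-intro ε ε² (sym-entry ε² p) (sym-entry ε² q) (sym-entry ε² r) (sym-entry ε² s)

  ≃-trans : ∀ {x y z} → x ≃ y → y ≃ z → x ≃ z
  ≃-trans (≃-intro ε ε² p q r s) (≃-intro η η² p′ q′ r′ s′) =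
    ≃-intro (ε * η) (sgn*sgn ε² η²) (t p p′) (t q q′) (t r r′) (t s s′)
    where t : ∀ {a b c} → a ≈ ε * b → b ≈ η * c → a ≈ ε * η * c
          t p q = trans p (trans (*-congˡ q) (sym (*-assoc _ _ _)))

  -- The determinant proofs are abstract so that they are never unfolded when elements are compared.
  abstract
    det-∙ : ∀ (x y : SL) → Defs.det R (proj₁ x *ᴹ proj₁ y) ≈ 1#
    det-∙ x y = det-* R (proj₁ x) (proj₁ y) (proj₂ x) (proj₂ y)

    det-⁻¹ : ∀ (x : SL) → Defs.det R (adj (proj₁ x)) ≈ 1#
    det-⁻¹ x = trans (det-adj R (proj₁ x)) (proj₂ x)

    det-𝟙 : Defs.det R Iᴹ ≈ 1#
    det-𝟙 = det-I R

  PSL₂ : Group (c ⊔ ℓ) (c ⊔ ℓ)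
  PSL₂ = record
    { Carrier = SL
    ; _≈_     = _≃_
    ; _∙_     = λ x y → proj₁ x *ᴹ proj₁ y , det-∙ x y
    ; ε       = Iᴹ , det-𝟙
    ; _⁻¹     = λ x → adj (proj₁ x) , det-⁻¹ x
    ; isGroup = record
      { isMonoid = record
        { isSemigroup = record
          { isMagma = record
            { isEquivalence = record { refl = ≃-refl ; sym = ≃-sym ; trans = ≃-trans }
            ; ∙-cong = λ (≃-intro ε ε² p q r s) (≃-intro η η² p′ q′ r′ s′) →
                ≃-intro (ε * η) (sgn*sgn ε² η²) (dot p q p′ r′) (dot p q q′ s′) (dot r s p′ r′) (dot r s q′ s′)
            }
          ; assoc = λ x y z → ≈⇒≃ (G.assoc x y z)
          }
        ; identity = (λ x → ≈⇒≃ (G.identityˡ x)) , (λ x → ≈⇒≃ (G.identityʳ x))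
        }
      ; inverse = (λ x → ≈⇒≃ (G.inverseˡ x)) , (λ x → ≈⇒≃ (G.inverseʳ x))
      ; ⁻¹-cong = λ (≃-intro ε ε² p q r s) →
          ≃-intro ε ε² s (-*-entry q) (-*-entry r) p
      }
    }

  open Group PSL₂ public using (_∙_; _⁻¹) renaming (ε to 𝟙; setoid to ≃-setoid)

  tr : SL → Carrier
  tr x = x ₁₁ + x ₂₂

  tr-≃ : ∀ {x y} (e : x ≃ y) → tr x ≈ sgn e * tr y
  tr-≃ (≃-intro ε ε² p q r s) = trans (+-cong p s) (sym (distribˡ _ _ _))

  -- With determinant 1, trace ±2 characterises unipotents up to sign; squaring the trace makes the
  -- condition well defined modulo ±1.
  record Par (x : SL) : Set ℓ where
    constructor par
    field tr²≈4 : tr x * tr x ≈ 4#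
  open Par public

  Par-resp : ∀ {x y} → x ≃ y → Par x → Par y
  Par-resp {x} {y} e p = par (by₂ 1# (- (tr y * tr y)) (solve 3 (λ ε t s → t :* t :- p4 :=
      p1 :* (ε :* t :* (ε :* t) :- p4) :+ :- (t :* t) :* (ε :* ε :- p1)) refl (sgn e) (tr y) 0#)
      (trans (sym (*-cong (tr-≃ e) (tr-≃ e))) (tr²≈4 p)) (sgn² e))

  tr-comm : ∀ x y → tr (x ∙ y) ≈ tr (y ∙ x)
  tr-comm (mat a b c d , _) (mat e f g h , _) =
    solve 8 (λ a b c d e f g h → trP (matP a b c d ∙P matP e f g h) := trP (matP e f g h ∙P matP a b c d))
      refl a b c d e f g h

  Par-comm : ∀ {x y} → Par (x ∙ y) → Par (y ∙ x)
  Par-comm {x} {y} p = par (trans (*-cong (tr-comm y x) (tr-comm y x)) (tr²≈4 p))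

  Par-⁻¹ : ∀ {x} → Par x → Par (x ⁻¹)
  Par-⁻¹ p = par (trans (*-cong (+-comm _ _) (+-comm _ _)) (tr²≈4 p))

  Par-𝟙 : Par 𝟙
  Par-𝟙 = par (solve 0 (p2 :* p2 := p4) refl)

  V : Set c
  V = Carrier × Carrier

  ω : V → V → Carrier
  ω (x , y) (z , w) = x * w - y * z

  abstract
    det-u : ∀ x y s → (1# - s * (x * y)) * (1# + s * (x * y)) - s * (x * x) * - (s * (y * y)) ≈ 1#
    det-u = solve 3 (λ x y s → detP (uP x y s) := p1) refl

  -- u v s = 1 + s v ω(v, ─), so s ↦ u ⟪ d ⟫ s parametrises the root group fixing the point d of P¹.
  u : V → Carrier → SL
  u (x , y) s = mat (1# - s * (x * y)) (s * (x * x)) (- (s * (y * y))) (1# + s * (x * y)) , det-u x y s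

  -- The nilpotent part v ω(v, ─) squares to zero because ω(v,v) = 0, so parameters add.
  u-*ᴹ : ∀ v s r → proj₁ (u v s) *ᴹ proj₁ (u v r) ≈ᴹ proj₁ (u v (s + r))
  u-*ᴹ (x , y) s r = mat≈
    (solve 4 (λ x y s r → p₁₁ (uP x y s ∙P uP x y r) := p₁₁ (uP x y (s :+ r))) refl x y s r)
    (solve 4 (λ x y s r → p₁₂ (uP x y s ∙P uP x y r) := p₁₂ (uP x y (s :+ r))) refl x y s r)
    (solve 4 (λ x y s r → p₂₁ (uP x y s ∙P uP x y r) := p₂₁ (uP x y (s :+ r))) refl x y s r)
    (solve 4 (λ x y s r → p₂₂ (uP x y s ∙P uP x y r) := p₂₂ (uP x y (s :+ r))) refl x y s r)

  u-∙ : ∀ v s r → u v s ∙ u v r ≃ u v (s + r)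
  u-∙ v s r = ≈⇒≃ (u-*ᴹ v s r)

  u-cong : ∀ v {s r} → s ≈ r → u v s ≃ u v r
  u-cong v {s} {r} s≈r = ≈⇒≃ (mat≈ (+-congˡ (-‿cong (*-congʳ s≈r))) (*-congʳ s≈r)
    (-‿cong (*-congʳ s≈r)) (+-congˡ (*-congʳ s≈r)))

  u-0 : ∀ v → u v 0# ≃ 𝟙
  u-0 v@(x , y) = ≈⇒≃ (mat≈
    (solve 2 (λ x y → p₁₁ (uP x y p0) := p1) refl x y)
    (solve 2 (λ x y → p₁₂ (uP x y p0) := p0) refl x y)
    (solve 2 (λ x y → p₂₁ (uP x y p0) := p0) refl x y)
    (solve 2 (λ x y → p₂₂ (uP x y p0) := p1) refl x y))

  u-⁻¹ : ∀ v s → u v s ⁻¹ ≃ u v (- s)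
  u-⁻¹ v@(x , y) s = ≈⇒≃ (mat≈
    (solve 3 (λ x y s → p₁₁ (adjP (uP x y s)) := p₁₁ (uP x y (:- s))) refl x y s)
    (solve 3 (λ x y s → p₁₂ (adjP (uP x y s)) := p₁₂ (uP x y (:- s))) refl x y s)
    (solve 3 (λ x y s → p₂₁ (adjP (uP x y s)) := p₂₁ (uP x y (:- s))) refl x y s)
    (solve 3 (λ x y s → p₂₂ (adjP (uP x y s)) := p₂₂ (uP x y (:- s))) refl x y s))

  Par-u : ∀ v s → Par (u v s)
  Par-u (x , y) s = par (solve 3 (λ x y s → trP (uP x y s) :* trP (uP x y s) := p4) refl x y s)

  -- The cross term is the trace of a product of two matrices of rank one, ω(v,w) ω(w,v) = -ω(v,w)².
  tr-uu : ∀ v r w s → tr (u v r ∙ u w s) ≈ 2# - r * s * (ω v w * ω v w)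
  tr-uu (x , y) r (z , w) s = solve 6 (λ x y r z w s → trP (uP x y r ∙P uP z w s) :=
    p2 :- r :* s :* (ωP x y z w :* ωP x y z w)) refl x y r z w s

  [2-k]²≈4⇒ : ∀ {t k} → t * t ≈ 4# → t ≈ 2# - k → k ≈ 0# ⊎ k ≈ 4#
  [2-k]²≈4⇒ {t} {k} t² t≈ = [ inj₁ , inj₂ ∘ undiff ]′ (xy≈0⇒x≈0⊎y≈0 {k} {k - 4#} (undiff (by₂ 1# (- (t + (2# - k)))
    (solve 2 (λ t k → k :* (k :- p4) :- p0 :- p0 := p1 :* (t :* t :- p4) :+ :- (t :+ (p2 :- k)) :* (t :- (p2 :- k)))
      refl t k) t² t≈)))

  Par-uu : ∀ v r w s → Par (u v r ∙ u w s) → r * s * (ω v w * ω v w) ≈ 0# ⊎ r * s * (ω v w * ω v w) ≈ 4#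
  Par-uu v r w s p = [2-k]²≈4⇒ (tr²≈4 p) (tr-uu v r w s)

  -- Points carry normalised coordinates, so parallel points have equal representatives (`∥⇒≈`) and
  -- the parameter of a root group element depends only on the point.
  data P¹ : Set c where
    ∞   : P¹
    aff : Carrier → P¹

  ⟪_⟫ : P¹ → V
  ⟪ ∞ ⟫     = 1# , 0#
  ⟪ aff t ⟫ = t , 1#

  infix 4 _∥_
  record _∥_ (d e : P¹) : Set ℓ where
    constructor ∥-intro
    field ω≈0 : ω ⟪ d ⟫ ⟪ e ⟫ ≈ 0#
  open _∥_ public

  ∦⇒ω≉0 : ∀ {d e} → ¬ d ∥ e → ¬ ω ⟪ d ⟫ ⟪ e ⟫ ≈ 0#
  ∦⇒ω≉0 d∦e = d∦e ∘ ∥-intro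

  -- A matrix of trace 2 and determinant 1 is 1 + N with N² = 0, hence determined by the line ker N.
  abstract
    Par⇒u : ∀ {g} → Par g → ∃₂ λ d s → g ≃ u ⟪ d ⟫ s
    Par⇒u {g@(mat a b c′ d , det)} p = main (x²≈y²⇒x≈±y (trans (tr²≈4 p) (solve 0 (p4 := p2 :* p2) refl)))
      where
      unip : ∀ {a b c′ d} (det : a * d - b * c′ ≈ 1#) → a + d ≈ 2# → ∃₂ λ e s → mat a b c′ d ≈ᴹ proj₁ (u ⟪ e ⟫ s)
      unip {a} {b} {c′} {d} det tr≈2 with c′ ≟ 0#
      ... | yes c≈0 = ∞ , b , mat≈
              (trans a≈1 (solve 1 (λ b → p1 := p1 :- b :* (p1 :* p0)) refl b))
              (solve 1 (λ b → b := b :* (p1 :* p1)) refl b)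
              (trans c≈0 (solve 1 (λ b → p0 := :- (b :* (p0 :* p0))) refl b))
              (trans d≈1 (solve 1 (λ b → p1 := p1 :+ b :* (p1 :* p0)) refl b))
        where
        [a-1]² : (a - 1#) * (a - 1#) ≈ 0#
        [a-1]² = undiff (by₃ (- 1#) (- b) a
          (solve 4 (λ a b c d → (a :- p1) :* (a :- p1) :- p0 :- p0 := :- p1 :* (a :* d :- b :* c :- p1)
            :+ :- b :* (c :- p0) :+ a :* (a :+ d :- p2)) refl a b c′ d) det c≈0 tr≈2)
        a≈1 : a ≈ 1#
        a≈1 = undiff ([ (λ e → e) , (λ e → e) ]′ (xy≈0⇒x≈0⊎y≈0 [a-1]²))
        d≈1 : d ≈ 1#
        d≈1 = by₂ 1# (- 1#) (solve 2 (λ a d → d :- p1 := p1 :* (a :+ d :- p2) :+ :- p1 :* (a :- p1)) refl a d) tr≈2 a≈1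
      -- The kernel of N is spanned by (t, 1) with t = (a - 1)/c, and the lower left entry of `u`
      -- for such a vector is -s, whence s = -c.
      ... | no c≉0 = aff t , - c′ , mat≈
              (by₁ (1# - a) (solve 3 (λ a c i → a :- (p1 :- :- c :* ((a :- p1) :* i :* p1)) :=
                (p1 :- a) :* (c :* i :- p1)) refl a c′ i) ci)
              (*-cancelˡ c≉0 (by₃ (- 1#) a ((a - 1#) * (a - 1#) * (c′ * i + 1#))
                (solve 5 (λ a b c d i → let t = (a :- p1) :* i in c :* b :- c :* (:- c :* (t :* t)) :=
                  :- p1 :* (a :* d :- b :* c :- p1) :+ a :* (a :+ d :- p2) :+ (a :- p1) :* (a :- p1) :* (c :* i
                  :+ p1) :* (c :* i :- p1)) refl a b c′ d i) det tr≈2 ci))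
              (solve 1 (λ c → c := :- (:- c :* (p1 :* p1))) refl c′)
              (by₂ 1# (a - 1#) (solve 4 (λ a c d i → d :- (p1 :+ :- c :* ((a :- p1) :* i :* p1)) := p1 :* (a :+ d :- p2)
                :+ (a :- p1) :* (c :* i :- p1)) refl a c′ d i) tr≈2 ci)
        where
        i : Carrier
        i = inv c≉0
        ci : c′ * i ≈ 1#
        ci = inv-inverse c≉0
        t : Carrier
        t = (a - 1#) * i

      main : a + d ≈ 2# ⊎ a + d ≈ - 2# → ∃₂ λ e s → g ≃ u ⟪ e ⟫ s
      main (inj₁ tr≈2) = let e , s , eq = unip det tr≈2 in e , s , ≈⇒≃ eq
      main (inj₂ tr≈-2) = let e , s , eq = unip { - a} { - b} { - c′} { - d} det′ tr≈2 in
        e , s , ≃-trans {y = g⁻} (≃-intro (- 1#) (solve 0 (:- p1 :* :- p1 :=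
          p1) refl) (neg a) (neg b) (neg c′) (neg d)) (≈⇒≃ eq)
        where
        det′ : - a * - d - - b * - c′ ≈ 1#
        det′ = trans (solve 4 (λ a b c d → :- a :* :- d :- :- b :* :- c := a :* d :- b :* c) refl a b c′ d) det
        tr≈2 : - a + - d ≈ 2#
        tr≈2 = by₁ (- 1#) (solve 2 (λ a d → :- a :+ :- d :- p2 := :- p1 :* (a :+ d :- :- p2)) refl a d) tr≈-2
        g⁻ : SL
        g⁻ = mat (- a) (- b) (- c′) (- d) , det′
        neg : ∀ x → x ≈ - 1# * - x
        neg = solve 1 (λ x → x := :- p1 :* :- x) refl

-- Adjacency, lines and cliques in PSL(2,q).

module Geometry {c ℓ q} (F : FiniteField c ℓ q) (2∤q : ¬ 2 ∣ q) where
  open FiniteField F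
  open RingProperties ring using (-0#≈0#)
  open FieldTheory F
  open Odd 2∤q
  open MatP
  open ProjectiveSL₂ F 2∤q public
  open Group PSL₂ using () renaming
    (∙-cong to ≃-∙; ∙-congˡ to ≃-∙ˡ; ∙-congʳ to ≃-∙ʳ; assoc to ≃-assoc; identityˡ to ≃-identityˡ; identityʳ to ≃-identityʳ;
     inverseˡ to ≃-inverseˡ; inverseʳ to ≃-inverseʳ; ⁻¹-cong to ≃-⁻¹) public
  open GroupProperties PSL₂ using () renaming
    (⁻¹-anti-homo-∙ to ≃-⁻¹-∙; ⁻¹-involutive to ≃-⁻¹-⁻¹; ∙-cancelˡ to ≃-cancelˡ; ∙-cancelʳ to ≃-cancelʳ; ε⁻¹≈ε to 𝟙⁻¹;
     \\-leftDividesˡ to x∙x⁻¹y; \\-leftDividesʳ to x⁻¹∙xy; //-rightDividesˡ to xy⁻¹∙y; //-rightDividesʳ to xy∙y⁻¹) public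
  module ≃-Reasoning = SetoidReasoning ≃-setoid

  -- This is ω(v, x w). Evaluated on vectors fixed by root groups, it extracts one parameter from an
  -- equation up to sign.
  form : V → SL → V → Carrier
  form (a , b) x (z , w) = a * (x ₂₁ * z + x ₂₂ * w) - b * (x ₁₁ * z + x ₁₂ * w)

  form-≃ : ∀ {x y} (e : x ≃ y) v w → form v x w ≈ sgn e * form v y w
  form-≃ {x} {y} (≃-intro ε ε² p q r s) (a , b) (z , w) = trans
    (+-cong (*-congˡ (+-cong (*-congʳ r) (*-congʳ s))) (-‿cong (*-congˡ (+-cong (*-congʳ p) (*-congʳ q)))))
    (solve 9 (λ ε a b z w x₁ x₂ x₃ x₄ → a :* (ε :* x₃ :* z :+ ε :* x₄ :* w) :- b :* (ε :* x₁ :* z :+ ε :* x₂ :* w)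
       := ε :* (a :* (x₃ :* z :+ x₄ :* w) :- b :* (x₁ :* z :+ x₂ :* w))) refl ε a b z w (y ₁₁) (y ₁₂) (y ₂₁) (y ₂₂))

  -- Equality or adjacency in the Cayley graph modulo ±1.
  infix 4 _↔_
  record _↔_ (x y : SL) : Set ℓ where
    constructor adjacent
    field ratio : Par (y ∙ x ⁻¹)
  open _↔_ public

  ↔-resp : ∀ {x x′ y y′} → x ≃ x′ → y ≃ y′ → x ↔ y → x′ ↔ y′
  ↔-resp x≃ y≃ p = adjacent (Par-resp (≃-∙ y≃ (≃-⁻¹ x≃)) (ratio p))

  ↔-sym : ∀ {x y} → x ↔ y → y ↔ x
  ↔-sym {x} {y} p = adjacent (Par-resp (≃-trans (≃-⁻¹-∙ y (x ⁻¹)) (≃-∙ʳ (≃-⁻¹-⁻¹ x))) (Par-⁻¹ (ratio p)))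

  ↔-refl : ∀ x → x ↔ x
  ↔-refl x = adjacent (Par-resp (≃-sym (≃-inverseʳ x)) Par-𝟙)

  xg∙[yg]⁻¹ : ∀ x y g → (x ∙ g) ∙ (y ∙ g) ⁻¹ ≃ x ∙ y ⁻¹
  xg∙[yg]⁻¹ x y g = begin
    (x ∙ g) ∙ (y ∙ g) ⁻¹     ≈⟨ ≃-∙ˡ (≃-⁻¹-∙ y g) ⟩
    (x ∙ g) ∙ (g ⁻¹ ∙ y ⁻¹)  ≈⟨ ≃-assoc x g _ ⟩
    x ∙ (g ∙ (g ⁻¹ ∙ y ⁻¹))  ≈⟨ ≃-∙ˡ (x∙x⁻¹y g (y ⁻¹)) ⟩
    x ∙ y ⁻¹                 ∎
    where open ≃-Reasoning

  ↔-∙ʳ : ∀ {x y} g → x ↔ y → x ∙ g ↔ y ∙ g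
  ↔-∙ʳ {x} {y} g p = adjacent (Par-resp (≃-sym (xg∙[yg]⁻¹ y x g)) (ratio p))

  ↔-⁻¹ : ∀ {x y} → x ↔ y → x ⁻¹ ↔ y ⁻¹
  ↔-⁻¹ {x} {y} p = adjacent (Par-resp (≃-∙ˡ (≃-sym (≃-⁻¹-⁻¹ x))) (Par-comm (ratio (↔-sym p))))

  -- Left multiplication is right multiplication conjugated by inversion, and inversion preserves
  -- adjacency because traces are cyclic.
  ↔-∙ˡ : ∀ {x y} g → x ↔ y → g ∙ x ↔ g ∙ y
  ↔-∙ˡ {x} {y} g p = ↔-resp (lem x) (lem y) (↔-⁻¹ (↔-∙ʳ (g ⁻¹) (↔-⁻¹ p)))
    where
    lem : ∀ x → (x ⁻¹ ∙ g ⁻¹) ⁻¹ ≃ g ∙ x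
    lem x = ≃-trans (≃-⁻¹-∙ _ _) (≃-∙ (≃-⁻¹-⁻¹ g) (≃-⁻¹-⁻¹ x))

  infix 4 _─[_]─_
  record _─[_]─_ (x : SL) (d : P¹) (y : SL) : Set (c ⊔ ℓ) where
    constructor _by_
    field
      step : Carrier
      y≃ux : y ≃ u ⟪ d ⟫ step ∙ x
  open _─[_]─_ public

  line-resp : ∀ {d x x′ y y′} → x ≃ x′ → y ≃ y′ → x ─[ d ]─ y → x′ ─[ d ]─ y′
  line-resp x≃ y≃ (s by y≃ux) = s by ≃-trans (≃-sym y≃) (≃-trans y≃ux (≃-∙ˡ x≃))

  line-refl : ∀ {d x} → x ─[ d ]─ x
  line-refl {d} {x} = 0# by ≃-sym (≃-trans (≃-∙ʳ (u-0 ⟪ d ⟫)) (≃-identityˡ x))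

  line-trans : ∀ {d x y z} → x ─[ d ]─ y → y ─[ d ]─ z → x ─[ d ]─ z
  line-trans {d} {x} {y} {z} (s by y≃) (r by z≃) = (r + s) by (begin
    z                               ≈⟨ z≃ ⟩
    u ⟪ d ⟫ r ∙ y                   ≈⟨ ≃-∙ˡ y≃ ⟩
    u ⟪ d ⟫ r ∙ (u ⟪ d ⟫ s ∙ x)     ≈⟨ ≃-assoc _ _ x ⟨
    u ⟪ d ⟫ r ∙ u ⟪ d ⟫ s ∙ x       ≈⟨ ≃-∙ʳ (u-∙ ⟪ d ⟫ r s) ⟩
    u ⟪ d ⟫ (r + s) ∙ x             ∎)
    where open ≃-Reasoning

  u-cancel : ∀ v s x → u v (- s) ∙ (u v s ∙ x) ≃ x
  u-cancel v s x = ≃-trans (≃-∙ʳ (≃-sym (u-⁻¹ v s))) (x⁻¹∙xy (u v s) x)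

  line-sym : ∀ {d x y} → x ─[ d ]─ y → y ─[ d ]─ x
  line-sym {d} {x} (s by y≃) = (- s) by ≃-sym (≃-trans (≃-∙ˡ y≃) (u-cancel ⟪ d ⟫ s x))

  u-line : ∀ d s x → x ─[ d ]─ u ⟪ d ⟫ s ∙ x
  u-line d s x = s by ≃-refl

  line⇒↔ : ∀ {d x y} → x ─[ d ]─ y → x ↔ y
  line⇒↔ {d} {x} (s by y≃) = adjacent (Par-resp (≃-sym (≃-trans (≃-∙ʳ y≃) (xy∙y⁻¹ x (u ⟪ d ⟫ s)))) (Par-u ⟪ d ⟫ s))

  ↔⇒line : ∀ {x y} → x ↔ y → ∃ λ d → x ─[ d ]─ y
  ↔⇒line {x} {y} p = let d , s , e = Par⇒u (ratio p) in d , s by ≃-trans (≃-sym (xy⁻¹∙y x y)) (≃-∙ʳ e)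

  -- The trace of u(w,s) u(v,r)⁻¹ is 2 + r s ω(v,w)².
  ↔-uu : ∀ v r w s x → u v r ∙ x ↔ u w s ∙ x → r * s * (ω v w * ω v w) ≈ 0# ⊎ r * s * (ω v w * ω v w) ≈ - 4#
  ↔-uu v@(v₁ , v₂) r w@(w₁ , w₂) s x p = case (Par-uu w s v (- r) (Par-resp (≃-trans (xg∙[yg]⁻¹ (u w s) (u v r) x) (≃-∙ˡ
    (u-⁻¹ v r))) (ratio p)))
    where
    case : s * - r * (ω w v * ω w v) ≈ 0# ⊎ s * - r * (ω w v * ω w v) ≈ 4# → _
    case (inj₁ e) = inj₁ (by₁ (- 1#) (solve 6 (λ v₁ v₂ w₁ w₂ r s → let o = ωP v₁ v₂ w₁ w₂ ; o′ = ωP w₁ w₂ v₁ v₂ in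
      r :* s :* (o :* o) :- p0 := :- p1 :* (s :* :- r :* (o′ :* o′) :- p0)) refl v₁ v₂ w₁ w₂ r s) e)
    case (inj₂ e) = inj₂ (by₁ (- 1#) (solve 6 (λ v₁ v₂ w₁ w₂ r s → let o = ωP v₁ v₂ w₁ w₂ ; o′ = ωP w₁ w₂ v₁ v₂ in
      r :* s :* (o :* o) :- :- p4 := :- p1 :* (s :* :- r :* (o′ :* o′) :- p4)) refl v₁ v₂ w₁ w₂ r s) e)

  uu⇒↔ : ∀ v r w s x → r * s * (ω v w * ω v w) ≈ - 4# → u v r ∙ x ↔ u w s ∙ x
  uu⇒↔ v@(v₁ , v₂) r w@(w₁ , w₂) s x e = adjacent (Par-resp (≃-sym (≃-trans (xg∙[yg]⁻¹ (u w s) (u v r) x) (≃-∙ˡ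
    (u-⁻¹ v r))))
    (par (trans (*-cong tr≈ tr≈) (solve 0 (:- p2 :* :- p2 := p4) refl))))
    where
    tr≈ : tr (u w s ∙ u v (- r)) ≈ - 2#
    tr≈ = trans (tr-uu w s v (- r)) (by₁ 1# (solve 6 (λ v₁ v₂ w₁ w₂ r s →
      let o = ωP v₁ v₂ w₁ w₂ ; o′ = ωP w₁ w₂ v₁ v₂ in
      p2 :- s :* :- r :* (o′ :* o′) :- :- p2 := p1 :* (r :* s :* (o :* o) :- :- p4)) refl v₁ v₂ w₁ w₂ r s) e)

  -- Apply ω(w, ─ w): it vanishes on `u w r`, which fixes w, and equals -s ω(v,w)² on `u v s`.
  u≃u⇒s≈0 : ∀ {v s w r} → ¬ ω v w ≈ 0# → u v s ≃ u w r → s ≈ 0#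
  u≃u⇒s≈0 {v@(v₁ , v₂)} {s} {w@(w₁ , w₂)} {r} ω≉0 e = *-cancelˡ (*-≉0 ω≉0 ω≉0) (by₁ (- 1#)
    (solve 7 (λ v₁ v₂ w₁ w₂ s r ε → let o = ωP v₁ v₂ w₁ w₂ in o :* o :* s :- o :* o :* p0 :=
      :- p1 :* (formP w₁ w₂ (uP v₁ v₂ s) w₁ w₂ :- ε :* formP w₁ w₂ (uP w₁ w₂ r) w₁ w₂))
        refl v₁ v₂ w₁ w₂ s r (sgn e)) (form-≃ e w w))

  two-lines : ∀ {d e x y} → ¬ d ∥ e → x ─[ d ]─ y → x ─[ e ]─ y → x ≃ y
  two-lines {d} {e} {x} {y} d∦e (s by y≃) (r by y≃′) = ≃-sym (≃-trans y≃ (≃-trans (≃-∙ʳ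
    (≃-trans (u-cong ⟪ d ⟫ (u≃u⇒s≈0 {⟪ d ⟫} {s} {⟪ e ⟫} {r} (∦⇒ω≉0 d∦e) (≃-cancelʳ x _ _ (≃-trans (≃-sym y≃) y≃′))))
      (u-0 ⟪ d ⟫))) (≃-identityˡ x)))

  other : P¹ → P¹
  other ∞       = aff 0#
  other (aff _) = ∞

  other-∦ : ∀ d → ¬ d ∥ other d
  other-∦ ∞       (∥-intro e) = 0≉1 (trans (sym e) (solve 0 (p1 :* p1 :- p0 :* p0 := p1) refl))
  other-∦ (aff t) (∥-intro e) = 0≉1 (by₁ 1# (solve 1 (λ t → p0 :- p1 := p1 :* (t :* p0 :- p1 :* p1 :- p0)) refl t) e)

  u≃𝟙⇒s≈0 : ∀ {d s} → u ⟪ d ⟫ s ≃ 𝟙 → s ≈ 0#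
  u≃𝟙⇒s≈0 {d} {s} e = u≃u⇒s≈0 {⟪ d ⟫} {s} {⟪ other d ⟫} {0#} (∦⇒ω≉0 (other-∦ d)) (≃-trans e (≃-sym (u-0 ⟪ other d ⟫)))

  u-injective : ∀ {d s r} → u ⟪ d ⟫ s ≃ u ⟪ d ⟫ r → s ≈ r
  u-injective {d} {s} {r} e = undiff (u≃𝟙⇒s≈0 {d} (≃-trans (≃-sym (u-∙ ⟪ d ⟫ s (- r)))
    (≃-trans (≃-∙ e (≃-sym (u-⁻¹ ⟪ d ⟫ r))) (≃-inverseʳ (u ⟪ d ⟫ r)))))

  ux≃x⇒s≈0 : ∀ {d s x} → u ⟪ d ⟫ s ∙ x ≃ x → s ≈ 0#
  ux≃x⇒s≈0 {d} {s} {x} e = u≃𝟙⇒s≈0 {d} (≃-cancelʳ x _ _ (≃-trans e (≃-sym (≃-identityˡ x))))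

  s≈0⇒ux≃x : ∀ {d s x} → s ≈ 0# → u ⟪ d ⟫ s ∙ x ≃ x
  s≈0⇒ux≃x {d} {s} {x} e = ≃-trans (≃-∙ʳ (≃-trans (u-cong ⟪ d ⟫ e) (u-0 ⟪ d ⟫))) (≃-identityˡ x)

  ∥⇒≈ : ∀ {d e} → d ∥ e → proj₁ ⟪ d ⟫ ≈ proj₁ ⟪ e ⟫ × proj₂ ⟪ d ⟫ ≈ proj₂ ⟪ e ⟫
  ∥⇒≈ {∞} {∞} _ = refl , refl
  ∥⇒≈ {∞} {aff t} (∥-intro e) = ⊥-elim (0≉1 (by₁ (- 1#) (solve 1 (λ t → p0 :- p1 :=
    :- p1 :* (p1 :* p1 :- p0 :* t :- p0)) refl t) e))
  ∥⇒≈ {aff t} {∞} (∥-intro e) = ⊥-elim (0≉1 (by₁ 1# (solve 1 (λ t → p0 :- p1 := p1 :* (t :* p0 :- p1 :* p1 :- p0))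
    refl t) e))
  ∥⇒≈ {aff t} {aff s} (∥-intro e) = by₁ 1# (solve 2 (λ t s → t :- s := p1 :* (t :* p1 :- p1 :* s :- p0))
    refl t s) e , refl

  ∥⇒u : ∀ {d e} s → d ∥ e → u ⟪ d ⟫ s ≃ u ⟪ e ⟫ s
  ∥⇒u s p = let x≈ , y≈ = ∥⇒≈ p in ≈⇒≃ (mat≈ (+-congˡ (-‿cong (*-congˡ (*-cong x≈ y≈)))) (*-congˡ (*-cong x≈ x≈))
    (-‿cong (*-congˡ (*-cong y≈ y≈))) (+-congˡ (*-congˡ (*-cong x≈ y≈))))

  ω-∥ : ∀ {d e} v → d ∥ e → ω ⟪ d ⟫ v ≈ ω ⟪ e ⟫ v
  ω-∥ v p = let x≈ , y≈ = ∥⇒≈ p in +-cong (*-congʳ x≈) (-‿cong (*-congʳ y≈))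

  ω-anti : ∀ v w → ω v w ≈ - ω w v
  ω-anti (a , b) (z , w) = solve 4 (λ a b z w → ωP a b z w := :- ωP z w a b) refl a b z w

  ω≉0-sym : ∀ {v w} → ¬ ω v w ≈ 0# → ¬ ω w v ≈ 0#
  ω≉0-sym {v} {w} p e = p (trans (ω-anti v w) (trans (-‿cong e) -0#≈0#))

  ∥-refl : ∀ d → d ∥ d
  ∥-refl d = ∥-intro (solve 2 (λ x y → ωP x y x y := p0) refl _ _)

  ∥-sym : ∀ {d e} → d ∥ e → e ∥ d
  ∥-sym {d} {e} (∥-intro p) = ∥-intro (trans (ω-anti ⟪ e ⟫ ⟪ d ⟫) (trans (-‿cong p) -0#≈0#))

  ∥-trans : ∀ {d e f} → d ∥ e → e ∥ f → d ∥ f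
  ∥-trans {d} {e} {f} d∥e e∥f = ∥-intro (trans (ω-∥ {d} {e} ⟪ f ⟫ d∥e) (ω≈0 e∥f))

  _∥?_ : ∀ d e → Dec (d ∥ e)
  d ∥? e = map′ ∥-intro ω≈0 (ω ⟪ d ⟫ ⟪ e ⟫ ≟ 0#)

  line-∥ : ∀ {d e x y} → d ∥ e → x ─[ d ]─ y → x ─[ e ]─ y
  line-∥ d∥e (s by y≃) = s by ≃-trans y≃ (≃-∙ʳ (∥⇒u s d∥e))

  line-unique : ∀ {d e x y} → ¬ x ≃ y → x ─[ d ]─ y → x ─[ e ]─ y → d ∥ e
  line-unique {d} {e} x≄y p p′ = decidable-stable (d ∥? e) (λ d∦e → x≄y (two-lines d∦e p p′))

  private
    -- With r = -2 / (s ω(w,v)²) the trace of u(w,s) u(v,r)⁻¹ vanishes.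
    not-all-adjacent : ∀ {v s w x} → ¬ s ≈ 0# → ¬ ω v w ≈ 0# → ∃ λ r → ¬ u v r ∙ x ↔ u w s ∙ x
    not-all-adjacent {v} {s} {w} {x} s≉0 ω≉0 = r , λ p → [ bad₀ , bad₄ ]′ (↔-uu v r w s x p)
      where
      o = ω v w
      k≉0 = *-≉0 s≉0 (*-≉0 ω≉0 ω≉0)
      r = - 2# * inv k≉0
      ki = inv-inverse k≉0
      bad₀ : ¬ r * s * (o * o) ≈ 0#
      bad₀ e = 2≉0 (by₂ (- 1#) (- 2#) (solve 3 (λ s o i → p2 :- p0 := :- p1 :* (:- p2 :* i :* s :* (o :* o) :- p0)
        :+ :- p2 :* (s :* (o :* o) :* i :- p1)) refl s o (inv k≉0)) e ki)
      bad₄ : ¬ r * s * (o * o) ≈ - 4#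
      bad₄ e = 2≉0 (by₂ 1# 2# (solve 3 (λ s o i → p2 :- p0 := p1 :* (:- p2 :* i :* s :* (o :* o) :- :- p4)
        :+ p2 :* (s :* (o :* o) :* i :- p1)) refl s o (inv k≉0)) e ki)

  -- If y were a different point on a line through x, some point of another line through x would be
  -- adjacent to x but not to y. This lets automorphisms of the graph on SL(2,q) descend modulo ±1.
  twin : ∀ {x y} → (∀ z → z ↔ x → z ↔ y) → x ≃ y
  twin {x} {y} sub = let d , on = ↔⇒line (sub x (↔-refl x)) in main d on
    where
    main : ∀ d → x ─[ d ]─ y → x ≃ y
    main d (s by y≃) with s ≟ 0#
    ... | yes s≈0 = ≃-sym (≃-trans y≃ (s≈0⇒ux≃x {d} s≈0))
    ... | no s≉0 = let r , ¬p = not-all-adjacent {⟪ other d ⟫} {s} {⟪ d ⟫} {x} s≉0 (ω≉0-sym {⟪ d ⟫} {⟪ other d ⟫} (∦⇒ω≉0 (other-∦ d))) in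
      ⊥-elim (¬p (↔-resp ≃-refl y≃ (sub _ (↔-sym (line⇒↔ (u-line (other d) r x))))))

  -- If b were reached from a along another direction, it would miss the point of the line at which
  -- the trace of the ratio is 0.
  on-line : ∀ {d a b} → (∀ r → u ⟪ d ⟫ r ∙ a ↔ b) → a ─[ d ]─ b
  on-line {d} {a} {b} adj = let e , on = ↔⇒line (↔-resp (s≈0⇒ux≃x {d} refl) ≃-refl (adj 0#)) in main e on
    where
    main : ∀ e → a ─[ e ]─ b → a ─[ d ]─ b
    main e (s by b≃) with s ≟ 0# | d ∥? e
    ... | yes s≈0 | _ = line-resp ≃-refl (≃-sym (≃-trans b≃ (s≈0⇒ux≃x {e} s≈0))) line-refl
    ... | no _ | yes d∥e = s by ≃-trans b≃ (≃-∙ʳ (≃-sym (∥⇒u s d∥e)))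
    ... | no s≉0 | no d∦e = let r , ¬p = not-all-adjacent {⟪ d ⟫} {s} {⟪ e ⟫} {a} s≉0 (∦⇒ω≉0 d∦e) in
      ⊥-elim (¬p (↔-resp ≃-refl b≃ (adj r)))

  -- Cliques through a point x, each further vertex u(d,r) x recorded as (d , r).
  Neighbour : Set c
  Neighbour = P¹ × Carrier

  pairing : Neighbour → Neighbour → Carrier
  pairing (d , r) (e , s) = r * s * (ω ⟪ d ⟫ ⟪ e ⟫ * ω ⟪ d ⟫ ⟪ e ⟫)

  pairing-sym : ∀ m n → pairing m n ≈ pairing n m
  pairing-sym (d , r) (e , s) = solve 6 (λ a b z w r s → let o = ωP a b z w ; o′ = ωP z w a b in
    r :* s :* (o :* o) := s :* r :* (o′ :* o′)) refl (proj₁ ⟪ d ⟫) (proj₂ ⟪ d ⟫) (proj₁ ⟪ e ⟫) (proj₂ ⟪ e ⟫) r s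

  record Compatible (m n : Neighbour) : Set ℓ where
    constructor compatible
    field
      pair : pairing m n ≈ 0# ⊎ pairing m n ≈ - 4#
      m≉0  : ¬ proj₂ m ≈ 0#
      n≉0  : ¬ proj₂ n ≈ 0#
      m≠n  : proj₁ m ∥ proj₁ n → ¬ proj₂ m ≈ proj₂ n

  open Compatible

  ∦⇒-4 : ∀ {m n} → Compatible m n → ¬ proj₁ m ∥ proj₁ n → pairing m n ≈ - 4#
  ∦⇒-4 C ∦ = [ (λ e → ⊥-elim (*-≉0 (*-≉0 (m≉0 C) (n≉0 C)) (*-≉0 (∦⇒ω≉0 ∦) (∦⇒ω≉0 ∦)) e)) , (λ e → e) ]′ (pair C)

  -- A neighbour of the base point off a line through it is adjacent to at most one further point of
  -- that line, because pairing -4 determines the parameter. So two distinct neighbours of m cannot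
  -- share such a line.
  ∦-spread : ∀ {l m n} → Compatible l m → Compatible l n → Compatible n m →
             ¬ proj₁ l ∥ proj₁ m → ¬ proj₁ l ∥ proj₁ n
  ∦-spread {d , r} {e , s} {f ,
    k} Clm Cln Cnm d∦e d∥f = m≠n Cln d∥f (*-cancelˡ (*-≉0 (n≉0 Clm) (*-≉0 (∦⇒ω≉0 d∦e) (∦⇒ω≉0 d∦e)))
    (begin
      s * (o * o) * r ≈⟨ solve 3 (λ s o r → s :* (o :* o) :* r := r :* s :* (o :* o)) refl s o r ⟩
      r * s * (o * o) ≈⟨ ∦⇒-4 Clm d∦e ⟩
      - 4#            ≈⟨ ∦⇒-4 Cnm (λ (∥-intro p) → d∦e (∥-intro (trans (ω-∥ {d} {f} ⟪ e ⟫ d∥f) p))) ⟨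
      k * s * (o′ * o′) ≈⟨ *-congˡ (*-cong o≈ o≈) ⟨
      k * s * (o * o) ≈⟨ solve 3 (λ s o k → k :* s :* (o :* o) := s :* (o :* o) :* k) refl s o k ⟩
      s * (o * o) * k ∎))
    where
    open SetoidReasoning setoid
    o = ω ⟪ d ⟫ ⟪ e ⟫
    o′ = ω ⟪ f ⟫ ⟪ e ⟫
    o≈ : o ≈ o′
    o≈ = ω-∥ {d} {f} ⟪ e ⟫ d∥f

  abstract
    plücker : ∀ v₁ v₂ v₃ v₄ → ω v₁ v₂ * ω v₃ v₄ - ω v₁ v₃ * ω v₂ v₄ + ω v₁ v₄ * ω v₂ v₃ ≈ 0#
    plücker (a , b) (z , w) (x , y) (e , f) = solve 8 (λ a b z w x y e f →
      ωP a b z w :* ωP x y e f :- ωP a b x y :* ωP z w e f :+ ωP a b e f :* ωP z w x y := p0) refl a b z w x y e f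

  private
    -- Each product of two opposite pairings contains r₁ r₂ r₃ r₄ once; cancelling it leaves squares
    -- of products of ω.
    square-ratio : ∀ r₁ r₂ r₃ r₄ {a b a′ b′} → ¬ r₁ * r₂ * (r₃ * r₄) ≈ 0# →
      r₁ * r₂ * (a * a) ≈ - 4# → r₃ * r₄ * (b * b) ≈ - 4# →
      r₁ * r₃ * (a′ * a′) ≈ - 4# → r₂ * r₄ * (b′ * b′) ≈ - 4# →
      a * b ≈ a′ * b′ ⊎ a * b ≈ - (a′ * b′)
    square-ratio r₁ r₂ r₃ r₄ {a} {b} {a′} {b′} k≉0 e₁ e₂ e₃ e₄ = x²≈y²⇒x≈±y (*-cancelˡ k≉0 (begin
      r₁ * r₂ * (r₃ * r₄) * (a * b * (a * b))     ≈⟨ solve 6 (λ r₁ r₂ r₃ r₄ a b →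
        r₁ :* r₂ :* (r₃ :* r₄) :* (a :* b :* (a :* b)) := r₁ :* r₂ :* (a :* a) :* (r₃ :* r₄ :* (b :* b)))
        refl r₁ r₂ r₃ r₄ a b ⟩
      r₁ * r₂ * (a * a) * (r₃ * r₄ * (b * b))     ≈⟨ *-cong (trans e₁ (sym e₃)) (trans e₂ (sym e₄)) ⟩
      r₁ * r₃ * (a′ * a′) * (r₂ * r₄ * (b′ * b′)) ≈⟨ solve 6 (λ r₁ r₂ r₃ r₄ a b →
        r₁ :* r₃ :* (a :* a) :* (r₂ :* r₄ :* (b :* b)) := r₁ :* r₂ :* (r₃ :* r₄) :* (a :* b :* (a :* b)))
        refl r₁ r₂ r₃ r₄ a′ b′ ⟩
      r₁ * r₂ * (r₃ * r₄) * (a′ * b′ * (a′ * b′)) ∎))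
      where open SetoidReasoning setoid

  3# : Carrier
  3# = 2# + 1#

  private
    -- Of the sign patterns, only P = -Q = R leaves the Plücker sum without forcing a term to vanish
    -- outright; the sum is then 3P.
    signs : ∀ {P Q R} → ¬ P ≈ 0# → ¬ R ≈ 0# → P - Q + R ≈ 0# → P ≈ Q ⊎ P ≈ - Q → P ≈ R ⊎ P ≈ - R → 3# ≈ 0# × P ≈ - Q
    signs {P} {Q} {R} P≉0 R≉0 pl (inj₁ P≈Q) _ = ⊥-elim (R≉0 (by₂ 1# (- 1#)
      (solve 3 (λ P Q R → R :- p0 := p1 :* (P :- Q :+ R :- p0) :+ :- p1 :* (P :- Q)) refl P Q R) pl P≈Q))
    signs {P} {Q} {R} P≉0 R≉0 pl (inj₂ P≈-Q) (inj₂ P≈-R) = ⊥-elim (P≉0 (by₃ 1# 1# (- 1#)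
      (solve 3 (λ P Q R → P :- p0 := p1 :* (P :- Q :+ R :- p0) :+ p1 :* (P :- :- Q) :+ :- p1 :* (P :- :- R))
        refl P Q R) pl P≈-Q P≈-R))
    signs {P} {Q} {R} P≉0 R≉0 pl (inj₂ P≈-Q) (inj₁ P≈R) = [ (λ e → e) , ⊥-elim ∘ P≉0 ]′ (xy≈0⇒x≈0⊎y≈0 (by₃ 1# 1# 1#
      (solve 3 (λ P Q R → (p2 :+ p1) :* P :- p0 := p1 :* (P :- Q :+ R :- p0) :+ p1 :* (P :- :- Q) :+ p1 :* (P :- R))
        refl P Q R) pl P≈-Q P≈R)) , P≈-Q

  private
    o : Neighbour → Neighbour → Carrier
    o m n = ω ⟪ proj₁ m ⟫ ⟪ proj₁ n ⟫

    infix 4 _∦_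
    _∦_ : Neighbour → Neighbour → Set ℓ
    m ∦ n = ¬ proj₁ m ∥ proj₁ n

  -- The three Plücker products agree up to sign, so `signs` applies. The second component pins the
  -- cross-ratio: in characteristic 3 the fourth direction is determined by the other three.
  four-clique : ∀ {n₁ n₂ n₃ n₄} →
    Compatible n₁ n₂ → Compatible n₁ n₃ → Compatible n₁ n₄ → Compatible n₂ n₃ → Compatible n₂ n₄ → Compatible n₃ n₄ →
    n₁ ∦ n₂ → n₁ ∦ n₃ → n₁ ∦ n₄ → n₂ ∦ n₃ → n₂ ∦ n₄ → n₃ ∦ n₄ →
    3# ≈ 0# × o n₁ n₂ * o n₃ n₄ ≈ - (o n₁ n₃ * o n₂ n₄)
  four-clique {d₁ , r₁} {d₂ , r₂} {d₃ , r₃} {d₄ , r₄} C₁₂ C₁₃ C₁₄ C₂₃ C₂₄ C₃₄ ∦₁₂ ∦₁₃ ∦₁₄ ∦₂₃ ∦₂₄ ∦₃₄ =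
    signs (*-≉0 (∦⇒ω≉0 ∦₁₂) (∦⇒ω≉0 ∦₃₄)) (*-≉0 (∦⇒ω≉0 ∦₁₄) (∦⇒ω≉0 ∦₂₃)) (plücker ⟪ d₁ ⟫ ⟪ d₂ ⟫ ⟪ d₃ ⟫ ⟪ d₄ ⟫)
      (square-ratio r₁ r₂ r₃ r₄ k≉0 (∦⇒-4 C₁₂ ∦₁₂) (∦⇒-4 C₃₄ ∦₃₄) (∦⇒-4 C₁₃ ∦₁₃) (∦⇒-4 C₂₄ ∦₂₄))
      (square-ratio r₁ r₂ r₄ r₃ (λ e → k≉0 (trans (*-congˡ (*-comm r₃ r₄)) e)) (∦⇒-4 C₁₂ ∦₁₂)
        (trans (*-congʳ (*-comm r₄ r₃)) (∦⇒-4 C₃₄ ∦₃₄)) (∦⇒-4 C₁₄ ∦₁₄) (∦⇒-4 C₂₃ ∦₂₃))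
    where
    k≉0 = *-≉0 (*-≉0 (m≉0 C₁₂) (n≉0 C₁₂)) (*-≉0 (m≉0 C₃₄) (n≉0 C₃₄))
  -- Multiply the Plücker relation of directions 2, 3, 4, 5 by ω₁₂ and substitute both hypotheses:
  -- only ω₁₂ ω₂₃ ω₄₅ survives.
  five-clique : ∀ {n₁ n₂ n₃ n₄ n₅} → n₂ ∦ n₃ → n₁ ∦ n₂ →
    o n₁ n₂ * o n₃ n₄ ≈ - (o n₁ n₃ * o n₂ n₄) → o n₁ n₂ * o n₃ n₅ ≈ - (o n₁ n₃ * o n₂ n₅) → o n₄ n₅ ≈ 0#
  five-clique {d₁ , _} {d₂ , _} {d₃ , _} {d₄ , _} {d₅ , _} ∦₂₃ ∦₁₂ e₄ e₅ = [ ⊥-elim ∘ *-≉0 (∦⇒ω≉0 ∦₁₂) (∦⇒ω≉0 ∦₂₃) ,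
    (λ e → e) ]′ (xy≈0⇒x≈0⊎y≈0
    (by₃ (ω v₁ v₂) (- ω v₂ v₅) (ω v₂ v₄)
      (solve 8 (λ a₁₂ a₁₃ a₂₃ a₂₄ a₂₅ a₃₄ a₃₅ a₄₅ → a₁₂ :* a₂₃ :* a₄₅ :- p0 :=
        a₁₂ :* (a₂₃ :* a₄₅ :- a₂₄ :* a₃₅ :+ a₂₅ :* a₃₄ :- p0) :+ :- a₂₅ :* (a₁₂ :* a₃₄ :- :- (a₁₃ :* a₂₄))
          :+ a₂₄ :* (a₁₂ :* a₃₅ :- :- (a₁₃ :* a₂₅)))
        refl (ω v₁ v₂) (ω v₁ v₃) (ω v₂ v₃) (ω v₂ v₄) (ω v₂ v₅) (ω v₃ v₄) (ω v₃ v₅) (ω v₄ v₅))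
      (plücker v₂ v₃ v₄ v₅) e₄ e₅))
    where v₁ = ⟪ d₁ ⟫ ; v₂ = ⟪ d₂ ⟫ ; v₃ = ⟪ d₃ ⟫ ; v₄ = ⟪ d₄ ⟫ ; v₅ = ⟪ d₅ ⟫

-- Embeddings of the graph preserve lines.

module LinePreservation {c ℓ q} (F : FiniteField c ℓ q) (2∤q : ¬ 2 ∣ q) (5≤q : 5 ℕ.≤ q) where
  open FiniteField F
  open FieldTheory F
  open Odd 2∤q
  open Geometry F 2∤q
  private module E = Inverse cardinality

  private
    -- For q = 5 also 5 = 0, and then 2 = 0. The strict bound supplies a fifth nonzero parameter on
    -- a line in characteristic 3.
    3≈0⇒5<q : 3# ≈ 0# → 5 ℕ.< q
    3≈0⇒5<q 3≈0 = ℕₚ.≤∧≢⇒< 5≤q (λ { ≡.refl → 2≉0 (by₂ 1# (- 1#)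
      (solve 0 (p2 :- p0 := p1 :* (p1 :+ (p1 :+ (p1 :+ (p1 :+ (p1 :+ p0)))) :- p0) :+ :- p1 :* (p2 :+ p1 :- p0)) refl)
      (q×1≈0 F) 3≈0) })

  record Embedding (φ : SL → SL) : Set (c ⊔ ℓ) where
    field
      cong      : ∀ {x y} → x ≃ y → φ x ≃ φ y
      injective : ∀ {x y} → φ x ≃ φ y → x ≃ y
      adjacency : ∀ {x y} → x ↔ y → φ x ↔ φ y

  -- Lines have q ≥ 5 points, whereas a clique containing a non-collinear triangle has at most
  -- four vertices, or five in characteristic 3.
  module _ {φ} (Φ : Embedding φ) where
    open Embedding Φ
    module _ (d : P¹) (x : SL) where
      private
        pt : Carrier → SL
        pt k = u ⟪ d ⟫ k ∙ x

        img : ∀ k → ∃ λ e → φ x ─[ e ]─ φ (pt k)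
        img k = ↔⇒line (adjacency (line⇒↔ (u-line d k x)))

        nb : Carrier → Neighbour
        nb k = proj₁ (img k) , step (proj₂ (img k))

        nb-≃ : ∀ k → φ (pt k) ≃ u ⟪ proj₁ (nb k) ⟫ (proj₂ (nb k)) ∙ φ x
        nb-≃ k = y≃ux (proj₂ (img k))

        nb≉0 : ∀ {k} → ¬ k ≈ 0# → ¬ proj₂ (nb k) ≈ 0#
        nb≉0 {k} k≉0 r≈0 = k≉0 (ux≃x⇒s≈0 {d} (injective (≃-trans (nb-≃ k) (s≈0⇒ux≃x {proj₁ (nb k)} r≈0))))

        compat : ∀ {k l} → ¬ k ≈ 0# → ¬ l ≈ 0# → ¬ k ≈ l → Compatible (nb k) (nb l)
        compat {k} {l} k≉0 l≉0 k≉l = compatible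
          (↔-uu ⟪ proj₁ (nb k) ⟫ (proj₂ (nb k)) ⟪ proj₁ (nb l) ⟫ (proj₂ (nb l)) (φ x) (↔-resp (nb-≃ k) (nb-≃ l)
            (adjacency (line⇒↔ (line-trans (line-sym (u-line d k x)) (u-line d l x))))))
          (nb≉0 k≉0) (nb≉0 l≉0)
          (λ p e → k≉l (u-injective {d} (≃-cancelʳ x _ _ (injective (≃-trans (nb-≃ k) (≃-trans
            (≃-∙ʳ (≃-trans (∥⇒u (proj₂ (nb k)) p) (u-cong ⟪ proj₁ (nb l) ⟫ e))) (≃-sym (nb-≃ l))))))))

        infix 4 _#_
        _#_ : Carrier → Carrier → Set ℓ
        k # l = ¬ proj₁ (nb k) ∥ proj₁ (nb l)

        #-sym : ∀ {k l} → k # l → l # k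
        #-sym k#l p = k#l (∥-sym p)

        ≉-sym : ∀ {k l} → ¬ k ≈ l → ¬ l ≈ k
        ≉-sym k≉l e = k≉l (sym e)

        #-spread : ∀ {k l m} → ¬ k ≈ 0# → ¬ l ≈ 0# → ¬ m ≈ 0# → ¬ k ≈ l → ¬ k ≈ m → ¬ m ≈ l → k # l → k # m
        #-spread k l m kl km ml = ∦-spread (compat k l kl) (compat k m km) (compat m l ml)

        four : ∀ {k l m n} → ¬ k ≈ 0# → ¬ l ≈ 0# → ¬ m ≈ 0# → ¬ n ≈ 0# →
          ¬ l ≈ k → ¬ m ≈ k → ¬ m ≈ l → ¬ n ≈ k → ¬ n ≈ l → ¬ n ≈ m → k # l →
          3# ≈ 0# × ω ⟪ proj₁ (nb k) ⟫ ⟪ proj₁ (nb l) ⟫ * ω ⟪ proj₁ (nb m) ⟫ ⟪ proj₁ (nb n) ⟫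
                 ≈ - (ω ⟪ proj₁ (nb k) ⟫ ⟪ proj₁ (nb m) ⟫ * ω ⟪ proj₁ (nb l) ⟫ ⟪ proj₁ (nb n) ⟫)
        four k l m n lk mk ml nk nl nm k#l =
          four-clique (compat k l (≉-sym lk)) (compat k m (≉-sym mk)) (compat k n (≉-sym nk))
            (compat l m (≉-sym ml)) (compat l n (≉-sym nl)) (compat m n (≉-sym nm))
            k#l k#m (#-spread k l n (≉-sym lk) (≉-sym nk) nl k#l)
            (#-spread l k m lk (≉-sym ml) mk (#-sym k#l)) (#-spread l k n lk (≉-sym nl) nk (#-sym k#l))
            (#-spread m k n mk (≉-sym nm) nk (#-sym k#m))
          where k#m = #-spread k l m (≉-sym lk) (≉-sym mk) ml k#l

        -- One non-collinear pair makes all directions of the image pairwise distinct. Four nonzero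
        -- parameters then force 3 = 0, and the fifth one available there repeats a direction by
        -- `five-clique`.
        collinear : ∀ {k l} → ¬ k ≈ 0# → ¬ l ≈ 0# → ¬ l ≈ k → ¬ k # l
        collinear {k}
          {l} k≉0 l≉0 l≉k k#l = stage₁ (fresh (0# ∷ k ∷ l ∷ []) (ℕₚ.≤-trans (s≤s (s≤s (s≤s (s≤s z≤n)))) 5≤q))
          where
          stage₃ : ∀ {m n} → ¬ m ≈ 0# → ¬ n ≈ 0# → ¬ m ≈ k → ¬ m ≈ l → ¬ n ≈ k → ¬ n ≈ l →
            ω ⟪ proj₁ (nb k) ⟫ ⟪ proj₁ (nb l) ⟫ * ω ⟪ proj₁ (nb m) ⟫ ⟪ proj₁ (nb n) ⟫ ≈ - (ω ⟪ proj₁ (nb k) ⟫ ⟪ proj₁ (nb m) ⟫ * ω ⟪ proj₁ (nb l) ⟫ ⟪ proj₁ (nb n) ⟫) →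
            (∃ λ o → All (λ x → ¬ o ≈ x) (0# ∷ k ∷ l ∷ m ∷ n ∷ [])) → ⊥
          stage₃ {m} {n} m≉0 n≉0 mk ml nk nl e₄ (o , o≉0 ∷ ok ∷ ol ∷ om ∷ on ∷ []) =
            #-spread n≉0 k≉0 o≉0 nk (≉-sym on) ok
              (#-sym (#-spread k≉0 l≉0 n≉0 (≉-sym l≉k) (≉-sym nk) nl k#l))
              (∥-intro (five-clique {nb k} {nb l} {nb m} {nb n}
                {nb o} (#-spread l≉0 k≉0 m≉0 l≉k (≉-sym ml) mk (#-sym k#l)) k#l e₄
                (proj₂ (four k≉0 l≉0 m≉0 o≉0 l≉k mk ml ok ol om k#l))))

          stage₂ : ∀ {m} → ¬ m ≈ 0# → ¬ m ≈ k → ¬ m ≈ l → (∃ λ n → All (λ x → ¬ n ≈ x) (0# ∷ k ∷ l ∷ m ∷ [])) → ⊥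
          stage₂ {m} m≉0 mk ml (n , n≉0 ∷ nk ∷ nl ∷ nm ∷ []) =
            let 3≈0 , e₄ = four k≉0 l≉0 m≉0 n≉0 l≉k mk ml nk nl nm k#l in
            stage₃ m≉0 n≉0 mk ml nk nl e₄ (fresh (0# ∷ k ∷ l ∷ m ∷ n ∷ []) (3≈0⇒5<q 3≈0))

          stage₁ : (∃ λ m → All (λ x → ¬ m ≈ x) (0# ∷ k ∷ l ∷ [])) → ⊥
          stage₁ (m , m≉0 ∷ mk ∷ ml ∷ []) = stage₂ m≉0 mk ml (fresh (0# ∷ k ∷ l ∷ m ∷ []) 5≤q)

      preserves-lines : ∀ {e y z} → ¬ x ≃ y → x ─[ d ]─ y → φ x ─[ e ]─ φ y → x ─[ d ]─ z → φ x ─[ e ]─ φ z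
      preserves-lines {e} {y} {z} x≄y (k by y≃) φy (l by z≃) with l ≟ 0# | l ≟ k
      ... | yes l≈0 | _ = line-resp ≃-refl (cong (≃-sym (≃-trans z≃ (s≈0⇒ux≃x {d} l≈0)))) line-refl
      ... | no _ | yes l≈k = line-resp ≃-refl (cong (≃-trans y≃ (≃-trans (≃-∙ʳ (u-cong ⟪ d ⟫ (sym l≈k)))
        (≃-sym z≃)))) φy
      ... | no l≉0 | no l≉k = line-∥ l∥e (line-resp ≃-refl (cong (≃-sym z≃)) (proj₂ (img l)))
        where
        k≉0 : ¬ k ≈ 0#
        k≉0 k≈0 = x≄y (≃-sym (≃-trans y≃ (s≈0⇒ux≃x {d} k≈0)))
        k∥e : proj₁ (nb k) ∥ e
        k∥e = line-unique (λ eq → x≄y (injective eq)) (line-resp ≃-refl (cong (≃-sym y≃)) (proj₂ (img k))) φy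
        k∥l : proj₁ (nb k) ∥ proj₁ (nb l)
        k∥l = decidable-stable (_ ∥? _) (collinear k≉0 l≉0 l≉k)
        l∥e : proj₁ (nb l) ∥ e
        l∥e = ∥-trans (∥-sym k∥l) k∥e

-- Transitive abelian actions and the count of lines through 𝟙.

module Translations {c ℓ q} (F : FiniteField c ℓ q) (2∤q : ¬ 2 ∣ q) (5≤q : 5 ℕ.≤ q) where
  open FiniteField F hiding (zero)
  open FieldTheory F
  open Odd 2∤q
  open Geometry F 2∤q
  open LinePreservation F 2∤q 5≤q
  private module E = Inverse cardinality

  -- The group K as seen modulo ±1, where distinct elements may act alike; hence commuting
  -- invertible maps indexed by a type in place of a group.
  record AbelianAction (ι : Level) : Set (c ⊔ ℓ ⊔ Level.suc ι) where
    field
      Index    : Set ι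
      act      : Index → SL → SL
      act⁻¹    : Index → SL → SL
      act-cong : ∀ i {x y} → x ≃ y → act i x ≃ act i y
      act⁻¹-cong : ∀ i {x y} → x ≃ y → act⁻¹ i x ≃ act⁻¹ i y
      act-↔    : ∀ i {x y} → x ↔ y → act i x ↔ act i y
      act⁻¹-↔  : ∀ i {x y} → x ↔ y → act⁻¹ i x ↔ act⁻¹ i y
      act-comm : ∀ i j x → act i (act j x) ≃ act j (act i x)
      act⁻¹-act : ∀ i x → act⁻¹ i (act i x) ≃ x
      act-act⁻¹ : ∀ i x → act i (act⁻¹ i x) ≃ x
      transitive : ∀ x y → ∃ λ i → act i x ≃ y

    act-embedding : ∀ i → Embedding (act i)
    act-embedding i = record
      { cong = act-cong i
      ; injective = λ {x} {y} e → ≃-trans (≃-sym (act⁻¹-act i x)) (≃-trans (act⁻¹-cong i e) (act⁻¹-act i y))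
      ; adjacency = act-↔ i }

    act⁻¹-embedding : ∀ i → Embedding (act⁻¹ i)
    act⁻¹-embedding i = record
      { cong = act⁻¹-cong i
      ; injective = λ {x} {y} e → ≃-trans (≃-sym (act-act⁻¹ i x)) (≃-trans (act-cong i e) (act-act⁻¹ i y))
      ; adjacency = act⁻¹-↔ i }

    act-injective : ∀ i {x y} → act i x ≃ act i y → x ≃ y
    act-injective i = Embedding.injective (act-embedding i)

    act⁻¹-injective : ∀ i {x y} → act⁻¹ i x ≃ act⁻¹ i y → x ≃ y
    act⁻¹-injective i = Embedding.injective (act⁻¹-embedding i)

    act-comm⁻¹ : ∀ i j x → act i (act⁻¹ j x) ≃ act⁻¹ j (act i x)
    act-comm⁻¹ i j x = act-injective j (≃-trans (act-comm j i _)
      (≃-trans (act-cong i (act-act⁻¹ j x)) (≃-sym (act-act⁻¹ j (act i x)))))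

    to : SL → Index
    to x = proj₁ (transitive 𝟙 x)

    act-to : ∀ x → act (to x) 𝟙 ≃ x
    act-to x = proj₂ (transitive 𝟙 x)

    record Central (f : SL → SL) : Set (c ⊔ ℓ ⊔ ι) where
      constructor central
      field
        cong     : ∀ {x y} → x ≃ y → f x ≃ f y
        commutes : ∀ k x → f (act k x) ≃ act k (f x)

    central-id : Central (λ x → x)
    central-id = central (λ e → e) (λ _ _ → ≃-refl)

    central-act : ∀ i → Central (act i)
    central-act i = central (act-cong i) (act-comm i)

    central-act⁻¹ : ∀ i → Central (act⁻¹ i)
    central-act⁻¹ i = central (act⁻¹-cong i) (λ k x → ≃-sym (act-comm⁻¹ k i x))

    central-∘ : ∀ {f g} → Central f → Central g → Central (λ x → f (g x))
    central-∘ f g = central (λ e → F.cong (G.cong e)) (λ k x → ≃-trans (F.cong (G.commutes k x)) (F.commutes k _))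
      where
      module F = Central f
      module G = Central g

    -- Transitivity carries one coincidence to every point. This is the regularity of a transitive
    -- abelian group, stated for all maps commuting with it.
    agree : ∀ {f g x} → Central f → Central g → f x ≃ g x → ∀ y → f y ≃ g y
    agree {f} {g} {x} f-central g-central e y = let k , kx≃y = transitive x y in begin
      f y         ≈⟨ F.cong kx≃y ⟨
      f (act k x) ≈⟨ F.commutes k x ⟩
      act k (f x) ≈⟨ act-cong k e ⟩
      act k (g x) ≈⟨ G.commutes k x ⟨
      g (act k x) ≈⟨ G.cong kx≃y ⟩
      g y         ∎
      where
      open ≃-Reasoning
      module F = Central f-central
      module G = Central g-central

    free : ∀ {i x} → act i x ≃ x → ∀ y → act i y ≃ y
    free {i} = agree (central-act i) central-id

    act-lines : ∀ i {d e x y z} → ¬ x ≃ y → x ─[ d ]─ y → act i x ─[ e ]─ act i y → x ─[ d ]─ z →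
      act i x ─[ e ]─ act i z
    act-lines i {d} {e} {x} = preserves-lines (act-embedding i) d x

    act⁻¹-lines : ∀ i {d e x y z} → ¬ x ≃ y → x ─[ d ]─ y → act⁻¹ i x ─[ e ]─ act⁻¹ i y → x ─[ d ]─ z →
      act⁻¹ i x ─[ e ]─ act⁻¹ i z
    act⁻¹-lines i {d} {e} {x} = preserves-lines (act⁻¹-embedding i) d x

    record Slides (i : Index) (x : SL) (d : P¹) : Set (c ⊔ ℓ) where
      field
        moves  : ¬ x ≃ act i x
        along  : x ─[ d ]─ act i x
        stable : ∀ {z} → x ─[ d ]─ z → x ─[ d ]─ act i z

    -- A member of the action taking x to y commutes with i and carries the line through x to one
    -- through y, so i slides along the latter.
    slides-everywhere : ∀ {i x d} → Slides i x d → ∀ y → ∃ λ e → Slides i y e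
    slides-everywhere {i} {x} {d} sl y = e , record { moves = moves′ ; along = along′ ; stable = stable′ }
      where
      open Slides sl
      k = proj₁ (transitive x y)
      kx≃y = proj₂ (transitive x y)
      k⁻y≃x : act⁻¹ k y ≃ x
      k⁻y≃x = ≃-trans (act⁻¹-cong k (≃-sym kx≃y)) (act⁻¹-act k x)
      kix≃iy : act k (act i x) ≃ act i y
      kix≃iy = ≃-trans (act-comm k i x) (act-cong i kx≃y)
      k⁻iy≃ix : act⁻¹ k (act i y) ≃ act i x
      k⁻iy≃ix = ≃-trans (act⁻¹-cong k (≃-sym kix≃iy)) (act⁻¹-act k _)
      edge : ∃ λ e → y ─[ e ]─ act i y
      edge = ↔⇒line (↔-resp kx≃y kix≃iy (act-↔ k (line⇒↔ along)))
      e = proj₁ edge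
      along′ : y ─[ e ]─ act i y
      along′ = proj₂ edge
      moves′ : ¬ y ≃ act i y
      moves′ eq = moves (≃-sym (free (≃-sym eq) x))
      stable′ : ∀ {z} → y ─[ e ]─ z → y ─[ e ]─ act i z
      stable′ {z} on = line-resp kx≃y (≃-trans (act-comm k i _) (act-cong i (act-act⁻¹ k z)))
        (act-lines k moves along (line-resp (≃-sym kx≃y) (≃-sym kix≃iy) along′)
          (stable (line-resp k⁻y≃x ≃-refl (act⁻¹-lines k moves′ along′ (line-resp (≃-sym k⁻y≃x)
            (≃-sym k⁻iy≃ix) along) on))))

    -- If no element slides along a line, the q translates back to 𝟙 of a line ℓ through 𝟙 are distinct
    -- and miss some w among the q + 1 lines through 𝟙; then w and a translate of w are both missed.
    module _ (none : ∀ i d → ¬ Slides i 𝟙 d) where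
      private
        pt : P¹ → Carrier → SL
        pt d s = u ⟪ d ⟫ s

        on-d : ∀ d s → 𝟙 ─[ d ]─ pt d s
        on-d d s = s by ≃-sym (≃-identityʳ (pt d s))

        pt-line : ∀ d s r → pt d s ─[ d ]─ pt d r
        pt-line d s r = line-trans (line-sym (on-d d s)) (on-d d r)

        k : P¹ → Carrier → Index
        k d s = to (pt d s)

        back : ∀ d s → act⁻¹ (k d s) (pt d s) ≃ 𝟙
        back d s = ≃-trans (act⁻¹-cong (k d s) (≃-sym (act-to (pt d s)))) (act⁻¹-act (k d s) 𝟙)

        s≄s+1 : ∀ d s → ¬ pt d s ≃ pt d (s + 1#)
        s≄s+1 d s e = 0≉1 (by₁ 1# (solve 1 (λ s → p0 :- p1 := p1 :* (s :- (s :+ p1))) refl s) (u-injective {d} e))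

        image : ∀ d s → ∃ λ e → 𝟙 ─[ e ]─ act⁻¹ (k d s) (pt d (s + 1#))
        image d s = ↔⇒line (↔-resp (back d s) ≃-refl (act⁻¹-↔ (k d s) (line⇒↔ (pt-line d s (s + 1#)))))

        abstract
          -- The direction of the line through 𝟙 obtained by pulling line d back along the element
          -- taking 𝟙 to `pt d s`; the parameter s + 1 supplies a second point of that line.
          D : P¹ → Carrier → P¹
          D d s = proj₁ (image d s)

          D-image : ∀ d s → 𝟙 ─[ D d s ]─ act⁻¹ (k d s) (pt d (s + 1#))
          D-image d s = proj₂ (image d s)

        D-spec : ∀ d s {z} → 𝟙 ─[ d ]─ z → 𝟙 ─[ D d s ]─ act⁻¹ (k d s) z
        D-spec d s on = line-resp (back d s) ≃-refl (act⁻¹-lines (k d s) (s≄s+1 d s) (pt-line d s (s + 1#))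
          (line-resp (≃-sym (back d s)) ≃-refl (D-image d s)) (line-trans (line-sym (on-d d s)) on))

        D-inverse : ∀ e s {w} → 𝟙 ─[ D e s ]─ w → 𝟙 ─[ e ]─ act (k e s) w
        D-inverse e s {w} on = line-trans (on-d e s) (line-resp (act-to (pt e s)) ≃-refl forth)
          where
          p : SL
          p = act⁻¹ (k e s) (pt e (s + 1#))
          𝟙≄p : ¬ 𝟙 ≃ p
          𝟙≄p eq = s≄s+1 e s (act⁻¹-injective (k e s) (≃-trans (back e s) eq))
          edge : act (k e s) 𝟙 ─[ e ]─ act (k e s) p
          edge = line-resp (≃-sym (act-to (pt e s))) (≃-sym (act-act⁻¹ (k e s) (pt e (s + 1#)))) (pt-line e s (s + 1#))
          forth : act (k e s) 𝟙 ─[ e ]─ act (k e s) w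
          forth = act-lines (k e s) {D e s} {e} {𝟙} {p} {w} 𝟙≄p (D-image e s) edge on

        transfer : ∀ {d e s r} → D d s ∥ D e r → ∀ {z} → 𝟙 ─[ d ]─ z → 𝟙 ─[ e ]─ act (k e r) (act⁻¹ (k d s) z)
        transfer {d} {e} {s} {r} p on = D-inverse e r (line-∥ p (D-spec d s on))

        -- If two pullbacks coincide, the quotient of the two elements stabilises line d and moves 𝟙
        -- along it, which is a slide.
        D-injective : ∀ {d s r} → ¬ s ≈ r → ¬ D d s ∥ D d r
        D-injective {d} {s} {r} s≉r p = none i d record { moves = moves ; along = along ; stable = stable }
          where
          f : SL → SL
          f y = act (k d r) (act⁻¹ (k d s) y)
          i : Index
          i = to (f 𝟙)
          i≃f : ∀ y → act i y ≃ f y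
          i≃f = agree {act i} {f}
            {𝟙} (central-act i) (central-∘ (central-act (k d r)) (central-act⁻¹ (k d s))) (act-to (f 𝟙))
          f-s≃r : f (pt d s) ≃ pt d r
          f-s≃r = ≃-trans (act-cong (k d r) (back d s)) (act-to (pt d r))
          moves : ¬ 𝟙 ≃ act i 𝟙
          moves eq = s≉r (u-injective {d} {s} {r} (≃-trans (≃-sym (free {i} {𝟙} (≃-sym eq) (pt d s)))
            (≃-trans (i≃f (pt d s)) f-s≃r)))
          along : 𝟙 ─[ d ]─ act i 𝟙
          along = line-resp ≃-refl (≃-sym (i≃f 𝟙)) (transfer p line-refl)
          stable : ∀ {z} → 𝟙 ─[ d ]─ z → 𝟙 ─[ d ]─ act i z
          stable {z} on = line-resp ≃-refl (≃-sym (i≃f z)) (transfer p on)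

        Hit : P¹ → Set ℓ
        Hit w = ∃ λ j → D ∞ (E.from j) ∥ w

        -- A common pullback yields f in K taking line w to line ∞. Since f 𝟙 is a point of line ∞,
        -- f is by `agree` one of the elements defining `D ∞`, and pulling line ∞ back along it
        -- gives w.
        hit-translate : ∀ {w s r} → D w s ∥ D ∞ r → Hit w
        hit-translate {w} {s} {r} p = E.to σ , line-unique 𝟙≄z
          (line-resp ≃-refl (f≃id z) (D-spec ∞ σ′ (transfer p (on-d w 1#)))) (on-d w 1#)
          where
          f : SL → SL
          f y = act (k ∞ r) (act⁻¹ (k w s) y)
          base : 𝟙 ─[ ∞ ]─ f 𝟙
          base = transfer p line-refl
          σ = step base
          σ′ = E.from (E.to σ)
          z = pt w 1#
          f≃id : ∀ y → act⁻¹ (k ∞ σ′) (f y) ≃ y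
          f≃id = agree {λ y → act⁻¹ (k ∞ σ′) (f y)} {λ y →
            y} {𝟙} (central-∘ (central-act⁻¹ (k ∞ σ′)) (central-∘ (central-act (k ∞ r)) (central-act⁻¹ (k w s)))) central-id
            (≃-trans (act⁻¹-cong (k ∞ σ′) (≃-trans (y≃ux base) (≃-trans (≃-identityʳ _) (u-cong ⟪ ∞ ⟫
              (sym (E.inverseʳ ≡.refl))))))
              (back ∞ σ′))
          𝟙≄z : ¬ 𝟙 ≃ z
          𝟙≄z eq = 0≉1 (sym (u≃𝟙⇒s≈0 {w} (≃-sym eq)))

        D-self : ∀ {w} → ¬ w ∥ D w 1#
        D-self {w} p = D-injective {w} 0≉1 (∥-trans D0∥w p)
          where
          id : ∀ y → act⁻¹ (k w 0#) y ≃ y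
          id = agree {act⁻¹ (k w 0#)} {λ y → y} {𝟙} (central-act⁻¹ (k w 0#)) central-id (≃-trans (act⁻¹-cong (k w 0#)
            (≃-sym (u-0 ⟪ w ⟫))) (back w 0#))
          D0∥w : D w 0# ∥ w
          D0∥w = line-unique (λ eq → 0≉1 (sym (u≃𝟙⇒s≈0 {w} (≃-sym eq))))
            (line-resp ≃-refl (id _) (D-spec w 0# (on-d w 1#))) (on-d w 1#)

        from-injective : ∀ {j j′} → E.from j ≈ E.from j′ → j ≡ j′
        from-injective e = ≡.trans (≡.sym (E.inverseˡ refl)) (≡.trans (E.to-cong e) (E.inverseˡ refl))

        code : P¹ → Fin (suc q)
        code ∞       = zero
        code (aff t) = suc (E.to t)

        code-injective : ∀ d e → code d ≡ code e → d ∥ e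
        code-injective ∞ ∞ _ = ∥-refl ∞
        code-injective (aff t) (aff s) eq = ∥-intro (by₁ 1# (solve 2 (λ t s → t :* p1 :- p1 :* s :- p0 :=
          p1 :* (t :- s)) refl t s)
          (E-injective (Finₚ.suc-injective eq)))

        decode : Fin (suc q) → P¹
        decode zero    = ∞
        decode (suc j) = aff (E.from j)

        decode-injective : ∀ m n → decode m ∥ decode n → m ≡ n
        decode-injective zero zero _ = ≡.refl
        decode-injective zero (suc n) p = ⊥-elim (0≉1 (proj₂ (∥⇒≈ p)))
        decode-injective (suc m) zero p = ⊥-elim (0≉1 (sym (proj₂ (∥⇒≈ p))))
        decode-injective (suc m) (suc n) p = ≡.cong suc (from-injective (proj₁ (∥⇒≈ p)))

        missed : ∃ λ w → ¬ Hit w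
        missed with Finₚ.any? (λ m → ¬? (Finₚ.any? (λ j → D ∞ (E.from j) ∥? decode m)))
        ... | yes (m , ¬hit) = decode m , ¬hit
        ... | no ¬∃ = ⊥-elim (collide (Finₚ.pigeonhole ℕₚ.≤-refl (λ m → proj₁ (hits m))))
          where
          hits : ∀ m → Hit (decode m)
          hits m = decidable-stable (Finₚ.any? (λ j → D ∞ (E.from j) ∥? decode m)) (λ ¬hit → ¬∃ (m , ¬hit))
          collide : (∃₂ λ m n → m Fin.< n × proj₁ (hits m) ≡ proj₁ (hits n)) → ⊥
          collide (m , n , m<n , eq) = Finₚ.<-irrefl (decode-injective m n (∥-trans (∥-sym (proj₂ (hits m)))
            (≡.subst (λ j → D ∞ (E.from j) ∥ decode n) (≡.sym eq) (proj₂ (hits n))))) m<n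

      not-slide-free : ⊥
      not-slide-free = let w , w-missed = missed in collide w w-missed (Finₚ.pigeonhole ℕₚ.≤-refl (λ m →
        code (lines w m)))
        where
        lines : P¹ → Fin (suc (suc q)) → P¹
        lines w zero          = w
        lines w (suc zero)    = D w 1#
        lines w (suc (suc j)) = D ∞ (E.from j)
        distinct : ∀ w → ¬ Hit w → ∀ m n → m Fin.< n → ¬ lines w m ∥ lines w n
        distinct w ¬hit zero          (suc zero)    _ p = D-self p
        distinct w ¬hit zero          (suc (suc j)) _ p = ¬hit (j , ∥-sym p)
        distinct w ¬hit (suc zero)    (suc zero)    (s≤s ())
        distinct w ¬hit (suc zero)    (suc (suc j)) _ p = ¬hit (hit-translate p)
        distinct w ¬hit (suc (suc i)) (suc zero)    (s≤s ())
        distinct w ¬hit (suc (suc i)) (suc (suc j)) (s≤s (s≤s i<j)) p = D-injective (λ e →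
          Finₚ.<-irrefl (from-injective e) i<j) p
        collide : ∀ w → ¬ Hit w → (∃₂ λ m n → m Fin.< n × code (lines w m) ≡ code (lines w n)) → ⊥
        collide w ¬hit (m , n , m<n , eq) = distinct w ¬hit m n m<n (code-injective _ _ eq)

-- The two rulings: images of lines under a slide.

module Grid {c ℓ q} (F : FiniteField c ℓ q) (2∤q : ¬ 2 ∣ q) (5≤q : 5 ℕ.≤ q) where
  open FiniteField F hiding (zero)
  open RingProperties ring using (-0#≈0#)
  open FieldTheory F
  open Odd 2∤q
  open MatP
  open Geometry F 2∤q
  open LinePreservation F 2∤q 5≤q
  open Translations F 2∤q 5≤q

  infixr 8 _·_
  _·_ : SL → V → V
  g · (x , y) = g ₁₁ * x + g ₁₂ * y , g ₂₁ * x + g ₂₂ * y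

  abstract
    -- An element of determinant 1 preserves ω, so conjugation by g moves the root group of v to
    -- that of g v.
    conjugate-u : ∀ g v r → u (g · v) r ∙ g ≃ g ∙ u v r
    conjugate-u (mat a b c′ d , det≈1) (x , y) r = ≈⇒≃ (mat≈
      (by₁ (- (r * (a * x + b * y) * y)) (solve 7 (λ a b c d x y r →
        let m = matP a b c d ; X = a :* x :+ b :* y ; Y = c :* x :+ d :* y in
        p₁₁ (uP X Y r ∙P m) :- p₁₁ (m ∙P uP x y r) := :- (r :* X :* y) :* (a :* d :- b :* c :- p1))
          refl a b c′ d x y r) det≈1)
      (by₁ (r * (a * x + b * y) * x) (solve 7 (λ a b c d x y r →
        let m = matP a b c d ; X = a :* x :+ b :* y ; Y = c :* x :+ d :* y in
        p₁₂ (uP X Y r ∙P m) :- p₁₂ (m ∙P uP x y r) := r :* X :* x :* (a :* d :- b :* c :- p1))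
          refl a b c′ d x y r) det≈1)
      (by₁ (- (r * (c′ * x + d * y) * y)) (solve 7 (λ a b c d x y r →
        let m = matP a b c d ; X = a :* x :+ b :* y ; Y = c :* x :+ d :* y in
        p₂₁ (uP X Y r ∙P m) :- p₂₁ (m ∙P uP x y r) := :- (r :* Y :* y) :* (a :* d :- b :* c :- p1))
          refl a b c′ d x y r) det≈1)
      (by₁ (r * (c′ * x + d * y) * x) (solve 7 (λ a b c d x y r →
        let m = matP a b c d ; X = a :* x :+ b :* y ; Y = c :* x :+ d :* y in
        p₂₂ (uP X Y r ∙P m) :- p₂₂ (m ∙P uP x y r) := r :* Y :* x :* (a :* d :- b :* c :- p1))
          refl a b c′ d x y r) det≈1))

    -- Here w = k v, and `u` is quadratic in its vector, so κ = k². The vector e off the line serves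
    -- to compute k.
    parallel-u : ∀ {v w} e → ¬ ω v e ≈ 0# → ω v w ≈ 0# → ∃ λ κ → ∀ r → u w r ≃ u v (r * κ)
    parallel-u {v@(v₁ , v₂)} {w@(w₁ , w₂)} e@(e₁ , e₂) ve≉0 vw≈0 = k * k , λ r → ≈⇒≃ (mat≈
      (+-congˡ (-‿cong (lem r w₁≈ w₂≈))) (lem r w₁≈ w₁≈) (-‿cong (lem r w₂≈ w₂≈)) (+-congˡ (lem r w₁≈ w₂≈)))
      where
      i k : Carrier
      i = inv ve≉0
      k = ω w e * i
      w₁≈ : w₁ ≈ k * v₁
      w₁≈ = by₂ (- w₁) (i * e₁) (solve 7 (λ v₁ v₂ w₁ w₂ e₁ e₂ i → w₁ :- ωP w₁ w₂ e₁ e₂ :* i :* v₁ :=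
        :- w₁ :* (ωP v₁ v₂ e₁ e₂ :* i :- p1) :+ i :* e₁ :* (ωP v₁ v₂ w₁ w₂ :- p0))
          refl v₁ v₂ w₁ w₂ e₁ e₂ i) (inv-inverse ve≉0) vw≈0
      w₂≈ : w₂ ≈ k * v₂
      w₂≈ = by₂ (- w₂) (i * e₂) (solve 7 (λ v₁ v₂ w₁ w₂ e₁ e₂ i → w₂ :- ωP w₁ w₂ e₁ e₂ :* i :* v₂ :=
        :- w₂ :* (ωP v₁ v₂ e₁ e₂ :* i :- p1) :+ i :* e₂ :* (ωP v₁ v₂ w₁ w₂ :- p0))
          refl v₁ v₂ w₁ w₂ e₁ e₂ i) (inv-inverse ve≉0) vw≈0
      lem : ∀ r {x y z t} → x ≈ k * z → y ≈ k * t → r * (x * y) ≈ r * (k * k) * (z * t)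
      lem r {z = z} {t} p p′ = trans (*-congˡ (*-cong p p′)) (solve 4 (λ r k z t → r :* (k :* z :* (k :* t)) :=
        r :* (k :* k) :* (z :* t)) refl r k z t)

    -- By `ω-u·` the mixed coefficient is ω(B,D) ω(aB,D) with a = `u A α`: it vanishes just when D
    -- is parallel to B or to aB, the directions of the two rulings.
    tr-uuu : ∀ D r A α B s → tr (u D r ∙ (u A α ∙ u B (- s))) ≈
      2# + α * s * (ω A B * ω A B) - r * (α * (ω D A * ω D A)) + r * s * (ω B D * (ω B D - α * ω D A * ω A B))
    tr-uuu (d₁ , d₂) r (a₁ , a₂) α (b₁ , b₂) s = solve 9 (λ d₁ d₂ r a₁ a₂ α b₁ b₂ s →
      let AB = ωP a₁ a₂ b₁ b₂ ; DA = ωP d₁ d₂ a₁ a₂ ; BD = ωP b₁ b₂ d₁ d₂ in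
      trP (uP d₁ d₂ r ∙P (uP a₁ a₂ α ∙P uP b₁ b₂ (:- s))) :=
      p2 :+ α :* s :* (AB :* AB) :- r :* (α :* (DA :* DA)) :+ r :* s :* (BD :* (BD :- α :* DA :* AB)))
        refl d₁ d₂ r a₁ a₂ α b₁ b₂ s

    ω-u· : ∀ A α B D → ω (u A α · B) D ≈ ω B D - α * ω D A * ω A B
    ω-u· (a₁ , a₂) α (b₁ , b₂) (d₁ , d₂) = solve 7 (λ a₁ a₂ α b₁ b₂ d₁ d₂ →
      ωP ((p1 :- α :* (a₁ :* a₂)) :* b₁ :+ α :* (a₁ :* a₁) :* b₂) (:- (α :* (a₂ :* a₂)) :* b₁ :+ (p1
        :+ α :* (a₁ :* a₂)) :* b₂) d₁ d₂ :=
      ωP b₁ b₂ d₁ d₂ :- α :* ωP d₁ d₂ a₁ a₂ :* ωP a₁ a₂ b₁ b₂) refl a₁ a₂ α b₁ b₂ d₁ d₂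

    -- In other words, the common value has trace 0.
    uu≃uu : ∀ {A α B r r′ s} → ¬ ω A B ≈ 0# → ¬ α ≈ 0# → ¬ s ≈ 0# → u B r ∙ u A α ≃ u A r′ ∙ u B s →
      r ≈ - s × α * s * (ω A B * ω A B) ≈ - 2#
    uu≃uu {A@(a₁ , a₂)} {α} {B@(b₁ , b₂)} {r} {r′} {s} o≉0 α≉0 s≉0 e = main (±1 (sgn² e))
      where
      ε o : Carrier
      ε = sgn e
      o = ω A B
      -- A and B are fixed by their own root groups, so ω(A, ─ A), ω(B, ─ B) and ω(B, ─ A) each
      -- isolate one relation between the parameters.
      r≈εs : r ≈ ε * s
      r≈εs = *-cancelˡ (*-≉0 o≉0 o≉0) (by₁ (- 1#) (solve 9 (λ a₁ a₂ b₁ b₂ α r r′ s ε → let o = ωP a₁ a₂ b₁ b₂ in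
        o :* o :* r :- o :* o :* (ε :* s) :=
          :- p1 :* (formP a₁ a₂ (uP b₁ b₂ r ∙P uP a₁ a₂ α) a₁ a₂ :- ε :* formP a₁ a₂ (uP a₁ a₂ r′ ∙P uP b₁ b₂ s) a₁ a₂))
        refl a₁ a₂ b₁ b₂ α r r′ s ε) (form-≃ e A A))
      α≈εr′ : α ≈ ε * r′
      α≈εr′ = *-cancelˡ (*-≉0 o≉0 o≉0) (by₁ (- 1#) (solve 9 (λ a₁ a₂ b₁ b₂ α r r′ s ε → let o = ωP a₁ a₂ b₁ b₂ in
        o :* o :* α :- o :* o :* (ε :* r′) :=
          :- p1 :* (formP b₁ b₂ (uP b₁ b₂ r ∙P uP a₁ a₂ α) b₁ b₂ :- ε :* formP b₁ b₂ (uP a₁ a₂ r′ ∙P uP b₁ b₂ s) b₁ b₂))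
        refl a₁ a₂ b₁ b₂ α r r′ s ε) (form-≃ e B B))
      1≈ε[1-r′so²] : 1# ≈ ε * (1# - r′ * s * (o * o))
      1≈ε[1-r′so²] = *-cancelˡ o≉0 (by₁ (- 1#) (solve 9 (λ a₁ a₂ b₁ b₂ α r r′ s ε → let o = ωP a₁ a₂ b₁ b₂ in
        o :* p1 :- o :* (ε :* (p1 :- r′ :* s :* (o :* o))) :=
          :- p1 :* (formP b₁ b₂ (uP b₁ b₂ r ∙P uP a₁ a₂ α) a₁ a₂ :- ε :* formP b₁ b₂ (uP a₁ a₂ r′ ∙P uP b₁ b₂ s) a₁ a₂))
        refl a₁ a₂ b₁ b₂ α r r′ s ε) (form-≃ e B A))
      r′≉0 : ¬ r′ ≈ 0#
      r′≉0 r′≈0 = α≉0 (trans α≈εr′ (*0 ε r′≈0))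
      main : ε ≈ 1# ⊎ ε ≈ - 1# → r ≈ - s × α * s * (o * o) ≈ - 2#
      main (inj₁ ε≈1) = ⊥-elim (*-≉0 (*-≉0 r′≉0 s≉0) (*-≉0 o≉0 o≉0) (by₂ 1# (1# - r′ * s * (o * o))
        (solve 2 (λ k ε → k :- p0 := p1 :* (p1 :- ε :* (p1 :- k)) :+ (p1 :- k) :* (ε :- p1))
          refl (r′ * s * (o * o)) ε) 1≈ε[1-r′so²] ε≈1))
      main (inj₂ ε≈-1) =
        trans r≈εs (by₁ s (solve 2 (λ ε s → ε :* s :- :- s := s :* (ε :- :- p1)) refl ε s) ε≈-1) ,
        by₃ (s * (o * o)) (- 1#) 1# (solve 5 (λ α r′ s o ε → α :* s :* (o :* o) :- :- p2 :=
          s :* (o :* o) :* (α :- ε :* r′) :+ :- p1 :* (ε :* (p1 :- r′ :* s :* (o :* o)) :- p1) :+ p1 :* (ε :- :- p1))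
            refl α r′ s o ε)
          α≈εr′ (sym 1≈ε[1-r′so²]) ε≈-1

  module _ {ι} (𝒜 : AbelianAction ι) where
    open AbelianAction 𝒜

    -- Disjointness of a line from its image, the condition under which the image falls into one of
    -- the two rulings.
    NoReturn : Index → SL → P¹ → Set (c ⊔ ℓ)
    NoReturn j x B = ∀ {y} → x ─[ B ]─ y → ¬ x ─[ B ]─ act j y

    displaced : ∀ {j x} → x ↔ act j x → ∀ y → y ↔ act j y
    displaced {j} {x} p y = let k , kx≃y = transitive x y in
      ↔-resp kx≃y (≃-trans (act-comm k j x) (act-cong j kx≃y)) (act-↔ k p)

    -- If y and its image were both on the B-line, i would slide along that line at y, hence move x
    -- along B as well as along A.
    slides⇒no-return : ∀ {i x A B} → Slides i x A → ¬ A ∥ B → NoReturn i x B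
    slides⇒no-return {i} {x} {A} {B} sl A∦B {y} xy xTy = moves sl (two-lines A∦B (along sl) xTx)
      where
      open Slides
      at-y : ∃ λ e → Slides i y e
      at-y = slides-everywhere sl y
      e : P¹
      e = proj₁ at-y
      sl′ : Slides i y e
      sl′ = proj₂ at-y
      e∥B : e ∥ B
      e∥B = line-unique (moves sl′) (along sl′) (line-trans (line-sym xy) xTy)
      xTx : x ─[ B ]─ act i x
      xTx = line-trans xy (line-∥ e∥B (stable sl′ (line-∥ (∥-sym e∥B) (line-sym xy))))

    Translate : Index → SL → SL → P¹ → Set (c ⊔ ℓ)
    Translate j x a B = (∀ s → ∃ λ r → act j (u ⟪ B ⟫ s ∙ x) ≃ a ∙ (u ⟪ B ⟫ r ∙ x))
                      ⊎ (∀ s → ∃ λ r → act j (u ⟪ B ⟫ s ∙ x) ≃ u ⟪ B ⟫ r ∙ (a ∙ x))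

    -- The trace form is bi-affine in the parameters of a line and its image; unless its mixed coefficient
    -- vanishes, one point of the first line is adjacent to the whole of the second.
    module _ {j x A α B} (jx≃ax : act j x ≃ u ⟪ A ⟫ α ∙ x) (α≉0 : ¬ α ≈ 0#) (A∦B : ¬ A ∥ B) (no-return : NoReturn j x B) where
      private
        a : SL
        a = u ⟪ A ⟫ α
        b : Carrier → SL
        b s = u ⟪ B ⟫ s ∙ x
        on-b : ∀ s → x ─[ B ]─ b s
        on-b s = u-line B s x
        y₀ : SL
        y₀ = b 1#
        x≄y₀ : ¬ x ≃ y₀
        x≄y₀ eq = 0≉1 (sym (ux≃x⇒s≈0 {B} (≃-sym eq)))
        x-A-jx : x ─[ A ]─ act j x
        x-A-jx = α by jx≃ax
        edge : ∃ λ D → act j x ─[ D ]─ act j y₀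
        edge = ↔⇒line (act-↔ j (line⇒↔ (on-b 1#)))
        abstract
          D : P¹
          D = proj₁ edge
          on-D : act j x ─[ D ]─ act j y₀
          on-D = proj₂ edge
        image : ∀ s → act j x ─[ D ]─ act j (b s)
        image s = act-lines j x≄y₀ (on-b 1#) on-D (on-b s)
        pull-back : ∀ {z} → act j x ─[ D ]─ z → x ─[ B ]─ act⁻¹ j z
        pull-back on = line-resp (act⁻¹-act j x) ≃-refl (act⁻¹-lines j (λ eq → x≄y₀ (act-injective j eq)) on-D
          (line-resp (≃-sym (act⁻¹-act j x)) (≃-sym (act⁻¹-act j y₀)) (on-b 1#)) on)
        not-both : ∀ {z} → act j x ─[ D ]─ z → ¬ x ─[ B ]─ z
        not-both {z} on xz = no-return (pull-back on) (line-resp ≃-refl (≃-sym (act-act⁻¹ j z)) xz)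
        o p k : Carrier
        o = ω ⟪ A ⟫ ⟪ B ⟫
        p = ω ⟪ D ⟫ ⟪ A ⟫
        k = ω ⟪ B ⟫ ⟪ D ⟫ * (ω ⟪ B ⟫ ⟪ D ⟫ - α * p * o)
        o≉0 : ¬ o ≈ 0#
        o≉0 = ∦⇒ω≉0 {A} {B} A∦B
        f : Carrier → Carrier → Carrier
        f s r = 2# + α * s * (o * o) - r * (α * (p * p)) + r * s * k
        ratio≃ : ∀ s r → u ⟪ D ⟫ r ∙ act j x ∙ b s ⁻¹ ≃ u ⟪ D ⟫ r ∙ (a ∙ u ⟪ B ⟫ (- s))
        ratio≃ s r = begin
          u ⟪ D ⟫ r ∙ act j x ∙ b s ⁻¹        ≈⟨ ≃-∙ʳ (≃-trans (≃-∙ˡ jx≃ax) (≃-sym (≃-assoc _ a x))) ⟩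
          u ⟪ D ⟫ r ∙ a ∙ x ∙ b s ⁻¹          ≈⟨ xg∙[yg]⁻¹ (u ⟪ D ⟫ r ∙ a) (u ⟪ B ⟫ s) x ⟩
          u ⟪ D ⟫ r ∙ a ∙ u ⟪ B ⟫ s ⁻¹        ≈⟨ ≃-∙ˡ (u-⁻¹ ⟪ B ⟫ s) ⟩
          u ⟪ D ⟫ r ∙ a ∙ u ⟪ B ⟫ (- s)       ≈⟨ ≃-assoc _ a _ ⟩
          u ⟪ D ⟫ r ∙ (a ∙ u ⟪ B ⟫ (- s))     ∎
          where open ≃-Reasoning
        f² : ∀ s → ∃ λ r → f s r * f s r ≈ 4#
        f² s = step (image s) , trans (sym (*-cong tr≈ tr≈)) (tr²≈4 (Par-resp (ratio≃ s r) (ratio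
            (↔-resp ≃-refl (y≃ux (image s)) (displaced (line⇒↔ x-A-jx) (b s))))))
          where
          r : Carrier
          r = step (image s)
          tr≈ : tr (u ⟪ D ⟫ r ∙ (a ∙ u ⟪ B ⟫ (- s))) ≈ f s r
          tr≈ = tr-uuu ⟪ D ⟫ r ⟪ A ⟫ α ⟪ B ⟫ s
        f²⇒↔ : ∀ s r → f s r * f s r ≈ 4# → u ⟪ D ⟫ r ∙ act j x ↔ b s
        f²⇒↔ s r e = ↔-sym (adjacent (Par-resp (≃-sym (ratio≃ s r)) (par (trans (*-cong tr≈ tr≈) e))))
          where
          tr≈ : tr (u ⟪ D ⟫ r ∙ (a ∙ u ⟪ B ⟫ (- s))) ≈ f s r
          tr≈ = tr-uuu ⟪ D ⟫ r ⟪ A ⟫ α ⟪ B ⟫ s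
        module _ (k≉0 : ¬ k ≈ 0#) where
          -- The value of s at which the coefficient of r in `f` cancels.
          s₀ : Carrier
          s₀ = α * (p * p) * inv k≉0
          f-const : ∀ r → f s₀ r ≈ 2# + α * s₀ * (o * o)
          f-const r = by₁ (r * α * (p * p)) (solve 6 (λ α p o k i r → p2
            :+ α :* (α :* (p :* p) :* i) :* (o :* o) :- r :* (α :* (p :* p)) :+ r :* (α :* (p :* p) :* i) :* k
            :- (p2 :+ α :* (α :* (p :* p) :* i) :* (o :* o)) := r :* α :* (p :* p) :* (k :* i :- p1))
              refl α p o k (inv k≉0) r) (inv-inverse k≉0)
          f-const² : ∀ r r′ → f s₀ r′ * f s₀ r′ ≈ 4# → f s₀ r * f s₀ r ≈ 4#
          f-const² r r′ e = trans (*-cong f≈f f≈f) e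
            where
            f≈f : f s₀ r ≈ f s₀ r′
            f≈f = trans (f-const r) (sym (f-const r′))
          all : ∀ r → u ⟪ D ⟫ r ∙ act j x ↔ b s₀
          all r = f²⇒↔ s₀ r (f-const² r (proj₁ (f² s₀)) (proj₂ (f² s₀)))
          absurd : ⊥
          absurd = not-both (on-line all) (on-b s₀)
        k≈0 : k ≈ 0#
        k≈0 = decidable-stable (k ≟ 0#) absurd
        left : ω ⟪ B ⟫ ⟪ D ⟫ ≈ 0# → ∀ s → ∃ λ r → act j (b s) ≃ u ⟪ B ⟫ r ∙ (a ∙ x)
        left BD≈0 s = step (image s) , ≃-trans (y≃ux (image s)) (≃-∙ (∥⇒u {D}
          {B} (step (image s)) (∥-sym (∥-intro BD≈0))) jx≃ax)
        module _ (aBD≈0 : ω ⟪ B ⟫ ⟪ D ⟫ - α * p * o ≈ 0#) where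
          aB,A≉0 : ¬ ω (a · ⟪ B ⟫) ⟪ A ⟫ ≈ 0#
          aB,A≉0 e = o≉0 (by₃ (- 1#) 1# (- (α * o)) (solve 4 (λ BA α AA o → o :- p0 :=
            :- p1 :* (BA :- α :* AA :* o :- p0) :+ p1 :* (BA :- :- o) :+ :- (α :* o) :* (AA :- p0))
              refl (ω ⟪ B ⟫ ⟪ A ⟫) α (ω ⟪ A ⟫ ⟪ A ⟫) o)
            (trans (sym (ω-u· ⟪ A ⟫ α ⟪ B ⟫ ⟪ A ⟫)) e) (ω-anti ⟪ B ⟫ ⟪ A ⟫) (ω≈0 (∥-refl A)))
          par-D : ∃ λ κ → ∀ r → u ⟪ D ⟫ r ≃ u (a · ⟪ B ⟫) (r * κ)
          par-D = parallel-u {a · ⟪ B ⟫} {⟪ D ⟫} ⟪ A ⟫ aB,A≉0 (trans (ω-u· ⟪ A ⟫ α ⟪ B ⟫ ⟪ D ⟫) aBD≈0)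
          κ : Carrier
          κ = proj₁ par-D
          right : ∀ s → ∃ λ r → act j (b s) ≃ a ∙ (u ⟪ B ⟫ r ∙ x)
          right s = step (image s) * κ , (begin
            act j (b s)                                ≈⟨ y≃ux (image s) ⟩
            u ⟪ D ⟫ (step (image s)) ∙ act j x         ≈⟨ ≃-∙ (proj₂ par-D (step (image s))) jx≃ax ⟩
            u (a · ⟪ B ⟫) (step (image s) * κ) ∙ (a ∙ x) ≈⟨ ≃-assoc _ a x ⟨
            u (a · ⟪ B ⟫) (step (image s) * κ) ∙ a ∙ x ≈⟨ ≃-∙ʳ (conjugate-u a ⟪ B ⟫ _) ⟩
            a ∙ u ⟪ B ⟫ (step (image s) * κ) ∙ x       ≈⟨ ≃-assoc a _ x ⟩
            a ∙ (u ⟪ B ⟫ (step (image s) * κ) ∙ x)     ∎)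
            where open ≃-Reasoning

      grid : Translate j x (u ⟪ A ⟫ α) B
      grid = [ inj₂ ∘ left , inj₁ ∘ right ]′ (xy≈0⇒x≈0⊎y≈0 k≈0)

    neg-injective : ∀ {x y} → - x ≈ - y → x ≈ y
    neg-injective {x} {y} = by₁ (- 1#) (solve 2 (λ x y → x :- y := :- p1 :* (:- x :- :- y)) refl x y)

    neg≉0 : ∀ {x} → ¬ x ≈ 0# → ¬ - x ≈ 0#
    neg≉0 x≉0 e = x≉0 (neg-injective (trans e (sym -0#≈0#)))

    uu-⁻¹ : ∀ v r w s → (u v r ∙ u w s) ⁻¹ ≃ u w (- s) ∙ u v (- r)
    uu-⁻¹ v r w s = ≃-trans (≃-⁻¹-∙ (u v r) (u w s)) (≃-∙ (u-⁻¹ w s) (u-⁻¹ v r))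

    invert-uu : ∀ {v r w s v′ r′ w′ s′} → u v r ∙ u w s ≃ u v′ r′ ∙ u w′ s′ →
      u w (- s) ∙ u v (- r) ≃ u w′ (- s′) ∙ u v′ (- r′)
    invert-uu {v} {r} {w} {s} {v′} {r′} {w′} {s′} e = ≃-trans (≃-sym (uu-⁻¹ v r w s)) (≃-trans
      (≃-⁻¹ e) (uu-⁻¹ v′ r′ w′ s′))

    cancel-right : ∀ {g h g′ h′ x} → g ∙ (h ∙ x) ≃ g′ ∙ (h′ ∙ x) → g ∙ h ≃ g′ ∙ h′
    cancel-right {g} {h} {g′} {h′} {x} e = ≃-cancelʳ x _ _ (≃-trans (≃-assoc g h x) (≃-trans e (≃-sym
      (≃-assoc g′ h′ x))))

    uu-unique : ∀ {A B α r α′ s} → ¬ A ∥ B → u ⟪ A ⟫ α ∙ u ⟪ B ⟫ r ≃ u ⟪ A ⟫ α′ ∙ u ⟪ B ⟫ s → r ≈ s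
    uu-unique {A} {B} {α} {r} {α′} {s} A∦B e = sym (undiff (u≃u⇒s≈0 {⟪ B ⟫} {s - r} {⟪ A ⟫} { - α′ + α} (∦⇒ω≉0 {B} {A}
      (λ p → A∦B (∥-sym p))) (begin
      u ⟪ B ⟫ (s - r)                                         ≈⟨ u-∙ ⟪ B ⟫ s (- r) ⟨
      u ⟪ B ⟫ s ∙ u ⟪ B ⟫ (- r)                               ≈⟨ ≃-∙ʳ (u-cancel ⟪ A ⟫ α′ (u ⟪ B ⟫ s)) ⟨
      u ⟪ A ⟫ (- α′) ∙ (u ⟪ A ⟫ α′ ∙ u ⟪ B ⟫ s) ∙ u ⟪ B ⟫ (- r) ≈⟨ ≃-∙ʳ (≃-∙ˡ e) ⟨
      u ⟪ A ⟫ (- α′) ∙ (u ⟪ A ⟫ α ∙ u ⟪ B ⟫ r) ∙ u ⟪ B ⟫ (- r)  ≈⟨ ≃-∙ʳ (≃-assoc _ _ _) ⟨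
      u ⟪ A ⟫ (- α′) ∙ u ⟪ A ⟫ α ∙ u ⟪ B ⟫ r ∙ u ⟪ B ⟫ (- r)    ≈⟨ ≃-∙ (≃-∙ʳ (u-∙ ⟪ A ⟫ (- α′) α)) (≃-sym
        (u-⁻¹ ⟪ B ⟫ r)) ⟩
      u ⟪ A ⟫ (- α′ + α) ∙ u ⟪ B ⟫ r ∙ u ⟪ B ⟫ r ⁻¹             ≈⟨ xy∙y⁻¹ (u ⟪ B ⟫ r) _ ⟩
      u ⟪ A ⟫ (- α′ + α)                                       ∎)))
      where open ≃-Reasoning

    module _ {i x A α B} (slides : Slides i x A) (ix≃ax : act i x ≃ u ⟪ A ⟫ α ∙ x) (A∦B : ¬ A ∥ B) where
      private
        open Slides slides
        a : SL
        a = u ⟪ A ⟫ α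
        o : Carrier
        o = ω ⟪ A ⟫ ⟪ B ⟫
        o≉0 : ¬ o ≈ 0#
        o≉0 = ∦⇒ω≉0 {A} {B} A∦B
        B∦A : ¬ B ∥ A
        B∦A p = A∦B (∥-sym p)
        b : Carrier → SL
        b s = u ⟪ B ⟫ s
        α≉0 : ¬ α ≈ 0#
        α≉0 α≈0 = moves (≃-sym (≃-trans ix≃ax (s≈0⇒ux≃x {A} α≈0)))
        Sporadic : Carrier → Set ℓ
        Sporadic s = α * s * (o * o) ≈ - 2#

        first : Translate i x a B
        first = grid {i} {x} {A} {α} {B} ix≃ax α≉0 A∦B (slides⇒no-return slides A∦B)

        module _ {s} (s≉0 : ¬ s ≈ 0#) where
          j : Index
          j = proj₁ (transitive x (b s ∙ x))
          jx≃bx : act j x ≃ b s ∙ x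
          jx≃bx = proj₂ (transitive x (b s ∙ x))
          jix≃ibx : act j (u ⟪ A ⟫ α ∙ x) ≃ act i (b s ∙ x)
          jix≃ibx = ≃-trans (act-cong j (≃-sym ix≃ax)) (≃-trans (act-comm j i x) (act-cong i jx≃bx))
          at-bx : ∃ λ e → Slides i (b s ∙ x) e
          at-bx = slides-everywhere slides (b s ∙ x)
          x≄bx : ¬ x ≃ b s ∙ x
          x≄bx eq = s≉0 (ux≃x⇒s≈0 {B} (≃-sym eq))
          -- If z and `act j z` both lay on the A-line, i would slide at `act j z` along A and along
          -- the image of that line, so the image would be the A-line itself and contain `b s ∙ x`,
          -- which B already joins to x.
          no-return : NoReturn j x A
          no-return {z} xz xjz = x≄bx (two-lines A∦B (line-trans xjz (line-sym (line-∥ e∥A bx-jz))) (u-line B s x))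
            where
            e : P¹
            e = proj₁ at-bx
            sl : Slides i (b s ∙ x) e
            sl = proj₂ at-bx
            bx-jz : b s ∙ x ─[ e ]─ act j z
            bx-jz = line-resp jx≃bx ≃-refl (act-lines j moves along
              (line-resp (≃-sym jx≃bx) (≃-trans (≃-sym jix≃ibx) (act-cong j (≃-sym ix≃ax))) (Slides.along sl)) xz)
            e∥A : e ∥ A
            e∥A = line-unique {y = act i (act j z)} (λ eq → moves (≃-sym (free {i} {act j z} (≃-sym eq) x)))
              (line-trans (line-sym bx-jz) (Slides.stable sl bx-jz)) (line-trans (line-sym xjz) (stable xjz))
          -- By commutativity the point is also `act j (a ∙ x)`, so `grid` applies with A and B
          -- exchanged. This description has parameter exactly s at B and leaves the one at A open.
          second : (∃ λ r → act i (b s ∙ x) ≃ b s ∙ (u ⟪ A ⟫ r ∙ x)) ⊎ (∃ λ r → act i (b s ∙ x) ≃ u ⟪ A ⟫ r ∙ (b s ∙ x))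
          second = [ (λ h → inj₁ (proj₁ (h α) , ≃-trans (≃-sym jix≃ibx) (proj₂ (h α))))
                   , (λ h → inj₂ (proj₁ (h α) , ≃-trans (≃-sym jix≃ibx) (proj₂ (h α)))) ]′
                   (grid {j} {x} {B} {s} {A} jx≃bx s≉0 B∦A no-return)

        Left Right : Set (c ⊔ ℓ)
        Left  = ∀ s → ∃ λ r → act i (b s ∙ x) ≃ a ∙ (b r ∙ x)
        Right = ∀ s → ∃ λ r → act i (b s ∙ x) ≃ b r ∙ (a ∙ x)

        -- b r a ≃ b s a′ forces r = s: compare inverses, where the b-factors come last.
        right-parameter : ∀ {s r} → ¬ s ≈ 0# → act i (b s ∙ x) ≃ b r ∙ (a ∙ x) → r ≈ s ⊎ (r ≈ - s × Sporadic s)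
        right-parameter {s} {r} s≉0 e = [ same , opposite ]′ (second s≉0)
          where
          same : (∃ λ r′ → act i (b s ∙ x) ≃ b s ∙ (u ⟪ A ⟫ r′ ∙ x)) → r ≈ s ⊎ (r ≈ - s × Sporadic s)
          same (r′ , e′) = inj₁ (neg-injective (uu-unique {A} {B} { - α} { - r} { - r′} { - s} A∦B
            (invert-uu {⟪ B ⟫} {r} {⟪ A ⟫} {α} {⟪ B ⟫} {s} {⟪ A ⟫} {r′} (cancel-right (≃-trans (≃-sym e) e′)))))
          opposite : (∃ λ r′ → act i (b s ∙ x) ≃ u ⟪ A ⟫ r′ ∙ (b s ∙ x)) → r ≈ s ⊎ (r ≈ - s × Sporadic s)
          opposite (r′ , e′) = inj₂ (uu≃uu {⟪ A ⟫} {α} {⟪ B ⟫} {r} {r′} {s} o≉0 α≉0 s≉0 (cancel-right (≃-trans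
            (≃-sym e) e′)))

        left-parameter : ∀ {s r} → ¬ s ≈ 0# → act i (b s ∙ x) ≃ a ∙ (b r ∙ x) → r ≈ s ⊎ (r ≈ - s × Sporadic s)
        left-parameter {s} {r} s≉0 e = [ opposite , same ]′ (second s≉0)
          where
          same : (∃ λ r′ → act i (b s ∙ x) ≃ u ⟪ A ⟫ r′ ∙ (b s ∙ x)) → r ≈ s ⊎ (r ≈ - s × Sporadic s)
          same (r′ , e′) = inj₁ (uu-unique {A} {B} {α} {r} {r′} {s} A∦B (cancel-right (≃-trans (≃-sym e) e′)))
          opposite : (∃ λ r′ → act i (b s ∙ x) ≃ b s ∙ (u ⟪ A ⟫ r′ ∙ x)) → r ≈ s ⊎ (r ≈ - s × Sporadic s)
          opposite (r′ , e′) = inj₂ (neg-injective (proj₁ res) ,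
            trans (solve 3 (λ α s o → α :* s :* o := :- α :* :- s :* o) refl α s (o * o)) (proj₂ res))
            where
            res : - r ≈ - - s × - α * - s * (o * o) ≈ - 2#
            res = uu≃uu {⟪ A ⟫} { - α} {⟪ B ⟫} { - r} { - r′} { - s} o≉0 (neg≉0 α≉0) (neg≉0 s≉0)
              (invert-uu {⟪ A ⟫} {α} {⟪ B ⟫} {r} {⟪ B ⟫} {s} {⟪ A ⟫} {r′} (cancel-right (≃-trans (≃-sym e) e′)))

        not-opposite : ∀ {s r r′} {f : Carrier → SL} → ¬ s ≈ 0# → r ≈ - s → r′ ≈ - s → (∀ {k l} → k ≈ l → f k ≃ f l) →
          act i (b s ∙ x) ≃ f r → act i (b (- s) ∙ x) ≃ f r′ → ⊥
        not-opposite {s} {r} {r′} s≉0 r≈ r′≈ f-cong e e′ = *-≉0 2≉0 s≉0 (by₁ 1# (solve 1 (λ s → p2 :* s :- p0 :=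
          p1 :* (s :- :- s)) refl s)
          (u-injective {B} (≃-cancelʳ x _ _ (act-injective i (≃-trans e (≃-trans (f-cong (trans r≈ (sym r′≈)))
            (≃-sym e′)))))))

        not-sporadic : ∀ {s} → Sporadic s → ¬ Sporadic (- s)
        not-sporadic {s} e e′ = 4≉0 (by₂ 1# 1# (solve 3 (λ α s o → p4 :- p0 := p1 :* (α :* s :* o :- :- p2)
          :+ p1 :* (α :* :- s :* o :- :- p2)) refl α s (o * o)) e e′)

      -- Within one ruling the alternative to r = s is r = -s at a sporadic s. But s and -s are not
      -- both sporadic, so -s would keep its parameter and share its image with s.
      neighbour : ∀ {s} → ¬ s ≈ 0# → act i (b s ∙ x) ≃ a ∙ (b s ∙ x) ⊎ act i (b s ∙ x) ≃ b s ∙ (a ∙ x)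
      neighbour {s} s≉0 = [ inj₁ ∘ left , inj₂ ∘ right ]′ first
        where
        -s≉0 : ¬ - s ≈ 0#
        -s≉0 = neg≉0 s≉0
        left : Left → act i (b s ∙ x) ≃ a ∙ (b s ∙ x)
        left h = [ (λ r≈s → ≃-trans e (f-cong r≈s)) , (λ (r≈-s , sp) → ⊥-elim
            ([ (λ r′≈-s → not-opposite {f = f} s≉0 r≈-s r′≈-s f-cong e e′) , (λ (_ , sp′) →
              not-sporadic sp sp′) ]′ (left-parameter -s≉0 e′))) ]′
            (left-parameter s≉0 e)
          where
          f : Carrier → SL
          f r = a ∙ (b r ∙ x)
          f-cong : ∀ {k l} → k ≈ l → f k ≃ f l
          f-cong k≈l = ≃-∙ˡ (≃-∙ʳ (u-cong ⟪ B ⟫ k≈l))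
          e : act i (b s ∙ x) ≃ f (proj₁ (h s))
          e = proj₂ (h s)
          e′ : act i (b (- s) ∙ x) ≃ f (proj₁ (h (- s)))
          e′ = proj₂ (h (- s))
        right : Right → act i (b s ∙ x) ≃ b s ∙ (a ∙ x)
        right h = [ (λ r≈s → ≃-trans e (f-cong r≈s)) , (λ (r≈-s , sp) → ⊥-elim
            ([ (λ r′≈-s → not-opposite {f = f} s≉0 r≈-s r′≈-s f-cong e e′) , (λ (_ , sp′) →
              not-sporadic sp sp′) ]′ (right-parameter -s≉0 e′))) ]′
            (right-parameter s≉0 e)
          where
          f : Carrier → SL
          f r = b r ∙ (a ∙ x)
          f-cong : ∀ {k l} → k ≈ l → f k ≃ f l
          f-cong k≈l = ≃-∙ʳ (u-cong ⟪ B ⟫ k≈l)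
          e : act i (b s ∙ x) ≃ f (proj₁ (h s))
          e = proj₂ (h s)
          e′ : act i (b (- s) ∙ x) ≃ f (proj₁ (h (- s)))
          e′ = proj₂ (h (- s))

-- Propagating the choice between left and right.

module Colouring {c ℓ q} (F : FiniteField c ℓ q) (2∤q : ¬ 2 ∣ q) (5≤q : 5 ℕ.≤ q) where
  open FiniteField F hiding (zero)
  open RingProperties ring using (-‿involutive; -0#≈0#)
  open FieldTheory F
  open Odd 2∤q
  open MatP
  open Geometry F 2∤q
  open LinePreservation F 2∤q 5≤q
  open Translations F 2∤q 5≤q
  open Grid F 2∤q 5≤q

  up : Carrier → SL
  up = u ⟪ ∞ ⟫

  low : Carrier → Carrier → SL
  low t = u ⟪ aff t ⟫

  ∞∦aff : ∀ {t} → ¬ ∞ ∥ aff t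
  ∞∦aff p = 0≉1 (proj₂ (∥⇒≈ p))

  abstract
    ω∞aff≉0 : ∀ t → ¬ ω ⟪ ∞ ⟫ ⟪ aff t ⟫ ≈ 0#
    ω∞aff≉0 t = ∦⇒ω≉0 {∞} {aff t} ∞∦aff

    s≉-s : ∀ {s} → ¬ s ≈ 0# → ¬ s ≈ - s
    s≉-s {s} s≉0 e = *-≉0 2≉0 s≉0 (by₁ 1# (solve 1 (λ s → p2 :* s :- p0 := p1 :* (s :- :- s)) refl s) e)

    no-commute : ∀ {α t s} → ¬ α ≈ 0# → ¬ s ≈ 0# → ¬ up α ∙ low t s ≃ low t s ∙ up α
    no-commute {α} {t} {s} α≉0 s≉0 e = s≉-s s≉0 (proj₁ (uu≃uu {⟪ ∞ ⟫} {α} {⟪ aff t ⟫} {s} {α} {s} (ω∞aff≉0 t) α≉0 s≉0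
      (≃-sym e)))

    -- The partners at parameters 1/e and - 4/e are adjacent, but not along the direction ∞.
    partners : ∀ {t t′} (e≉0 : ¬ t′ - t ≈ 0#) → let i = inv e≉0 in
      ∀ y → ∃ λ τ → low t i ∙ y ─[ aff τ ]─ low t′ (- 4# * i) ∙ y
    partners {t} {t′} e≉0 y = finish (↔⇒line adj-y)
      where
      i : Carrier
      i = inv e≉0
      ei≈1 : (t′ - t) * i ≈ 1#
      ei≈1 = inv-inverse e≉0
      adj-y : low t i ∙ y ↔ low t′ (- 4# * i) ∙ y
      adj-y = uu⇒↔ ⟪ aff t ⟫ i ⟪ aff t′ ⟫ (- 4# * i) y (by₁ (- 4# * ((t′ - t) * i + 1#)) (solve 3 (λ t t′ i →
        let o = ωP t p1 t′ p1 in
        i :* (:- p4 :* i) :* (o :* o) :- :- p4 := :- p4 :* ((t′ :- t) :* i :+ p1) :* ((t′ :- t) :* i :- p1))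
          refl t t′ i) ei≈1)
      not-∞ : ¬ low t i ∙ y ─[ ∞ ]─ low t′ (- 4# * i) ∙ y
      not-∞ (k by eq) = 0≉1 (sym (by₃ 1# ((1# + i * t) * (t′ - t)) (4# - (1# + i * t) * (4# + sgn eq′))
        (solve 5 (λ t t′ i ε k → let m = uP p1 p0 k ∙P uP t p1 i ; n = uP t′ p1 (:- p4 :* i) in
          p1 :- p0 := p1 :* (p₂₂ n :- ε :* p₂₂ m) :+ (p1 :+ i :* t) :* (t′ :- t) :* (p₂₁ n :- ε :* p₂₁ m)
            :+ (p4 :- (p1 :+ i :* t) :* (p4 :+ ε)) :* ((t′ :- t) :* i :- p1)) refl t t′ i (sgn eq′) k)
        (e₂₂ eq′) (e₂₁ eq′) ei≈1))
        where
        eq′ : low t′ (- 4# * i) ≃ up k ∙ low t i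
        eq′ = ≃-cancelʳ y _ _ (≃-trans eq (≃-sym (≃-assoc _ _ y)))
      finish : (∃ λ d → low t i ∙ y ─[ d ]─ low t′ (- 4# * i) ∙ y) → ∃ λ τ →
        low t i ∙ y ─[ aff τ ]─ low t′ (- 4# * i) ∙ y
      finish (∞ , on) = ⊥-elim (not-∞ on)
      finish (aff τ , on) = τ , on

    wP : ∀ {n} → MatP n
    wP = matP p0 p1 (:- p1) p0

    weyl : SL
    weyl = mat 0# 1# (- 1#) 0# , solve 0 (p0 :* p0 :- p1 :* :- p1 := p1) refl

    weyl≃ : weyl ≃ low 0# 2# ∙ low 1# 1#
    weyl≃ = ≈⇒≃ (mat≈
      (solve 0 (p0 := p₁₁ (uP p0 p1 p2 ∙P uP p1 p1 p1)) refl)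
      (solve 0 (p1 := p₁₂ (uP p0 p1 p2 ∙P uP p1 p1 p1)) refl)
      (solve 0 (:- p1 := p₂₁ (uP p0 p1 p2 ∙P uP p1 p1 p1)) refl)
      (solve 0 (p0 := p₂₂ (uP p0 p1 p2 ∙P uP p1 p1 p1)) refl))

    up≃ : ∀ r → up r ≃ weyl ∙ (low 0# r ∙ weyl)
    up≃ r = ≃-intro (- 1#) (solve 0 (:- p1 :* :- p1 := p1) refl)
      (solve 1 (λ r → p₁₁ (uP p1 p0 r) := :- p1 :* p₁₁ (wP ∙P (uP p0 p1 r ∙P wP))) refl r)
      (solve 1 (λ r → p₁₂ (uP p1 p0 r) := :- p1 :* p₁₂ (wP ∙P (uP p0 p1 r ∙P wP))) refl r)
      (solve 1 (λ r → p₂₁ (uP p1 p0 r) := :- p1 :* p₂₁ (wP ∙P (uP p0 p1 r ∙P wP))) refl r)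
      (solve 1 (λ r → p₂₂ (uP p1 p0 r) := :- p1 :* p₂₂ (wP ∙P (uP p0 p1 r ∙P wP))) refl r)

    weyl² : ∀ g → weyl ∙ (weyl ∙ g) ≃ g
    weyl² (mat a b c′ d , _) = ≃-intro (- 1#) (solve 0 (:- p1 :* :- p1 := p1) refl)
      (solve 4 (λ a b c d → p₁₁ (wP ∙P (wP ∙P matP a b c d)) := :- p1 :* a) refl a b c′ d)
      (solve 4 (λ a b c d → p₁₂ (wP ∙P (wP ∙P matP a b c d)) := :- p1 :* b) refl a b c′ d)
      (solve 4 (λ a b c d → p₂₁ (wP ∙P (wP ∙P matP a b c d)) := :- p1 :* c) refl a b c′ d)
      (solve 4 (λ a b c d → p₂₂ (wP ∙P (wP ∙P matP a b c d)) := :- p1 :* d) refl a b c′ d)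

    weyl∙₂₁ : ∀ g → (weyl ∙ g) ₂₁ ≈ - (g ₁₁)
    weyl∙₂₁ (mat a b c′ d , _) = solve 2 (λ a c → :- p1 :* a :+ p0 :* c := :- a) refl a c′

    bruhat : ∀ g → ¬ g ₂₁ ≈ 0# → ∃₂ λ x y → g ≃ up x ∙ (low 0# (- (g ₂₁)) ∙ up y)
    bruhat (mat a b c′ d , det≈1) c≉0 = (a - 1#) * i , (d - 1#) * i , ≈⇒≃ (mat≈
      (by₁ (- (a - 1#)) (solve 4 (λ a c d i → a :- p₁₁ (m a c d i) := :- (a :- p1) :* (c :* i :- p1)) refl a c′ d i) ci)
      (*-cancelˡ c≉0 (by₂ (- 1#) (- ((a - 1#) * (d - 1#) * (c′ * i) + (d - 1#) + (a - 1#) + (a - 1#) * (d - 1#)))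
        (solve 5 (λ a b c d i → c :* b :- c :* p₁₂ (m a c d i) :=
        :- p1 :* (a :* d :- b :* c :- p1) :+ :- ((a :- p1) :* (d :- p1) :* (c :* i) :+ (d :- p1) :+ (a :- p1)
          :+ (a :- p1) :* (d :- p1)) :* (c :* i :- p1)) refl a b c′ d i) det≈1 ci))
      (solve 4 (λ a c d i → c := p₂₁ (m a c d i)) refl a c′ d i)
      (by₁ (- (d - 1#)) (solve 4 (λ a c d i → d :- p₂₂ (m a c d i) := :- (d :- p1) :* (c :* i :- p1))
        refl a c′ d i) ci))
      where
      i : Carrier
      i = inv c≉0
      ci : c′ * i ≈ 1#
      ci = inv-inverse c≉0
      m : ∀ {n} → Polynomial n → Polynomial n → Polynomial n → Polynomial n → MatP n
      m a c d i = uP p1 p0 ((a :- p1) :* i) ∙P (uP p0 p1 (:- c) ∙P uP p1 p0 ((d :- p1) :* i))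

  -- The affine root groups generate: `weyl` is a product of two of their elements and turns
  -- `low 0#` into `up`. Steps along ∞ are avoided because left and right translation by `up α`
  -- agree there.
  generated : ∀ {p} (S : SL → Set p) → (∀ {x y} → x ≃ y → S x → S y) →
    (∀ t s {x} → S x → S (low t s ∙ x)) → S 𝟙 → ∀ g → S g
  generated S S-resp S-low S-𝟙 g = main (g ₂₁ ≟ 0#)
    where
    S-weyl : ∀ {x} → S x → S (weyl ∙ x)
    S-weyl {x} Sx = S-resp (≃-trans (≃-sym (≃-assoc _ _ x)) (≃-∙ʳ (≃-sym weyl≃))) (S-low 0# 2# (S-low 1# 1# Sx))
    S-up : ∀ r {x} → S x → S (up r ∙ x)
    S-up r {x} Sx = S-resp (≃-sym (≃-trans (≃-∙ʳ (up≃ r)) (≃-trans (≃-assoc _ _ x) (≃-∙ˡ (≃-assoc _ _ x)))))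
      (S-weyl (S-low 0# r (S-weyl Sx)))
    big : ∀ g → ¬ g ₂₁ ≈ 0# → S g
    big g c≉0 = let x , y , eq = bruhat g c≉0 in S-resp (≃-sym eq) (S-up x (S-low 0# (- (g ₂₁)) (S-resp
      (≃-identityʳ (up y)) (S-up y S-𝟙))))
    main : Dec (g ₂₁ ≈ 0#) → S g
    main (no c≉0) = big g c≉0
    main (yes c≈0) = S-resp (weyl² g) (S-weyl (big (weyl ∙ g) (λ e →
      a≉0 (trans (sym (-‿involutive _)) (trans (-‿cong (trans (sym (weyl∙₂₁ g)) e)) -0#≈0#)))))
      where
      a≉0 : ¬ g ₁₁ ≈ 0#
      a≉0 a≈0 = 0≉1 (by₃ (- (g ₂₂)) (g ₁₂) 1# (solve 4 (λ a b c d → p0 :- p1 := :- d :* (a :- p0) :+ b :* (c :- p0)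
        :+ p1 :* (a :* d :- b :* c :- p1)) refl (g ₁₁) (g ₁₂) (g ₂₁) (g ₂₂))
        a≈0 c≈0 (det₁ g))

  module _ {ι} (𝒜 : AbelianAction ι) where
    open AbelianAction 𝒜

    slides-∥ : ∀ {i x d e} → d ∥ e → Slides i x d → Slides i x e
    slides-∥ d∥e sl = record { moves = moves ; along = line-∥ d∥e along
                             ; stable = λ on → line-∥ d∥e (stable (line-∥ (∥-sym d∥e) on)) }
      where open Slides sl

    module LeftOrRight {i α} (slides : Slides i 𝟙 ∞) (i𝟙≃ : act i 𝟙 ≃ up α) where
      a : SL
      a = up α

      α≉0 : ¬ α ≈ 0#
      α≉0 α≈0 = Slides.moves slides (≃-sym (≃-trans i𝟙≃ (≃-trans (u-cong ⟪ ∞ ⟫ α≈0) (u-0 ⟪ ∞ ⟫))))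

      P : SL → Set (c ⊔ ℓ)
      P y = act i y ≃ a ∙ y

      P-𝟙 : P 𝟙
      P-𝟙 = ≃-trans i𝟙≃ (≃-sym (≃-identityʳ a))

      P-resp : ∀ {x y} → x ≃ y → P x → P y
      P-resp x≃y Px = ≃-trans (act-cong i (≃-sym x≃y)) (≃-trans Px (≃-∙ˡ x≃y))

      slides-at : ∀ {y} → P y → Slides i y ∞
      slides-at {y} Py = let e , sl = slides-everywhere slides y in
        slides-∥ (line-unique (Slides.moves sl) (Slides.along sl) (α by Py)) sl

      Left Right : SL → Carrier → Carrier → Set (c ⊔ ℓ)
      Left  y t s = act i (low t s ∙ y) ≃ a ∙ (low t s ∙ y)
      Right y t s = act i (low t s ∙ y) ≃ low t s ∙ (a ∙ y)

      left-or-right : ∀ {y} → P y → ∀ t {s} → ¬ s ≈ 0# → Left y t s ⊎ Right y t s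
      left-or-right {y} Py t s≉0 = neighbour 𝒜 {i} {y} {∞} {α} {aff t} (slides-at Py) Py ∞∦aff s≉0

      not-both : ∀ {y t s} → ¬ s ≈ 0# → Left y t s → ¬ Right y t s
      not-both {y} {t} {s} s≉0 L R = no-commute {α} {t} {s} α≉0 s≉0
        (cancel-right 𝒜 {a} {low t s} {low t s} {a} {y} (≃-trans (≃-sym L) R))

      -- If the second point were right as seen from y and also from the first point, cancelling
      -- would make `up α` commute with `low t s`.
      spread-edge : ∀ {y t s t′ s′ τ} → P y → ¬ s ≈ 0# → ¬ s′ ≈ 0# → Left y t s → ¬ low t s ∙ y ≃ low t′ s′ ∙ y →
        low t s ∙ y ─[ aff τ ]─ low t′ s′ ∙ y → Left y t′ s′
      spread-edge {y} {t} {s} {t′} {s′} {τ} Py s≉0 s′≉0 L z≄z′ (k by z′≃) =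
        [ (λ e → e) , (λ R → [ (λ e → P-resp (≃-sym z′≃) e) , (λ R′ →
          ⊥-elim (absurd R R′)) ]′ (left-or-right {z} L τ k≉0)) ]′ (left-or-right Py t′ s′≉0)
        where
        z : SL
        z = low t s ∙ y
        k≉0 : ¬ k ≈ 0#
        k≉0 k≈0 = z≄z′ (≃-sym (≃-trans z′≃ (s≈0⇒ux≃x {aff τ} k≈0)))
        absurd : Right y t′ s′ → ¬ Right z τ k
        absurd R R′ = no-commute {α} {t} {s} α≉0 s≉0 (≃-cancelˡ (low τ k) _ _ (≃-cancelʳ y _ _ (begin
          low τ k ∙ (a ∙ low t s) ∙ y   ≈⟨ ≃-trans (≃-assoc _ _ y) (≃-∙ˡ (≃-assoc a (low t s) y)) ⟩
          low τ k ∙ (a ∙ z)             ≈⟨ R′ ⟨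
          act i (low τ k ∙ z)           ≈⟨ act-cong i z′≃ ⟨
          act i (low t′ s′ ∙ y)         ≈⟨ R ⟩
          low t′ s′ ∙ (a ∙ y)           ≈⟨ ≃-∙ʳ (≃-cancelʳ y _ _ (≃-trans z′≃ (≃-sym (≃-assoc _ _ y)))) ⟩
          low τ k ∙ low t s ∙ (a ∙ y)   ≈⟨ ≃-trans (≃-assoc _ _ _) (≃-∙ˡ (≃-sym (≃-assoc _ a y))) ⟩
          low τ k ∙ (low t s ∙ a ∙ y)   ≈⟨ ≃-assoc _ _ y ⟨
          low τ k ∙ (low t s ∙ a) ∙ y   ∎)))
          where
          open ≃-Reasoning

      spread-line : ∀ {y t s s′} → P y → ¬ s ≈ 0# → ¬ s′ ≈ 0# → Left y t s → Left y t s′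
      spread-line {y} {t} {s} {s′} Py s≉0 s′≉0 L = main (s ≟ s′)
        where
        main : Dec (s ≈ s′) → Left y t s′
        main (yes s≈s′) = P-resp (≃-∙ʳ (u-cong ⟪ aff t ⟫ s≈s′)) L
        main (no s≉s′) = spread-edge {τ = t} Py s≉0 s′≉0 L (λ eq → s≉s′ (u-injective {aff t} (≃-cancelʳ y _ _ eq)))
          (line-trans (line-sym (u-line (aff t) s y)) (u-line (aff t) s′ y))

      -- Points in one direction are joined by an affine line. Distinct directions are linked
      -- through their `partners`, whose joining line is affine as `spread-edge` demands.
      spread : ∀ {y t s t′ s′} → P y → ¬ s ≈ 0# → ¬ s′ ≈ 0# → Left y t s → Left y t′ s′
      spread {y} {t} {s} {t′} {s′} Py s≉0 s′≉0 L = main (t′ - t ≟ 0#)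
        where
        main : Dec (t′ - t ≈ 0#) → Left y t′ s′
        main (yes e≈0) = P-resp (≃-∙ʳ (∥⇒u {aff t} {aff t′} s′ (∥-intro
          (by₁ (- 1#) (solve 2 (λ t t′ → t :* p1 :- p1 :* t′ :- p0 := :- p1 :* (t′ :- t :- p0))
            refl t t′) e≈0)))) (spread-line Py s≉0 s′≉0 L)
        main (no e≉0) = let τ , on = partners {t} {t′} e≉0 y in
          spread-line {s = - 4# * m} Py -4m≉0 s′≉0 (spread-edge {s = m}
            {τ = τ} Py m≉0 -4m≉0 (spread-line Py s≉0 m≉0 L) apart on)
          where
          m : Carrier
          m = inv e≉0
          m≉0 : ¬ m ≈ 0#
          m≉0 = inv≉0 e≉0
          -4m≉0 : ¬ - 4# * m ≈ 0#
          -4m≉0 = *-≉0 (neg≉0 𝒜 4≉0) m≉0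
          apart : ¬ low t m ∙ y ≃ low t′ (- 4# * m) ∙ y
          apart eq = m≉0 (u≃u⇒s≈0 {⟪ aff t ⟫} {m} {⟪ aff t′ ⟫} { - 4# * m}
            (λ e → e≉0 (by₁ (- 1#) (solve 2 (λ t t′ → t′ :- t :- p0 := :- p1 :* (t :* p1 :- p1 :* t′ :- p0))
              refl t t′) e)) (≃-cancelʳ y _ _ eq))

      record AllLeft (y : SL) : Set (c ⊔ ℓ) where
        field
          here : P y
          left : ∀ t {s} → ¬ s ≈ 0# → Left y t s

      all-left-resp : ∀ {x y} → x ≃ y → AllLeft x → AllLeft y
      all-left-resp x≃y h = record { here = P-resp x≃y here ; left = λ t s≉0 → P-resp (≃-∙ˡ x≃y) (left t s≉0) }
        where open AllLeft h

      -- Seen from the new point, y is a left neighbour at parameter -s, and this seeds `spread`.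
      all-left-step : ∀ t s {y} → AllLeft y → AllLeft (low t s ∙ y)
      all-left-step t s {y} h = main (s ≟ 0#)
        where
        open AllLeft h
        main : Dec (s ≈ 0#) → AllLeft (low t s ∙ y)
        main (yes s≈0) = all-left-resp (≃-sym (s≈0⇒ux≃x {aff t} s≈0)) h
        main (no s≉0) = record { here = left t s≉0
          ; left = λ t′ s′≉0 → spread {low t s ∙ y} {t} { - s} (left t s≉0) (neg≉0 𝒜 s≉0) s′≉0 (P-resp (≃-sym
            (u-cancel ⟪ aff t ⟫ s y)) here) }

      left-translation : ∀ {t s} → ¬ s ≈ 0# → Left 𝟙 t s → ∀ g → act i g ≃ a ∙ g
      left-translation {t} {s} s≉0 L g = AllLeft.here (generated AllLeft all-left-resp all-left-step
        (record { here = P-𝟙 ; left = λ t′ s′≉0 → spread P-𝟙 s≉0 s′≉0 L }) g)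

    -- The whole root group acts by left translations as soon as one of its elements does; hence every
    -- element of the action commutes with it.
    module LeftTranslations {i α} (slides : Slides i 𝟙 ∞) (i≃a : ∀ g → act i g ≃ up α ∙ g) where
      -- Left translation by `up α` joins x to a second point of its ∞-line; j commutes with it, so
      -- this pair fixes the direction of the image line.
      act-∞ : ∀ j {x y} → x ─[ ∞ ]─ y → act j x ─[ ∞ ]─ act j y
      act-∞ j {x} = act-lines j {∞} {∞} {x} {act i x} (λ eq → Slides.moves slides (≃-sym (free {i} {x} (≃-sym eq) 𝟙)))
        (α by i≃a x) (α by ≃-trans (act-comm j i x) (i≃a (act j x)))

      translate : ∀ r → ¬ r ≈ 0# → ∀ g → act (to (up r)) g ≃ up r ∙ g
      translate r r≉0 = LeftOrRight.left-translation {k} {r} sl (act-to (up r)) {0#} {1#} (λ e → 0≉1 (sym e))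
        ([ (λ L → L) , ⊥-elim ∘ not-right ]′ (LeftOrRight.left-or-right {k} {r} sl (act-to (up r)) (LeftOrRight.P-𝟙 {k}
          {r} sl (act-to (up r))) 0# (λ e → 0≉1 (sym e))))
        where
        k : Index
        k = to (up r)
        b : SL
        b = low 0# 1#
        𝟙-∞ : 𝟙 ─[ ∞ ]─ act k 𝟙
        𝟙-∞ = r by ≃-trans (act-to (up r)) (≃-sym (≃-identityʳ (up r)))
        sl : Slides k 𝟙 ∞
        sl = record { moves = λ eq → r≉0 (u≃𝟙⇒s≈0 {∞} (≃-sym (≃-trans eq (act-to (up r)))))
                    ; along = 𝟙-∞ ; stable = λ on → line-trans 𝟙-∞ (act-∞ k on) }
        -- By commutativity the image of b lies on the ∞-line through b. Acting from the right would
        -- give `up σ ∙ b ≃ b ∙ up r` for some σ, and `uu≃uu` then yields 1 = -1.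
        not-right : ¬ act k (b ∙ 𝟙) ≃ b ∙ (up r ∙ 𝟙)
        not-right R = s≉-s (λ e → 0≉1 (sym e)) (proj₁ (uu≃uu {⟪ ∞ ⟫} {r} {⟪ aff 0# ⟫} {1#} {step on}
          {1#} (ω∞aff≉0 0#) r≉0 (λ e → 0≉1 (sym e))
          (≃-trans (cancel-right 𝒜 {b} {up r} {up (step on)} {b} (≃-trans (≃-sym R) (≃-trans (y≃ux on) (≃-∙ˡ (≃-sym
            (≃-identityʳ b))))) ) ≃-refl)))
          where
          j : Index
          j = to b
          j𝟙 : act j 𝟙 ≃ b
          j𝟙 = act-to b
          on : b ─[ ∞ ]─ act k (b ∙ 𝟙)
          on = line-resp j𝟙 (≃-trans (act-comm j k 𝟙) (act-cong k (≃-trans j𝟙 (≃-sym (≃-identityʳ b))))) (act-∞ j 𝟙-∞)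

      act-up : ∀ j r g → act j (up r ∙ g) ≃ up r ∙ act j g
      act-up j r g = main (r ≟ 0#)
        where
        main : Dec (r ≈ 0#) → act j (up r ∙ g) ≃ up r ∙ act j g
        main (yes r≈0) = ≃-trans (act-cong j (s≈0⇒ux≃x {∞} r≈0)) (≃-sym (s≈0⇒ux≃x {∞} r≈0))
        main (no r≉0) = ≃-trans (act-cong j (≃-sym (translate r r≉0 g)))
          (≃-trans (act-comm j (to (up r)) g) (translate r r≉0 (act j g)))

-- Corner and trace as invariants of the action.

module TraceInvariants {c ℓ q} (F : FiniteField c ℓ q) (2∤q : ¬ 2 ∣ q) (5≤q : 5 ℕ.≤ q) where
  open FiniteField F hiding (zero)
  open FieldTheory F
  open Odd 2∤q
  open MatP
  open Geometry F 2∤q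
  open LinePreservation F 2∤q 5≤q
  open Translations F 2∤q 5≤q
  open Grid F 2∤q 5≤q
  open Colouring F 2∤q 5≤q

  -- The bottom rows of x and y have determinant corner x y.
  corner trace : SL → SL → Carrier
  corner x y = (x ∙ y ⁻¹) ₂₁
  trace x y = tr (x ∙ y ⁻¹)

  abstract
    tr-up : ∀ g r → tr (g ∙ up (- r)) ≈ tr g - r * g ₂₁
    tr-up (mat a b c′ d , _) r = solve 5 (λ a b c d r → trP (matP a b c d ∙P uP p1 p0 (:- r)) := a :+ d :- r :* c)
      refl a b c′ d r

    ratio-up : ∀ r y x → x ∙ (up r ∙ y) ⁻¹ ≃ x ∙ y ⁻¹ ∙ up (- r)
    ratio-up r y x = ≃-trans (≃-∙ˡ (≃-trans (≃-⁻¹-∙ (up r) y) (≃-∙ˡ (u-⁻¹ ⟪ ∞ ⟫ r)))) (≃-sym (≃-assoc x (y ⁻¹) _))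

    -- Adjacency of x to points of the ∞-line through y is quadratic in r; for corner c ≠ 0 and
    -- trace τ the solutions are (τ ± 2)/c.
    ↔-up : ∀ {r y x} → up r ∙ y ↔ x → (trace x y - r * corner x y) * (trace x y - r * corner x y) ≈ 4#
    ↔-up {r} {y} {x} p = trans (sym (*-cong e e)) (tr²≈4 (Par-resp (ratio-up r y x) (ratio p)))
      where e : tr (x ∙ y ⁻¹ ∙ up (- r)) ≈ trace x y - r * corner x y
            e = tr-up (x ∙ y ⁻¹) r

    up-↔ : ∀ {r y x} → (trace x y - r * corner x y) * (trace x y - r * corner x y) ≈ 4# → up r ∙ y ↔ x
    up-↔ {r} {y} {x} h = adjacent (Par-resp (≃-sym (ratio-up r y x)) (par (trans (*-cong e e) h)))
      where e : tr (x ∙ y ⁻¹ ∙ up (- r)) ≈ trace x y - r * corner x y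
            e = tr-up (x ∙ y ⁻¹) r

    ∞⇒corner≈0 : ∀ {y x} → y ─[ ∞ ]─ x → corner x y ≈ 0#
    ∞⇒corner≈0 {y} {x} (k by x≃) = trans (e₂₁ e) (solve 2 (λ ε k → ε :* p₂₁ (uP p1 p0 k) := p0) refl (sgn e) k)
      where e : x ∙ y ⁻¹ ≃ up k
            e = ≃-trans (≃-∙ʳ x≃) (xy∙y⁻¹ y (up k))

    -- At corner 0 the condition no longer involves r, so x is adjacent to the whole line and
    -- `on-line` applies.
    corner≈0⇒∞ : ∀ {y x} → corner x y ≈ 0# → trace x y * trace x y ≈ 4# → y ─[ ∞ ]─ x
    corner≈0⇒∞ {y} {x} c≈0 τ² = on-line λ r → up-↔ {r} {y} {x} (trans (*-cong (lem r) (lem r)) τ²)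
      where lem : ∀ r → trace x y - r * corner x y ≈ trace x y
            lem r = by₁ (- r) (solve 3 (λ t r k → t :- r :* k :- t := :- r :* (k :- p0))
              refl (trace x y) r (corner x y)) c≈0

    corner≈0∨∞ : ∀ {y x r} → corner x y ≈ 0# → up r ∙ y ↔ x → y ─[ ∞ ]─ x
    corner≈0∨∞ {y} {x} {r} c≈0 p = corner≈0⇒∞ c≈0 (trans (*-cong lem lem) (↔-up p))
      where lem : trace x y ≈ trace x y - r * corner x y
            lem = by₁ r (solve 3 (λ t r k → t :- (t :- r :* k) := r :* (k :- p0)) refl (trace x y) r (corner x y)) c≈0

    ±2 : ∀ {t} → t * t ≈ 4# → t ≈ 2# ⊎ t ≈ - 2#
    ±2 t² = x²≈y²⇒x≈±y (trans t² (solve 0 (p4 := p2 :* p2) refl))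

    -- The parameters (τ ± 2)/c solve the quadratic condition for c′ and τ′ too. Equal signs would
    -- give 4c′/c = 0; opposite signs determine (c′, τ′) as ±(c, τ).
    affine : ∀ {c τ c′ τ′} (c≉0 : ¬ c ≈ 0#) → ¬ c′ ≈ 0# →
      τ′ - (τ - 2#) * inv c≉0 * c′ ≈ 2# ⊎ τ′ - (τ - 2#) * inv c≉0 * c′ ≈ - 2# →
      τ′ - (τ + 2#) * inv c≉0 * c′ ≈ 2# ⊎ τ′ - (τ + 2#) * inv c≉0 * c′ ≈ - 2# →
      ∃ λ η → η * η ≈ 1# × c′ ≈ η * c × τ′ ≈ η * τ
    affine {c} {τ} {c′} {τ′} c≉0 c′≉0 = λ
      { (inj₁ p) (inj₁ m) → ⊥-elim (same p m)
      ; (inj₂ p) (inj₂ m) → ⊥-elim (same p m)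
      ; (inj₁ p) (inj₂ m) →
        let c′≈c = *-cancelˡ 4≉0 (by₃ c (- c) (- (p4′ * c′)) (solve 5 (λ c t k s i → p4 :* k :- p4 :* (p1 :* c) := c :* (s :- (t :- p2) :* i :* k :- p2) :+ :- c :* (s :- (t :+ p2) :* i :* k :- :- p2) :+ :- (p4 :* k) :* (c :* i :- p1)) refl c τ c′ τ′ i) p m ci)
          in 1# , *-identityˡ 1# , c′≈c , by₃ 1# ((τ - 2#) * i) (τ - 2#) (solve 5 (λ c t k s i → s :- p1 :* t :=
            p1 :* (s :- (t :- p2) :* i :* k :- p2) :+ (t :- p2) :* i :* (k :- p1 :* c) :+ (t :- p2) :* (c :* i :- p1))
            refl c τ c′ τ′ i) p c′≈c ci
      ; (inj₂ p) (inj₁ m) →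
        let c′≈-c = *-cancelˡ 4≉0 (by₃ c (- c) (- (p4′ * c′)) (solve 5 (λ c t k s i → p4 :* k :- p4 :* (:- p1 :* c) := c :* (s :- (t :- p2) :* i :* k :- :- p2) :+ :- c :* (s :- (t :+ p2) :* i :* k :- p2) :+ :- (p4 :* k) :* (c :* i :- p1)) refl c τ c′ τ′ i) p m ci)
          in - 1# , solve 0 (:- p1 :* :- p1 := p1) refl , c′≈-c , by₃ 1# ((τ - 2#) * i) (- (τ - 2#))
            (solve 5 (λ c t k s i → s :- :- p1 :* t := p1 :* (s :- (t :- p2) :* i :* k :- :- p2)
            :+ (t :- p2) :* i :* (k :- :- p1 :* c) :+ :- (t :- p2) :* (c :* i :- p1)) refl c τ c′ τ′ i) p c′≈-c ci }
      where
      p4′ : Carrier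
      p4′ = 4#
      i : Carrier
      i = inv c≉0
      ci : c * i ≈ 1#
      ci = inv-inverse c≉0
      same : ∀ {e} → τ′ - (τ - 2#) * i * c′ ≈ e → τ′ - (τ + 2#) * i * c′ ≈ e → ⊥
      same {e} p m = *-≉0 4≉0 (*-≉0 (inv≉0 c≉0) c′≉0) (by₂ 1# (- 1#) (solve 5 (λ t k s i e → p4 :* (i :* k) :- p0 :=
        p1 :* (s :- (t :- p2) :* i :* k :- e) :+ :- p1 :* (s :- (t :+ p2) :* i :* k :- e)) refl τ c′ τ′ i e) p m)

  module _ {ι} (𝒜 : AbelianAction ι) where
    open AbelianAction 𝒜
    module _ (act-up : ∀ j r g → act j (up r ∙ g) ≃ up r ∙ act j g) where

      act-∞ : ∀ j {y x} → y ─[ ∞ ]─ x → act j y ─[ ∞ ]─ act j x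
      act-∞ j {y} (k by x≃) = k by ≃-trans (act-cong j x≃) (act-up j k y)

      ∞-act : ∀ j {y x} → act j y ─[ ∞ ]─ act j x → y ─[ ∞ ]─ x
      ∞-act j {y} (k by jx≃) = k by act-injective j (≃-trans jx≃ (≃-sym (act-up j k y)))

      ↔-act : ∀ j {r y x} → up r ∙ act j y ↔ act j x → up r ∙ y ↔ x
      ↔-act j {r} {y} {x} p = ↔-resp (≃-trans (act⁻¹-cong j
        (≃-sym (act-up j r y))) (act⁻¹-act j _)) (act⁻¹-act j x) (act⁻¹-↔ j p)

      act-↔-up : ∀ j {r y x} → up r ∙ y ↔ x → up r ∙ act j y ↔ act j x
      act-↔-up j {r} {y} p = ↔-resp (act-up j r y) ≃-refl (act-↔ j p)

      meets : ∀ {y x} (c≉0 : ¬ corner x y ≈ 0#) → up ((trace x y - 2#) * inv c≉0) ∙ y ↔ x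
      meets {y} {x} c≉0 = up-↔ {(trace x y - 2#) * inv c≉0} {y} {x} (trans (*-cong lem lem) (solve 0 (p2 :* p2 :=
        p4) refl))
        where
        i = inv c≉0
        lem : trace x y - (trace x y - 2#) * i * corner x y ≈ 2#
        lem = by₁ (- (trace x y - 2#)) (solve 3 (λ t k i → t :- (t :- p2) :* i :* k :- p2 :=
          :- (t :- p2) :* (k :* i :- p1)) refl (trace x y) (corner x y) i) (inv-inverse c≉0)

      meets′ : ∀ {y x} (c≉0 : ¬ corner x y ≈ 0#) → up ((trace x y + 2#) * inv c≉0) ∙ y ↔ x
      meets′ {y} {x} c≉0 = up-↔ {(trace x y + 2#) * inv c≉0} {y} {x} (trans (*-cong lem lem) (solve 0 (:- p2 :* :- p2 :=
        p4) refl))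
        where
        i = inv c≉0
        lem : trace x y - (trace x y + 2#) * i * corner x y ≈ - 2#
        lem = by₁ (- (trace x y + 2#)) (solve 3 (λ t k i → t :- (t :+ p2) :* i :* k :- :- p2 := :- (t
          :+ p2) :* (k :* i :- p1)) refl (trace x y) (corner x y) i) (inv-inverse c≉0)

      -- A nonzero corner gives X a neighbour on the ∞-line of Y. Pulled back, this puts x on the
      -- ∞-line of y, hence X on that of Y, where the corner is 0.
      corner-zero : ∀ j {x y X Y} → X ≃ act j x → Y ≃ act j y → corner x y ≈ 0# → corner X Y ≈ 0#
      corner-zero j {x} {y} {X} {Y} X≃ Y≃ c≈0 = decidable-stable (corner X Y ≟ 0#) λ C≉0 →
        C≉0 (∞⇒corner≈0 (line-resp (≃-sym Y≃) (≃-sym X≃) (act-∞ j (corner≈0∨∞ c≈0 (↔-act j (↔-resp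
          (≃-∙ˡ Y≃) X≃ (meets C≉0)))))))

      -- As j commutes with every `up r`, the parameters of the neighbours of x on the ∞-line of y
      -- also work for X and Y.
      invariants : ∀ j {x y X Y} → X ≃ act j x → Y ≃ act j y → ¬ corner x y ≈ 0# →
        ∃ λ η → η * η ≈ 1# × corner X Y ≈ η * corner x y × trace X Y ≈ η * trace x y
      invariants j {x} {y} {X} {Y} X≃ Y≃ c≉0 = affine c≉0 C≉0 (±2 (↔-up r₊)) (±2 (↔-up r₋))
        where
        r₊ : up ((trace x y - 2#) * inv c≉0) ∙ Y ↔ X
        r₊ = ↔-resp (≃-∙ˡ (≃-sym Y≃)) (≃-sym X≃) (act-↔-up j (meets c≉0))
        r₋ : up ((trace x y + 2#) * inv c≉0) ∙ Y ↔ X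
        r₋ = ↔-resp (≃-∙ˡ (≃-sym Y≃)) (≃-sym X≃) (act-↔-up j (meets′ c≉0))
        C≉0 : ¬ corner X Y ≈ 0#
        C≉0 C≈0 = c≉0 (∞⇒corner≈0 (∞-act j (line-resp Y≃ X≃ (corner≈0∨∞ C≈0 r₊))))

      -- Compare with the right translation by diag(λ⁻¹, λ): commutativity forces λ⁴ = 1, and then the traces clash.
      module _ {λ′ i : Carrier} (λi≈1 : λ′ * i ≈ 1#) where
        private
          -- Normalised to have corner 1 and trace z relative to `𝟙`.
          w : Carrier → SL
          w z = mat 0# (- 1#) 1# z , solve 1 (λ z → p0 :* z :- :- p1 :* p1 := p1) refl z
          d : SL
          d = mat i 0# 0# λ′ , trans (solve 2 (λ l i → i :* l :- p0 :* p0 := l :* i) refl λ′ i) λi≈1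
          j : Index
          j = to d
          X : Carrier → SL
          X z = act j (w z)

          -- By commutativity `X z` is also the image of `d` under the element taking `𝟙` to `w z`.
          -- Since `d` and `𝟙` have corner 0, the bottom rows of `X z` and `w z` are proportional.
          row : ∀ z → X z ₂₂ ≈ X z ₂₁ * z
          row z = by₁ (- 1#) (solve 3 (λ x y z → y :- x :* z := :- p1 :* (x :* z :+ y :* :- p1 :- p0))
            refl (X z ₂₁) (X z ₂₂) z)
            (corner-zero (to (w z)) {d} {𝟙} {X z} {w z}
              (≃-trans (act-cong j (≃-sym (act-to (w z))))
                (≃-trans (act-comm j (to (w z)) 𝟙) (act-cong (to (w z)) (act-to d))))
              (≃-sym (act-to (w z)))
              (solve 1 (λ l → p0 :* p1 :+ l :* :- p0 := p0) refl λ′))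

          inv-w : ∀ z → ∃ λ η → η * η ≈ 1# × corner (X z) d ≈ η * corner (w z) 𝟙 × trace (X z) d ≈ η * trace (w z) 𝟙
          inv-w z = invariants j {w z} {𝟙} ≃-refl (≃-sym (act-to d)) (λ e → 0≉1 (trans (sym e) (solve 1 (λ z → p1 :* p1
            :+ z :* :- p0 := p1) refl z)))

          η : Carrier → Carrier
          η z = proj₁ (inv-w z)
          η² : ∀ z → η z * η z ≈ 1#
          η² z = proj₁ (proj₂ (inv-w z))

          x₂₁ : ∀ z → X z ₂₁ ≈ η z * i
          x₂₁ z = by₂ i (- (X z ₂₁)) (solve 6 (λ l i η x y z → x :- η :* i := i :* (x :* l
            :+ y :* :- p0 :- η :* (p1 :* p1 :+ z :* :- p0)) :+ :- x :* (l :* i :- p1))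
            refl λ′ i (η z) (X z ₂₁) (X z ₂₂) z) (proj₁ (proj₂ (proj₂ (inv-w z)))) λi≈1

          x₂₂ : ∀ z → X z ₂₂ ≈ η z * i * z
          x₂₂ z = trans (row z) (*-congʳ (x₂₁ z))

          x₁₁ : ∀ z → X z ₁₁ ≈ i * (η z * z) - i * i * (X z ₂₂)
          x₁₁ z = by₂ i (- (X z ₁₁)) (solve 8 (λ l i η a b x y z → a :- (i :* (η :* z) :- i :* i :* y) :=
              i :* (a :* l :+ b :* :- p0 :+ (x :* :- p0 :+ y :* i) :- η :* (p0 :* p1 :+ :- p1 :* :- p0 :+ (p1 :* :- p0
                :+ z :* p1))) :+ :- a :* (l :* i :- p1))
            refl λ′ i (η z) (X z ₁₁) (X z ₁₂) (X z ₂₁) (X z ₂₂) z) (proj₂ (proj₂ (proj₂ (inv-w z)))) λi≈1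

          -- The points compared are those for z = 0 and z = λ′; the latter value turns `X λ′ ₂₂`
          -- into a bare sign.
          η₀ η₁ : Carrier
          η₀ = η 0#
          η₁ = η λ′

          y₂₂ : X 0# ₂₂ ≈ 0#
          y₂₂ = trans (x₂₂ 0#) (zeroʳ _)
          y₁₁ : X 0# ₁₁ ≈ 0#
          y₁₁ = trans (x₁₁ 0#) (by₁ (- (i * i)) (solve 3 (λ i η y → i :* (η :* p0) :- i :* i :* y :- p0 :=
            :- (i :* i) :* (y :- p0)) refl i η₀ (X 0# ₂₂)) y₂₂)
          -y₁₂i : - (X 0# ₁₂) * i ≈ η₀
          -y₁₂i = by₃ η₀ (- (- (X 0# ₁₂) * i)) 1# (solve 5 (λ i η a b x → :- b :* i :- η :=
              η :* (p0 :- b :* (η :* i) :- p1) :+ :- (:- b :* i) :* (η :* η :- p1) :+ p1 :* (p0 :- p0))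
                refl i η₀ (X 0# ₁₁) (X 0# ₁₂) (X 0# ₂₁))
            (trans (+-cong (trans (sym (zeroʳ _)) (*-congˡ (sym y₂₂))) (-‿cong (*-congˡ
              (sym (x₂₁ 0#))))) (det₁ (X 0#))) (η² 0#) (refl {0#})

          z₂₂ : X λ′ ₂₂ ≈ η₁
          z₂₂ = trans (x₂₂ λ′) (by₁ η₁ (solve 3 (λ l i η → η :* i :* l :- η := η :* (l :* i :- p1)) refl λ′ i η₁) λi≈1)
          z₁₁ : X λ′ ₁₁ ≈ η₁ - i * i * η₁
          z₁₁ = by₃ 1# η₁ (- (i * i)) (solve 5 (λ l i η a y → a :- (η :- i :* i :* η) :=
            p1 :* (a :- (i :* (η :* l) :- i :* i :* y)) :+ η :* (l :* i :- p1) :+ :- (i :* i) :* (y :- η))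
            refl λ′ i η₁ (X λ′ ₁₁) (X λ′ ₂₂))
            (x₁₁ λ′) λi≈1 z₂₂
          z₁₂ : X λ′ ₁₂ ≈ - (η₁ * i)
          z₁₂ = by₃ (- (η₁ * λ′)) (λ′ * η₁ - λ′ * (η₁ * (i * i)) - X λ′ ₁₂) (- (η₁ * η₁ * X λ′ ₁₂) - η₁ * i)
            (solve 4 (λ l i η b → b :- :- (η :* i) := :- (η :* l) :* ((η :- i :* i :* η) :* η :- b :* (η :* i) :- p1)
              :+ (l :* η :- l :* (η :* (i :* i)) :- b) :* (η :* η :- p1)
              :+ (:- (η :* η :* b) :- η :* i) :* (l :* i :- p1)) refl λ′ i η₁ (X λ′ ₁₂))
            (trans (+-cong (sym (*-cong z₁₁ z₂₂)) (-‿cong (*-congˡ (sym (x₂₁ λ′))))) (det₁ (X λ′))) (η² λ′) λi≈1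

          λ≉0 : ¬ λ′ ≈ 0#
          λ≉0 l≈0 = 0≉1 (trans (sym (zeroˡ i)) (trans (*-congʳ (sym l≈0)) λi≈1))

          inv-pair : ∃ λ η →
            η * η ≈ 1# × corner (X 0#) (X λ′) ≈ η * corner (w 0#) (w λ′) × trace (X 0#) (X λ′) ≈ η * trace (w 0#) (w λ′)
          inv-pair = invariants j {w 0#} {w λ′} ≃-refl ≃-refl (λ e → λ≉0 (trans (sym (solve 1 (λ l → p1 :* l
            :+ p0 :* :- p1 := l) refl λ′)) e))

          η₂ : Carrier
          η₂ = proj₁ inv-pair

          corner≈ : η₀ * η₁ * i ≈ η₂ * λ′
          corner≈ = trans (sym lhs) (trans (proj₁ (proj₂ (proj₂ inv-pair))) (*-congˡ (solve 1 (λ l → p1 :* l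
            :+ p0 :* :- p1 := l) refl λ′)))
            where
            lhs : corner (X 0#) (X λ′) ≈ η₀ * η₁ * i
            lhs = trans (+-cong (*-cong (x₂₁ 0#) z₂₂) (*-congʳ y₂₂)) (solve 4 (λ a b i x → a :* i :* b :+ p0 :* :- x :=
              a :* b :* i) refl η₀ η₁ i (X λ′ ₂₁))

          trace≈ : η₀ * η₁ * (1# + i * i) ≈ η₂ * 2#
          trace≈ = trans (sym lhs) (trans (proj₂ (proj₂ (proj₂ inv-pair))) (*-congˡ (solve 1 (λ l → p0 :* l
            :+ :- p1 :* :- p1 :+ (p1 :* :- :- p1 :+ p0 :* p0) := p2) refl λ′)))
            where
            lhs : trace (X 0#) (X λ′) ≈ η₀ * η₁ * (1# + i * i)
            lhs = trans (+-cong (+-cong (*-congʳ y₁₁) (*-congˡ (-‿cong (x₂₁ λ′))))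
              (+-cong (*-cong (x₂₁ 0#) (-‿cong z₁₂)) (*-congʳ y₂₂)))
              (by₁ η₁ (solve 6 (λ a b i x y z → p0 :* z :+ y :* :- (b :* i) :+ (a :* i :* :- :- (b :* i)
                :+ p0 :* x) :- a :* b :* (p1 :+ i :* i) := b :* (:- y :* i :- a))
                refl η₀ η₁ i (X λ′ ₁₁) (X 0# ₁₂) (X λ′ ₂₂)) -y₁₂i)

        clash : ¬ λ′ ≈ 1# → ¬ λ′ ≈ - 1# → ⊥
        clash λ≉1 λ≉-1 = [ (λ e → [ λ≉1 , λ≉-1 ]′ (±1 e)) , last ]′ (±1 λ⁴≈1)
          where
          ε : Carrier
          ε = η₀ * η₁
          ε² : ε * ε ≈ 1#
          ε² = by₂ (η₁ * η₁) 1# (solve 2 (λ a b → a :* b :* (a :* b) :- p1 := b :* b :* (a :* a :- p1)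
            :+ p1 :* (b :* b :- p1)) refl η₀ η₁) (η² 0#) (η² λ′)
          η₂² : η₂ * η₂ ≈ 1#
          η₂² = proj₁ (proj₂ inv-pair)
          i²≈λ² : i * i ≈ λ′ * λ′
          i²≈λ² = by₃ (ε * i + η₂ * λ′) (- (i * i)) (λ′ * λ′) (solve 4 (λ e h l i → i :* i :- l :* l :=
            (e :* i :+ h :* l) :* (e :* i :- h :* l) :+ :- (i :* i) :* (e :* e :- p1) :+ l :* l :* (h :* h :- p1))
              refl ε η₂ λ′ i) corner≈ ε² η₂²
          λ⁴≈1 : λ′ * λ′ * (λ′ * λ′) ≈ 1#
          λ⁴≈1 = by₂ (- (λ′ * λ′)) (λ′ * i + 1#) (solve 2 (λ l i → l :* l :* (l :* l) :- p1 :=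
            :- (l :* l) :* (i :* i :- l :* l) :+ (l :* i :+ p1) :* (l :* i :- p1)) refl λ′ i) i²≈λ² λi≈1
          -- Now 1 + λ⁻² = 0, so the two images have trace 0, whereas the original pair has trace 2.
          last : λ′ * λ′ ≈ - 1# → ⊥
          last λ²≈-1 = 0≉1 (trans (sym (trans (*-congˡ η₂≈0) (zeroʳ η₂))) η₂²)
            where
            η₂≈0 : η₂ ≈ 0#
            η₂≈0 = *-cancelˡ 2≉0 (by₃ (- 1#) ε ε (solve 4 (λ e h l i → p2 :* h :- p2 :* p0 := :- p1 :* (e :* (p1
              :+ i :* i) :- h :* p2) :+ e :* (i :* i :- l :* l) :+ e :* (l :* l :- :- p1))
              refl ε η₂ λ′ i) trace≈ i²≈λ² λ²≈-1)

      no-commuting-action : ⊥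
      no-commuting-action = main (fresh (0# ∷ 1# ∷ - 1# ∷ []) (ℕₚ.≤-trans (s≤s (s≤s (s≤s (s≤s z≤n)))) 5≤q))
        where
        main : (∃ λ y → All (λ x → ¬ y ≈ x) (0# ∷ 1# ∷ - 1# ∷ [])) → ⊥
        main (l , l≉0 ∷ l≉1 ∷ l≉-1 ∷ []) = clash (inv-inverse l≉0) l≉1 l≉-1

-- The freshman's dream in characteristic p.

prime∤! : ∀ {p} → Prime p → ∀ k → k ℕ.< p → ¬ p ∣ k !
prime∤! {p} p-prime zero _ p∣1 = ℕₚ.<⇒≱ (nonTrivial⇒n>1 p {{prime⇒nonTrivial p-prime}}) (∣⇒≤ p∣1)
prime∤! p-prime (suc k) k<p p∣ = [ (λ p∣k+1 → ℕₚ.<⇒≱ k<p (∣⇒≤ p∣k+1)) ,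
  prime∤! p-prime k (ℕₚ.<-trans (ℕₚ.n<1+n k) k<p) ]′
  (euclidsLemma (suc k) (k !) p-prime p∣)

prime∣C : ∀ {p k} → Prime p → 0 ℕ.< k → k ℕ.< p → p ∣ p choose k
prime∣C {p@(suc n)} {k} p-prime 0<k k<p = [ (λ h → h) , (λ h →
  ⊥-elim ([ prime∤! p-prime k k<p , prime∤! p-prime (p ℕ.∸ k) (ℕₚ.∸-monoʳ-< 0<k (ℕₚ.<⇒≤ k<p)) ]′
    (euclidsLemma (k !) ((p ℕ.∸ k) !) p-prime h))) ]′
  (euclidsLemma (p choose k) (k ! ℕ.* (p ℕ.∸ k) !) p-prime (≡.subst (p ∣_) (≡.sym product) (m∣m*n (n !))))
  where
  instance _ = (k ℕₚ.!* (p ℕ.∸ k) !≢0)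
  product : (p choose k) ℕ.* (k ! ℕ.* (p ℕ.∸ k) !) ≡ p !
  product = ≡.trans (≡.cong (ℕ._* (k ! ℕ.* (p ℕ.∸ k) !)) (nCk≡n!/k![n-k]! (ℕₚ.<⇒≤ k<p))) (m/n*n≡m (k![n∸k]!∣n! (ℕₚ.<⇒≤ k<p)))

module FreshmansDream {a ℓ} (S : Semiring a ℓ) {p} (p-prime : Prime p) where
  open Semiring S hiding (zero)
  open Mult S using (×-congʳ; ×-assocˡ) renaming (_×_ to _⨯_)
  open Exp S
  open Sum S
  open SetoidReasoning setoid

  ⨯-zero : ∀ n → n ⨯ 0# ≈ 0#
  ⨯-zero zero    = refl
  ⨯-zero (suc n) = trans (+-identityˡ _) (⨯-zero n)

  1^n≈1 : ∀ n → 1# ^ n ≈ 1#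
  1^n≈1 zero    = refl
  1^n≈1 (suc n) = trans (*-identityˡ _) (1^n≈1 n)

  private
    module B (x : Carrier) = Binomial S x 1#

    multiples-vanish : ∀ {n} → (∀ x → p ⨯ x ≈ 0#) → p ∣ n → ∀ x → n ⨯ x ≈ 0#
    multiples-vanish char (divides k ≡.refl) x = trans (sym (×-assocˡ x k p)) (trans (×-congʳ k (char x)) (⨯-zero k))

    expand : ∀ {n} → p ≡ suc n → (∀ x → p ⨯ x ≈ 0#) → ∀ x → B.binomialExpansion x (suc n) ≈ 1# + x ^ suc n
    expand {n} ≡.refl char x = begin
      f Fin.zero + sum (λ j → f (Fin.suc j))             ≈⟨ +-congˡ (sum-init-last (λ j → f (Fin.suc j))) ⟩
      f Fin.zero + (sum (λ j → f (Fin.suc (Fin.inject₁ j))) + f (Fin.suc (Fin.fromℕ n))) ≈⟨ +-cong first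
        (+-cong middle last-term) ⟩
      1# + (0# + x ^ suc n)                              ≈⟨ +-congˡ (+-identityˡ _) ⟩
      1# + x ^ suc n                                     ∎
      where
      f : Fin (suc (suc n)) → Carrier
      f = B.binomialTerm x (suc n)
      first : f Fin.zero ≈ 1#
      first = trans (+-identityʳ _) (trans (*-identityˡ _) (1^n≈1 (suc n)))
      middle : sum (λ j → f (Fin.suc (Fin.inject₁ j))) ≈ 0#
      middle = trans (sum-cong-≋ {n} {λ j → f (Fin.suc (Fin.inject₁ j))} {λ _ → 0#} (λ j → multiples-vanish char
          (prime∣C p-prime (s≤s z≤n) (s≤s (≡.subst (ℕ._< n) (≡.sym (Finₚ.toℕ-inject₁ j)) (Finₚ.toℕ<n j)))) _))
        (sum-replicate-zero n)
      last-term : f (Fin.suc (Fin.fromℕ n)) ≈ x ^ suc n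
      last-term = begin
        (suc n choose suc (Fin.toℕ (Fin.fromℕ n))) ⨯ (x ^ suc (Fin.toℕ (Fin.fromℕ n)) * 1# ^ (n ℕ.∸ Fin.toℕ (Fin.fromℕ n)))
          ≡⟨ ≡.cong (λ k → (suc n choose suc k) ⨯ (x ^ suc k * 1# ^ (n ℕ.∸ k))) (Finₚ.toℕ-fromℕ n) ⟩
        (suc n choose suc n) ⨯ (x ^ suc n * 1# ^ (n ℕ.∸ n)) ≡⟨ ≡.cong (_⨯ (x ^ suc n * 1# ^ (n ℕ.∸ n))) (nCn≡1 (suc n)) ⟩
        1 ⨯ (x ^ suc n * 1# ^ (n ℕ.∸ n))     ≈⟨ +-identityʳ _ ⟩
        x ^ suc n * 1# ^ (n ℕ.∸ n)           ≈⟨ *-congˡ (1^n≈1 (n ℕ.∸ n)) ⟩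
        x ^ suc n * 1#                       ≈⟨ *-identityʳ _ ⟩
        x ^ suc n                            ∎

    suc-pred : ∃ λ n → p ≡ suc n
    suc-pred = ℕ.pred p , ≡.sym (ℕₚ.suc-pred p {{prime⇒nonZero p-prime}})

  abstract
    -- The second summand 1 commutes with x, so the binomial theorem holds even in the
    -- noncommutative semiring of matrices.
    dream : (∀ x → p ⨯ x ≈ 0#) → ∀ x → (x + 1#) ^ p ≈ 1# + x ^ p
    dream char x = let n , p≡ = suc-pred in ≡.subst (λ m → (x + 1#) ^ m ≈ 1# + x ^ m) (≡.sym p≡)
      (trans (B.theorem x (trans (*-identityʳ x) (sym (*-identityˡ x))) (suc n)) (expand p≡ char x))

-- Orders p and 2p against trace ±2.

module Orders {c ℓ q} (F : FiniteField c ℓ q) (2∤q : ¬ 2 ∣ q) (prime-power : IsPrimePower q)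
              {p} (p-prime : Prime p) (p∣q : p ∣ q) where
  open FiniteField F hiding (zero)
  open RingProperties ring using (-0#≈0#)
  open FieldTheory F
  open Odd 2∤q
  open MatP
  open Matrix₂
  open Geometry F 2∤q
  open Mult semiring using (×-congʳ; ×-assoc-*; ×1-homo-*; ×-assocˡ) renaming (_×_ to _⨯_)
  private
    R = commutativeRing
    Mat = Matrix₂ R
    det : Mat → Carrier
    det = Defs.det R
    module G = Group (SL₂F F)

  infixl 6 _+ᴹ_
  _+ᴹ_ : Mat → Mat → Mat
  mat a b c d +ᴹ mat e f g h = mat (a + e) (b + f) (c + g) (d + h)

  matrixSemiring : Semiring c ℓ
  matrixSemiring = record
    { Carrier = Mat ; _≈_ = _≈ᴹ_ ; _+_ = _+ᴹ_ ; _*_ = _*ᴹ_ ; 0# = mat 0# 0# 0# 0# ; 1# = Iᴹ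
    ; isSemiring = record
      { isSemiringWithoutAnnihilatingZero = record
        { +-isCommutativeMonoid = record
          { isMonoid = record
            { isSemigroup = record
              { isMagma = record
                { isEquivalence = record
                  { refl = mat≈ refl refl refl refl
                  ; sym = λ (mat≈ a b c d) → mat≈ (sym a) (sym b) (sym c) (sym d)
                  ; trans = λ (mat≈ a b c d) (mat≈ e f g h) → mat≈ (trans a e) (trans b f) (trans c g) (trans d h) }
                ; ∙-cong = λ (mat≈ a b c d) (mat≈ e f g h) → mat≈ (+-cong a e) (+-cong b f) (+-cong c g) (+-cong d h) }
              ; assoc = λ _ _ _ → mat≈ (+-assoc _ _ _) (+-assoc _ _ _) (+-assoc _ _ _) (+-assoc _ _ _) }
            ; identity = (λ _ → mat≈ (+-identityˡ _) (+-identityˡ _) (+-identityˡ _) (+-identityˡ _))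
                       , (λ _ → mat≈ (+-identityʳ _) (+-identityʳ _) (+-identityʳ _) (+-identityʳ _)) }
          ; comm = λ _ _ → mat≈ (+-comm _ _) (+-comm _ _) (+-comm _ _) (+-comm _ _) }
        ; *-cong = λ (mat≈ a b c d) (mat≈ e f g h) → mat≈ (dot a e b g) (dot a f b h) (dot c e d g) (dot c f d h)
        ; *-assoc = λ (mat a b c d) (mat e f g h) (mat i j k l) → mat≈
            (assoc a b e f g h i k) (assoc a b e f g h j l) (assoc c d e f g h i k) (assoc c d e f g h j l)
        ; *-identity = (λ (mat a b c d) → mat≈ (1·0· a c) (1·0· b d) (0·1· a c) (0·1· b d))
                     , (λ (mat a b c d) → mat≈ (·1·0 a b) (·0·1 a b) (·1·0 c d) (·0·1 c d))
        ; distrib = (λ (mat a b c d) (mat e f g h) (mat i j k l) → mat≈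
                        (distrˡ a b e g i k) (distrˡ a b f h j l) (distrˡ c d e g i k) (distrˡ c d f h j l))
                  , (λ (mat a b c d) (mat e f g h) (mat i j k l) → mat≈
                        (distrʳ a c e f i j) (distrʳ b d e f i j) (distrʳ a c g h k l) (distrʳ b d g h k l)) }
      ; zero = (λ (mat a b c d) → mat≈ (0·0· a c) (0·0· b d) (0·0· a c) (0·0· b d))
             , (λ (mat a b c d) → mat≈ (·0·0 a b) (·0·0 a b) (·0·0 c d) (·0·0 c d)) } }
    where
    dot : ∀ {a a′ e e′ b b′ g g′} → a ≈ a′ → e ≈ e′ → b ≈ b′ → g ≈ g′ → a * e + b * g ≈ a′ * e′ + b′ * g′
    dot a e b g = +-cong (*-cong a e) (*-cong b g)
    assoc : ∀ a b e f g h x y → (a * e + b * g) * x + (a * f + b * h) * y ≈ a * (e * x + f * y) + b * (g * x + h * y)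
    assoc = solve 8 (λ a b e f g h x y → (a :* e :+ b :* g) :* x :+ (a :* f :+ b :* h) :* y := a :* (e :* x :+ f :* y)
      :+ b :* (g :* x :+ h :* y)) refl
    1·0· : ∀ x y → 1# * x + 0# * y ≈ x
    1·0· = solve 2 (λ x y → p1 :* x :+ p0 :* y := x) refl
    0·1· : ∀ x y → 0# * x + 1# * y ≈ y
    0·1· = solve 2 (λ x y → p0 :* x :+ p1 :* y := y) refl
    ·1·0 : ∀ x y → x * 1# + y * 0# ≈ x
    ·1·0 = solve 2 (λ x y → x :* p1 :+ y :* p0 := x) refl
    ·0·1 : ∀ x y → x * 0# + y * 1# ≈ y
    ·0·1 = solve 2 (λ x y → x :* p0 :+ y :* p1 := y) refl
    0·0· : ∀ x y → 0# * x + 0# * y ≈ 0#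
    0·0· = solve 2 (λ x y → p0 :* x :+ p0 :* y := p0) refl
    ·0·0 : ∀ x y → x * 0# + y * 0# ≈ 0#
    ·0·0 = solve 2 (λ x y → x :* p0 :+ y :* p0 := p0) refl
    distrˡ : ∀ a b e g i k → a * (e + i) + b * (g + k) ≈ a * e + b * g + (a * i + b * k)
    distrˡ = solve 6 (λ a b e g i k → a :* (e :+ i) :+ b :* (g :+ k) := a :* e :+ b :* g :+ (a :* i :+ b :* k)) refl
    distrʳ : ∀ a c e f i j → (e + i) * a + (f + j) * c ≈ e * a + f * c + (i * a + j * c)
    distrʳ = solve 6 (λ a c e f i j → (e :+ i) :* a :+ (f :+ j) :* c := e :* a :+ f :* c :+ (i :* a :+ j :* c)) refl

  private
    module M = Semiring matrixSemiring
    open Exp matrixSemiring using () renaming (_^_ to _^ᴹ_; ^-assocʳ to ^ᴹ-assocʳ; ^-congˡ to ^ᴹ-congˡ)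
    open Mult matrixSemiring using () renaming (_×_ to _⨯ᴹ_)

    prime∣^ : ∀ {r} k → p ∣ r ℕ.^ k → p ∣ r
    prime∣^ zero p∣1 = ⊥-elim (ℕₚ.<⇒≱ (nonTrivial⇒n>1 p {{prime⇒nonTrivial p-prime}}) (∣⇒≤ p∣1))
    prime∣^ {r} (suc k) p∣ = [ (λ h → h) , prime∣^ k ]′ (euclidsLemma r (r ℕ.^ k) p-prime p∣)

    p^k×1≈0⇒p×1≈0 : ∀ k → (p ℕ.^ k) ⨯ 1# ≈ 0# → p ⨯ 1# ≈ 0#
    p^k×1≈0⇒p×1≈0 zero e = ⊥-elim (0≉1 (sym (trans (sym (+-identityʳ 1#)) e)))
    p^k×1≈0⇒p×1≈0 (suc k) e = [ (λ h → h) , p^k×1≈0⇒p×1≈0 k ]′ (xy≈0⇒x≈0⊎y≈0 (trans (sym (×1-homo-* p (p ℕ.^ k))) e))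

    q≡p^k : ∃ λ k → q ≡ p ℕ.^ k
    q≡p^k = let r , k , r-prime , _ , q≡r^k = prime-power in k ,
      ≡.trans q≡r^k (≡.cong (ℕ._^ k) (≡.sym (p≡r r-prime (prime∣^ k (≡.subst (p ∣_) q≡r^k p∣q)))))
      where
      p≡r : ∀ {r} → Prime r → p ∣ r → p ≡ r
      p≡r r-prime p∣r = [ (λ p≡1 → ⊥-elim (ℕₚ.<-irrefl (≡.sym p≡1) (nonTrivial⇒n>1 p {{prime⇒nonTrivial p-prime}}))) ,
        (λ h → h) ]′ (prime⇒irreducible r-prime p∣r)

  abstract
    p×1≈0 : p ⨯ 1# ≈ 0#
    p×1≈0 = let k , q≡ = q≡p^k in p^k×1≈0⇒p×1≈0 k (≡.subst (λ n → n ⨯ 1# ≈ 0#) q≡ (q×1≈0 F))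

    ⨯≈⨯1* : ∀ n x → n ⨯ x ≈ n ⨯ 1# * x
    ⨯≈⨯1* n x = sym (trans (×-assoc-* n 1# x) (×-congʳ n (*-identityˡ x)))

    p×≈0 : ∀ x → p ⨯ x ≈ 0#
    p×≈0 x = trans (⨯≈⨯1* p x) (trans (*-congʳ p×1≈0) (zeroˡ x))

    multiple×≈0 : ∀ {n} → p ∣ n → ∀ x → n ⨯ x ≈ 0#
    multiple×≈0 {n} (divides k n≡) x = trans (reflexive (≡.cong (_⨯ x) (≡.trans n≡ (ℕₚ.*-comm k p)))) (trans
      (sym (×-assocˡ x p k)) (p×≈0 (k ⨯ x)))

    -- The gcd of n and p is 1 or p, and a Bézout identity for 1 would make 1 vanish in the field.
    ×≈0⇒p∣ : ∀ {n x} → ¬ x ≈ 0# → n ⨯ x ≈ 0# → p ∣ n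
    ×≈0⇒p∣ {n} {x} x≉0 nx≈0 = by-gcd (GCD.Bézout.lemma n p)
      where
      n×1≈0 : n ⨯ 1# ≈ 0#
      n×1≈0 = [ (λ h → h) , ⊥-elim ∘ x≉0 ]′ (xy≈0⇒x≈0⊎y≈0 (trans (sym (⨯≈⨯1* n x)) nx≈0))
      vanish : ∀ k {m} → m ⨯ 1# ≈ 0# → (k ℕ.* m) ⨯ 1# ≈ 0#
      vanish k {m} e = trans (×1-homo-* k m) (trans (*-congˡ e) (zeroʳ _))
      one : ∀ {k l} → 1 ℕ.+ k ≡ l → k ⨯ 1# ≈ 0# → l ⨯ 1# ≈ 0# → ⊥
      one ≡.refl e e′ = 0≉1 (sym (trans (sym (+-identityʳ 1#)) (trans (+-congˡ (sym e)) e′)))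
      bezout : GCD.Bézout.Identity 1 n p → ⊥
      bezout (GCD.Bézout.+- x y eq) = one eq (vanish y p×1≈0) (vanish x n×1≈0)
      bezout (GCD.Bézout.-+ x y eq) = one eq (vanish x n×1≈0) (vanish y p×1≈0)
      by-gcd : GCD.Bézout.Lemma n p → p ∣ n
      by-gcd (GCD.Bézout.result d g b) = [ (λ d≡1 → ⊥-elim (bezout (≡.subst (λ d → GCD.Bézout.Identity d n p) d≡1 b)))
                                         , (λ d≡p → ≡.subst (_∣ n) d≡p (GCD.GCD.gcd∣m g)) ]′ (prime⇒irreducible p-prime (GCD.GCD.gcd∣n g))

    det-*ᴹ : ∀ A B → det (A *ᴹ B) ≈ det A * det B
    det-*ᴹ (mat a b c d) (mat e f g h) = solve 8 (λ a b c d e f g h →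
      detP (matP a b c d ∙P matP e f g h) := detP (matP a b c d) :* detP (matP e f g h)) refl a b c d e f g h

    det-^≈0 : ∀ A n → det (A ^ᴹ n) ≈ 0# → det A ≈ 0#
    det-^≈0 A zero e = ⊥-elim (0≉1 (trans (sym e) (solve 0 (p1 :* p1 :- p0 :* p0 := p1) refl)))
    det-^≈0 A (suc n) e = [ (λ h → h) , det-^≈0 A n ]′ (xy≈0⇒x≈0⊎y≈0 (trans (sym (det-*ᴹ A (A ^ᴹ n))) e))

    p⨯ᴹ≈0 : ∀ A → p ⨯ᴹ A ≈ᴹ mat 0# 0# 0# 0#
    p⨯ᴹ≈0 A = mat≈ (trans (reflexive (entry m₁₁ ≡.refl (λ _ _ →
      ≡.refl) p)) (p×≈0 (m₁₁ A))) (trans (reflexive (entry m₁₂ ≡.refl (λ _ _ → ≡.refl) p)) (p×≈0 (m₁₂ A)))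
                   (trans (reflexive (entry m₂₁ ≡.refl (λ _ _ →
                     ≡.refl) p)) (p×≈0 (m₂₁ A))) (trans (reflexive (entry m₂₂ ≡.refl (λ _ _ →
                     ≡.refl) p)) (p×≈0 (m₂₂ A)))
      where
      entry : (m : Mat → Carrier) → m (mat 0# 0# 0# 0#) ≡ 0# → (∀ A B → m (A +ᴹ B) ≡ m A + m B) → ∀ n →
        m (n ⨯ᴹ A) ≡ n ⨯ m A
      entry m m0 m+ zero = m0
      entry m m0 m+ (suc n) = ≡.trans (m+ A (n ⨯ᴹ A)) (≡.cong (λ z → m A + z) (entry m m0 m+ n))

    -- In characteristic p, g²ᵖ = 1 gives (g² - 1)ᵖ = 0, so 0 = det (g² - 1) = (2 - tr g) (2 + tr g).
    ^2p≈I⇒Par : ∀ g → proj₁ g ^ᴹ (2 ℕ.* p) ≈ᴹ Iᴹ → Par g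
    ^2p≈I⇒Par g@(A@(mat a b c′ d) , detA) A²ᵖ≈I = par (by₂ (- 1#) ((a * d - b * c′) + (1# + 2#))
        (solve 4 (λ a b c d → let m = matP a b c d ; D = a :* d :- b :* c in
          trP m :* trP m :- p4 := :- p1 :* (detP (N m) :- p0) :+ (D :+ (p1 :+ p2)) :* (D :- p1))
            refl a b c′ d) det-N detA)
      where
      N : ∀ {n} → MatP n → MatP n
      N m = let matP x y z w = m ∙P (m ∙P matP p1 p0 p0 p1) in matP (x :+ :- p1) (y :+ p0) (z :+ p0) (w :+ :- p1)
      N′ : Mat
      N′ = A ^ᴹ 2 +ᴹ mat (- 1#) 0# 0# (- 1#)
      N+I : N′ +ᴹ Iᴹ ≈ᴹ A ^ᴹ 2
      N+I = mat≈ (sub _) (zer _) (zer _) (sub _)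
        where
        sub : ∀ x → x + - 1# + 1# ≈ x
        sub = solve 1 (λ x → x :+ :- p1 :+ p1 := x) refl
        zer : ∀ x → x + 0# + 0# ≈ x
        zer = solve 1 (λ x → x :+ p0 :+ p0 := x) refl
      I+Nᵖ≈I : Iᴹ +ᴹ N′ ^ᴹ p ≈ᴹ Iᴹ
      I+Nᵖ≈I = M.trans (M.sym (FreshmansDream.dream matrixSemiring p-prime p⨯ᴹ≈0 N′)) (M.trans (^ᴹ-congˡ p N+I) (M.trans (^ᴹ-assocʳ A 2 p) A²ᵖ≈I))
      det-0 : ∀ B → Iᴹ +ᴹ B ≈ᴹ Iᴹ → det B ≈ 0#
      det-0 (mat x y z w) (mat≈ e₁ e₂ e₃ e₄) = trans (+-cong (*-congʳ (drop e₁)) (-‿cong (*-congʳ (drop₀ e₂))))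
        (solve 2 (λ z w → p0 :* w :- p0 :* z := p0) refl z w)
        where
        drop : ∀ {x} → 1# + x ≈ 1# → x ≈ 0#
        drop {x} e = by₁ 1# (solve 1 (λ x → x :- p0 := p1 :* (p1 :+ x :- p1)) refl x) e
        drop₀ : ∀ {x} → 0# + x ≈ 0# → x ≈ 0#
        drop₀ e = trans (sym (+-identityˡ _)) e
      det-N : det N′ ≈ 0#
      det-N = det-^≈0 N′ p (det-0 (N′ ^ᴹ p) I+Nᵖ≈I)

  private
    module 𝔽 = Exp semiring

    scale : Carrier → Mat → Mat
    scale k (mat a b c d) = mat (k * a) (k * b) (k * c) (k * d)

    scale-* : ∀ {k l A A′ B B′} → A ≈ᴹ scale k A′ → B ≈ᴹ scale l B′ → A *ᴹ B ≈ᴹ scale (k * l) (A′ *ᴹ B′)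
    scale-* {k} {l} (mat≈ p q r s) (mat≈ p′ q′ r′ s′) = mat≈ (dot p p′ q r′) (dot p q′ q s′) (dot r p′ s r′) (dot r q′ s s′)
      where
      dot : ∀ {a a′ b b′ e e′ g g′} → a ≈ k * a′ → e ≈ l * e′ → b ≈ k * b′ → g ≈ l * g′ →
        a * e + b * g ≈ k * l * (a′ * e′ + b′ * g′)
      dot {a′ = a} {b′ = b} {e′ = e} {g′ = g} p q r s = trans (+-cong (*-cong p q) (*-cong r s))
        (solve 6 (λ k l a e b g → k :* a :* (l :* e) :+ k :* b :* (l :* g) := k :* l :* (a :* e :+ b :* g))
          refl k l a e b g)

    scale-cong : ∀ {k l A B} → k ≈ l → A ≈ᴹ B → scale k A ≈ᴹ scale l B
    scale-cong k (mat≈ p q r s) = mat≈ (*-cong k p) (*-cong k q) (*-cong k r) (*-cong k s)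

    ≃⇒scale : ∀ {x y} (e : x ≃ y) → proj₁ x ≈ᴹ scale (sgn e) (proj₁ y)
    ≃⇒scale (≃-intro _ _ p q r s) = mat≈ p q r s

    scale-1 : ∀ A → scale 1# A ≈ᴹ A
    scale-1 A = mat≈ (*-identityˡ _) (*-identityˡ _) (*-identityˡ _) (*-identityˡ _)

    power : ∀ g n → proj₁ (_^ᴳ_ (SL₂F F) g n) ≡ proj₁ g ^ᴹ n
    power g zero    = ≡.refl
    power g (suc n) = ≡.cong (proj₁ g *ᴹ_) (power g n)

    ^ᴹ-I : ∀ A m n → A ^ᴹ m ≈ᴹ Iᴹ → A ^ᴹ (n ℕ.* m) ≈ᴹ Iᴹ
    ^ᴹ-I A m n e = M.trans (M.reflexive (≡.cong (A ^ᴹ_) (ℕₚ.*-comm n m))) (M.trans (M.sym (^ᴹ-assocʳ A m n))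
      (M.trans (^ᴹ-congˡ n e) (FreshmansDream.1^n≈1 matrixSemiring p-prime n)))

  order⇒Par : ∀ {g} → HasOrder (SL₂F F) g p ⊎ HasOrder (SL₂F F) g (2 ℕ.* p) → Par g
  order⇒Par {g} = [ (λ (_ , e , _) → ^2p≈I⇒Par g (^ᴹ-I (proj₁ g) p 2 (M.trans (M.reflexive (≡.sym (power g p))) e)))
                  , (λ (_ , e , _) → ^2p≈I⇒Par g (M.trans (M.reflexive (≡.sym (power g (2 ℕ.* p)))) e)) ]′

  module _ {g d s} (g≃u : g ≃ u ⟪ d ⟫ s) where
    private
      ε : Carrier
      ε = sgn g≃u

      A^n : ∀ n → proj₁ g ^ᴹ n ≈ᴹ scale (ε 𝔽.^ n) (proj₁ (u ⟪ d ⟫ (n ⨯ s)))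
      A^n zero = M.trans (M.sym (u0≈I ⟪ d ⟫)) (M.sym (scale-1 _))
        where
        u0≈I : ∀ v → proj₁ (u v 0#) ≈ᴹ Iᴹ
        u0≈I (x , y) = mat≈
          (solve 2 (λ x y → p₁₁ (uP x y p0) := p1) refl x y)
          (solve 2 (λ x y → p₁₂ (uP x y p0) := p0) refl x y)
          (solve 2 (λ x y → p₂₁ (uP x y p0) := p0) refl x y)
          (solve 2 (λ x y → p₂₂ (uP x y p0) := p1) refl x y)
      A^n (suc n) = M.trans (scale-* {ε} {ε 𝔽.^ n} (≃⇒scale {g} {u ⟪ d ⟫ s} g≃u) (A^n n)) (scale-cong
        refl (u-*ᴹ ⟪ d ⟫ s (n ⨯ s)))

      u≈I : ∀ {r} → r ≈ 0# → proj₁ (u ⟪ d ⟫ r) ≈ᴹ Iᴹ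
      u≈I {r} r≈0 = mat≈ (zap₁ (λ x → - x) (sym -0#≈0#) -‿cong) (zap₀ (λ x → x) refl (λ e → e)) (zap₀ (λ x →
        - x) (sym -0#≈0#) -‿cong) (zap₁ (λ x → x) refl (λ e → e))
        where
        zap₀ : (f : Carrier → Carrier) → 0# ≈ f 0# → (∀ {x y} → x ≈ y → f x ≈ f y) → ∀ {k} → f (r * k) ≈ 0#
        zap₀ f f0 f-cong = trans (f-cong (trans (*-congʳ r≈0) (zeroˡ _))) (sym f0)
        zap₁ : (f : Carrier → Carrier) → 0# ≈ f 0# → (∀ {x y} → x ≈ y → f x ≈ f y) → ∀ {k} → 1# + f (r * k) ≈ 1#
        zap₁ f f0 f-cong = trans (+-congˡ (zap₀ f f0 f-cong)) (+-identityʳ 1#)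

      A^n≈I : ∀ {n} → n ⨯ s ≈ 0# → ε 𝔽.^ n ≈ 1# → _^ᴳ_ (SL₂F F) g n G.≈ G.ε
      A^n≈I {n} ns≈0 εⁿ≈1 = M.trans (M.reflexive (power g n)) (M.trans (A^n n) (M.trans (scale-cong εⁿ≈1 (u≈I ns≈0)) (scale-1 Iᴹ)))

      A^n≈I⇒ : ∀ {n} → _^ᴳ_ (SL₂F F) g n G.≈ G.ε → n ⨯ s ≈ 0# × ε 𝔽.^ n ≈ 1#
      A^n≈I⇒ {n} e = u≃𝟙⇒s≈0 {d} (≃-sym 𝟙≃u) , εⁿ≈1
        where
        e′ : Iᴹ ≈ᴹ scale (ε 𝔽.^ n) (proj₁ (u ⟪ d ⟫ (n ⨯ s)))
        e′ = M.trans (M.sym e) (M.trans (M.reflexive (power g n)) (A^n n))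
        εⁿ≈1 : ε 𝔽.^ n ≈ 1#
        -- Adding the diagonal entries gives 2 = 2 εⁿ, since `u` has trace 2.
        εⁿ≈1 = *-cancelˡ 2≉0 (by₂ (- 1#) (- 1#) (solve 2 (λ k x → p2 :* k :- p2 :* p1 := :- p1 :* (p1 :- k :* (p1 :- x))
          :+ :- p1 :* (p1 :- k :* (p1 :+ x)))
          refl (ε 𝔽.^ n) (n ⨯ s * (proj₁ ⟪ d ⟫ * proj₂ ⟪ d ⟫))) (Defs._≈ᴹ_.≈₁₁ e′) (Defs._≈ᴹ_.≈₂₂ e′))
        𝟙≃u : 𝟙 ≃ u ⟪ d ⟫ (n ⨯ s)
        𝟙≃u = ≃-intro (ε 𝔽.^ n)
          (trans (*-cong εⁿ≈1 εⁿ≈1) (*-identityˡ 1#)) (Defs._≈ᴹ_.≈₁₁ e′) (Defs._≈ᴹ_.≈₁₂ e′) (Defs._≈ᴹ_.≈₂₁ e′) (Defs._≈ᴹ_.≈₂₂ e′)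

      0<p : 1 ℕ.≤ p
      0<p = ℕₚ.<⇒≤ (nonTrivial⇒n>1 p {{prime⇒nonTrivial p-prime}})

      order-p : ¬ s ≈ 0# → ε ≈ 1# → HasOrder (SL₂F F) g p
      order-p s≉0 ε≈1 = 0<p , A^n≈I {p} (p×≈0 s) (ε^≈1 p) ,
        λ m 0<m e → ∣⇒≤ {{ℕ.>-nonZero 0<m}} (×≈0⇒p∣ s≉0 (proj₁ (A^n≈I⇒ {m} e)))
        where
        ε^≈1 : ∀ n → ε 𝔽.^ n ≈ 1#
        ε^≈1 n = trans (𝔽.^-congˡ n ε≈1) (FreshmansDream.1^n≈1 semiring p-prime n)

      parity : ¬ ε ≈ 1# → ∀ n → (2 ∣ n × ε 𝔽.^ n ≈ 1#) ⊎ (2 ∣ suc n × ¬ ε 𝔽.^ n ≈ 1# × ε 𝔽.^ n ≈ ε)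
      parity ε≉1 zero = inj₁ (2 ∣0 , refl)
      parity ε≉1 (suc n) = [ (λ (2∣n , e) → inj₂ (∣m∣n⇒∣m+n (∣-refl {2}) 2∣n , (λ e′ →
        ε≉1 (trans (sym (ε* e)) e′)) , ε* e))
                           , (λ (2∣n+1 , _ , e) → inj₁ (2∣n+1 , trans (*-congˡ e) (sgn² g≃u))) ]′ (parity ε≉1 n)
        where
        ε* : ∀ {x} → x ≈ 1# → ε * x ≈ ε
        ε* e = trans (*-congˡ e) (*-identityʳ ε)

      order-2p : ¬ s ≈ 0# → ¬ ε ≈ 1# → HasOrder (SL₂F F) g (2 ℕ.* p)
      order-2p s≉0 ε≉1 = ℕₚ.≤-trans 0<p (ℕₚ.m≤n*m p 2) ,
        A^n≈I {2 ℕ.* p} (multiple×≈0 (divides 2 ≡.refl) s) (trans (sym (𝔽.^-assocʳ ε 2 p)) (trans (𝔽.^-congˡ p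
          (trans (*-congˡ (*-identityʳ ε)) (sgn² g≃u))) (FreshmansDream.1^n≈1 semiring p-prime p))) ,
        λ m 0<m e → ∣⇒≤ {{ℕ.>-nonZero 0<m}} (2p∣ m (×≈0⇒p∣ s≉0 (proj₁ (A^n≈I⇒ {m} e))) (even m (proj₂ (A^n≈I⇒ {m} e))))
        where
        even : ∀ m → ε 𝔽.^ m ≈ 1# → 2 ∣ m
        even m e = [ proj₁ , (λ (_ , ≉1 , _) → ⊥-elim (≉1 e)) ]′ (parity ε≉1 m)
        -- As a divisor of the odd number q, p is odd, so the factor 2 must divide the cofactor of p
        -- in m.
        2p∣ : ∀ m → p ∣ m → 2 ∣ m → 2 ℕ.* p ∣ m
        2p∣ m (divides k m≡kp) 2∣m = [ (λ 2∣k → ≡.subst (2 ℕ.* p ∣_) (≡.sym m≡kp) (*-monoˡ-∣ p 2∣k)) , (λ 2∣p →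
          ⊥-elim (2∤q (∣-trans 2∣p p∣q))) ]′
          (euclidsLemma k p prime[2] (≡.subst (2 ∣_) m≡kp 2∣m))

    classify : proj₁ g ≈ᴹ Iᴹ ⊎ (proj₁ g ≈ᴹ proj₁ (-I R) ⊎ (HasOrder (SL₂F F) g p ⊎ HasOrder (SL₂F F) g (2 ℕ.* p)))
    classify with s ≟ 0# | ε ≟ 1#
    ... | yes s≈0 | yes ε≈1 = inj₁ (M.trans (≃⇒scale {g}
      {u ⟪ d ⟫ s} g≃u) (M.trans (scale-cong ε≈1 (u≈I s≈0)) (scale-1 Iᴹ)))
    ... | yes s≈0 | no ε≉1 = inj₂ (inj₁ (M.trans (≃⇒scale {g}
      {u ⟪ d ⟫ s} g≃u) (M.trans (scale-cong ε≈-1 (u≈I s≈0)) -1·I)))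
      where
      ε≈-1 : ε ≈ - 1#
      ε≈-1 = [ ⊥-elim ∘ ε≉1 , (λ h → h) ]′ (±1 (sgn² g≃u))
      -1·I : scale (- 1#) Iᴹ ≈ᴹ proj₁ (-I R)
      -1·I = mat≈ (*-identityʳ _) (trans (zeroʳ _) (sym -0#≈0#)) (trans (zeroʳ _) (sym -0#≈0#)) (*-identityʳ _)
    ... | no s≉0 | yes ε≈1 = inj₂ (inj₂ (inj₁ (order-p s≉0 ε≈1)))
    ... | no s≉0 | no ε≉1 = inj₂ (inj₂ (inj₂ (order-2p s≉0 ε≉1)))

  Par⇒member : ∀ {g} → Par g → proj₁ g ≈ᴹ Iᴹ ⊎
    (proj₁ g ≈ᴹ proj₁ (-I R) ⊎ (HasOrder (SL₂F F) g p ⊎ HasOrder (SL₂F F) g (2 ℕ.* p)))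
  Par⇒member {g} p = let d , s , g≃u = Par⇒u p in classify {g} {d} {s} g≃u

  member⇒Par : ∀ {g} → proj₁ g ≈ᴹ proj₁ (-I R) ⊎ (HasOrder (SL₂F F) g p ⊎ HasOrder (SL₂F F) g (2 ℕ.* p)) → Par g
  member⇒Par {g} = [ (λ (mat≈ e _ _ e′) → par (trans (*-cong (+-cong e e′) (+-cong e e′)) (solve 0 ((:- p1
    :+ :- p1) :* (:- p1 :+ :- p1) := p4) refl))) , order⇒Par ]′

-- Reduction to a left slide along ∞.

module NoAction {c ℓ q} (F : FiniteField c ℓ q) (2∤q : ¬ 2 ∣ q) (5≤q : 5 ℕ.≤ q) where
  open FiniteField F hiding (zero)
  open RingProperties ring using (-‿involutive)
  open FieldTheory F
  open Odd 2∤q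
  open MatP
  open Geometry F 2∤q
  open LinePreservation F 2∤q 5≤q
  open Translations F 2∤q 5≤q
  open Grid F 2∤q 5≤q
  open Colouring F 2∤q 5≤q
  open TraceInvariants F 2∤q 5≤q

  -- Graph automorphisms fixing 𝟙, along which an action is transported: inversion exchanges left
  -- and right, conjugation changes the direction of a slide.
  record Symmetry : Set (c ⊔ ℓ) where
    field
      ψ ψ⁻ : SL → SL
      ψ-cong : ∀ {x y} → x ≃ y → ψ x ≃ ψ y
      ψ⁻-cong : ∀ {x y} → x ≃ y → ψ⁻ x ≃ ψ⁻ y
      ψ-↔ : ∀ {x y} → x ↔ y → ψ x ↔ ψ y
      ψ⁻-↔ : ∀ {x y} → x ↔ y → ψ⁻ x ↔ ψ⁻ y
      ψψ⁻ : ∀ x → ψ (ψ⁻ x) ≃ x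
      ψ⁻ψ : ∀ x → ψ⁻ (ψ x) ≃ x
      ψ𝟙 : ψ 𝟙 ≃ 𝟙

    ψ⁻𝟙 : ψ⁻ 𝟙 ≃ 𝟙
    ψ⁻𝟙 = ≃-trans (ψ⁻-cong (≃-sym ψ𝟙)) (ψ⁻ψ 𝟙)

    module _ {ι} (𝒜 : AbelianAction ι) where
      private module 𝒜 = AbelianAction 𝒜

      transport : AbelianAction ι
      transport = record
        { Index = 𝒜.Index
        ; act = λ i x → ψ (𝒜.act i (ψ⁻ x))
        ; act⁻¹ = λ i x → ψ (𝒜.act⁻¹ i (ψ⁻ x))
        ; act-cong = λ i e → ψ-cong (𝒜.act-cong i (ψ⁻-cong e))
        ; act⁻¹-cong = λ i e → ψ-cong (𝒜.act⁻¹-cong i (ψ⁻-cong e))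
        ; act-↔ = λ i e → ψ-↔ (𝒜.act-↔ i (ψ⁻-↔ e))
        ; act⁻¹-↔ = λ i e → ψ-↔ (𝒜.act⁻¹-↔ i (ψ⁻-↔ e))
        ; act-comm = λ i j x → ψ-cong (≃-trans (𝒜.act-cong i (ψ⁻ψ _)) (≃-trans (𝒜.act-comm i j (ψ⁻ x)) (𝒜.act-cong j
          (≃-sym (ψ⁻ψ _)))))
        ; act⁻¹-act = λ i x → ≃-trans (ψ-cong (≃-trans (𝒜.act⁻¹-cong i (ψ⁻ψ _)) (𝒜.act⁻¹-act i (ψ⁻ x)))) (ψψ⁻ x)
        ; act-act⁻¹ = λ i x → ≃-trans (ψ-cong (≃-trans (𝒜.act-cong i (ψ⁻ψ _)) (𝒜.act-act⁻¹ i (ψ⁻ x)))) (ψψ⁻ x)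
        ; transitive = λ x y → let i , e = 𝒜.transitive (ψ⁻ x) (ψ⁻ y) in i , ≃-trans (ψ-cong e) (ψψ⁻ y)
        }

      transport-slides : ∀ {i d e} → (∀ {y} → 𝟙 ─[ d ]─ y → 𝟙 ─[ e ]─ ψ y) → (∀ {y} → 𝟙 ─[ e ]─ y → 𝟙 ─[ d ]─ ψ⁻ y) →
        𝒜.Slides i 𝟙 d → AbelianAction.Slides transport i 𝟙 e
      transport-slides {i} forth back sl = record
        { moves = λ eq → moves (≃-trans (≃-sym ψ⁻𝟙) (≃-trans (ψ⁻-cong eq) (≃-trans (ψ⁻ψ _) (𝒜.act-cong i ψ⁻𝟙))))
        ; along = line-resp ≃-refl (ψ-cong (𝒜.act-cong i (≃-sym ψ⁻𝟙))) (forth along)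
        ; stable = λ on → forth (stable (back on)) }
        where open 𝒜.Slides sl

  inversion : Symmetry
  inversion = record
    { ψ = _⁻¹ ; ψ⁻ = _⁻¹ ; ψ-cong = ≃-⁻¹ ; ψ⁻-cong = ≃-⁻¹ ; ψ-↔ = ↔-⁻¹ ; ψ⁻-↔ = ↔-⁻¹
    ; ψψ⁻ = ≃-⁻¹-⁻¹ ; ψ⁻ψ = ≃-⁻¹-⁻¹ ; ψ𝟙 = 𝟙⁻¹ }

  line-⁻¹ : ∀ {d y} → 𝟙 ─[ d ]─ y → 𝟙 ─[ d ]─ y ⁻¹
  line-⁻¹ {d} {y} (s by y≃) = (- s) by ≃-trans (≃-⁻¹ (≃-trans y≃ (≃-identityʳ _))) (≃-trans (u-⁻¹ ⟪ d ⟫ s) (≃-sym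
    (≃-identityʳ _)))

  conjugation : SL → Symmetry
  conjugation h = record
    { ψ = λ x → h ⁻¹ ∙ x ∙ h ; ψ⁻ = λ x → h ∙ x ∙ h ⁻¹
    ; ψ-cong = λ e → ≃-∙ʳ (≃-∙ˡ e) ; ψ⁻-cong = λ e → ≃-∙ʳ (≃-∙ˡ e)
    ; ψ-↔ = λ e → ↔-∙ʳ h (↔-∙ˡ (h ⁻¹) e) ; ψ⁻-↔ = λ e → ↔-∙ʳ (h ⁻¹) (↔-∙ˡ h e)
    ; ψψ⁻ = λ x → ≃-trans (≃-∙ʳ (≃-trans (≃-∙ˡ (≃-assoc h x (h ⁻¹))) (x⁻¹∙xy h (x ∙ h ⁻¹)))) (xy⁻¹∙y h x)
    ; ψ⁻ψ = λ x → ≃-trans (≃-∙ʳ (≃-trans (≃-∙ˡ (≃-assoc (h ⁻¹) x h)) (x∙x⁻¹y h (x ∙ h)))) (xy∙y⁻¹ h x)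
    ; ψ𝟙 = ≃-trans (≃-∙ʳ (≃-identityʳ (h ⁻¹))) (≃-inverseˡ h) }

  -- Choosing h with first column ⟪ d ⟫ makes `conjugate-u` carry ∞ to d without rescaling the
  -- parameter.
  carrying-∞ : ∀ d → ∃ λ h → ∀ r → u ⟪ d ⟫ r ∙ h ≃ h ∙ up r
  carrying-∞ d = let h , e₁ , e₂ = frame d in h , λ r → ≃-trans (≃-∙ʳ (u-≈ r (sym e₁) (sym e₂))) (conjugate-u h ⟪ ∞ ⟫ r)
    where
    u-≈ : ∀ {x y z w} r → x ≈ z → y ≈ w → u (x , y) r ≃ u (z , w) r
    u-≈ r x≈ y≈ = ≈⇒≃ (mat≈ (+-congˡ (-‿cong (*-congˡ (*-cong x≈ y≈)))) (*-congˡ (*-cong x≈ x≈)) (-‿cong (*-congˡ (*-cong y≈ y≈))) (+-congˡ (*-congˡ (*-cong x≈ y≈))))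
    frame : ∀ d → ∃ λ h → proj₁ (h · ⟪ ∞ ⟫) ≈ proj₁ ⟪ d ⟫ × proj₂ (h · ⟪ ∞ ⟫) ≈ proj₂ ⟪ d ⟫
    frame ∞ = 𝟙 , solve 0 (p1 :* p1 :+ p0 :* p0 := p1) refl , solve 0 (p0 :* p1 :+ p1 :* p0 := p0) refl
    frame (aff t) = (mat t (- 1#) 1# 0# , solve 1 (λ t → t :* p0 :- :- p1 :* p1 := p1) refl t) ,
      solve 1 (λ t → t :* p1 :+ :- p1 :* p0 := t) refl t , solve 0 (p1 :* p1 :+ p0 :* p0 := p1) refl

  module _ {ι : Level} where
    open AbelianAction using (Slides; act)

    no-left-slide : (𝒜 : AbelianAction ι) → ∀ {i α} → Slides 𝒜 i 𝟙 ∞ → act 𝒜 i 𝟙 ≃ up α →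
      ∀ {t s} → ¬ s ≈ 0# → act 𝒜 i (low t s ∙ 𝟙) ≃ up α ∙ (low t s ∙ 𝟙) → ⊥
    no-left-slide 𝒜 {i} {α} sl i𝟙≃ {t} {s} s≉0 L =
      no-commuting-action 𝒜 (LeftTranslations.act-up 𝒜 {i} {α} sl (LeftOrRight.left-translation 𝒜 {i} {α} sl i𝟙≃ {t}
        {s} s≉0 L))

    no-∞-slide : (𝒜 : AbelianAction ι) → ∀ {i} → Slides 𝒜 i 𝟙 ∞ → ⊥
    no-∞-slide 𝒜 {i} sl = [ no-left-slide 𝒜 sl i𝟙≃ 1≉0 , right ]′ (LeftOrRight.left-or-right 𝒜 {i}
      {α} sl i𝟙≃ (LeftOrRight.P-𝟙 𝒜 {i} {α} sl i𝟙≃) 0# 1≉0)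
      where
      open AbelianAction 𝒜 using (act-cong)
      1≉0 : ¬ 1# ≈ 0#
      1≉0 e = 0≉1 (sym e)
      α : Carrier
      α = step (AbelianAction.Slides.along sl)
      i𝟙≃ : act 𝒜 i 𝟙 ≃ up α
      i𝟙≃ = ≃-trans (y≃ux (AbelianAction.Slides.along sl)) (≃-identityʳ (up α))
      b b⁻ : SL
      b = low 0# 1#
      b⁻ = low 0# (- 1#)
      -- Inversion turns b a into a⁻¹ b⁻¹, so the transported action shows left behaviour with
      -- parameters -α and -1.
      right : act 𝒜 i (b ∙ 𝟙) ≃ b ∙ (up α ∙ 𝟙) → ⊥
      right R = no-left-slide (Symmetry.transport inversion 𝒜) {i} { - α}
        (Symmetry.transport-slides inversion 𝒜 {i} {∞} {∞} line-⁻¹ line-⁻¹ sl)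
        (≃-trans (≃-⁻¹ (≃-trans (act-cong i 𝟙⁻¹) i𝟙≃)) (u-⁻¹ ⟪ ∞ ⟫ α))
        {0#} { - 1#} (neg≉0 𝒜 1≉0) (begin
          act 𝒜 i ((b⁻ ∙ 𝟙) ⁻¹) ⁻¹  ≈⟨ ≃-⁻¹ (act-cong i b⁻⁻¹) ⟩
          act 𝒜 i (b ∙ 𝟙) ⁻¹        ≈⟨ ≃-⁻¹ R ⟩
          (b ∙ (up α ∙ 𝟙)) ⁻¹     ≈⟨ ≃-⁻¹ (≃-∙ˡ (≃-identityʳ (up α))) ⟩
          (b ∙ up α) ⁻¹           ≈⟨ uu-⁻¹ 𝒜 ⟪ aff 0# ⟫ 1# ⟪ ∞ ⟫ α ⟩
          up (- α) ∙ b⁻           ≈⟨ ≃-∙ˡ (≃-identityʳ b⁻) ⟨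
          up (- α) ∙ (b⁻ ∙ 𝟙)     ∎)
        where
        open ≃-Reasoning
        b⁻⁻¹ : (b⁻ ∙ 𝟙) ⁻¹ ≃ b ∙ 𝟙
        b⁻⁻¹ = ≃-trans (≃-⁻¹ (≃-identityʳ b⁻)) (≃-trans (u-⁻¹ ⟪ aff 0# ⟫ (- 1#)) (≃-trans
          (u-cong ⟪ aff 0# ⟫ (-‿involutive 1#)) (≃-sym (≃-identityʳ b))))

    no-slide : (𝒜 : AbelianAction ι) → ∀ i d → ¬ Slides 𝒜 i 𝟙 d
    no-slide 𝒜 i d sl = no-∞-slide (Symmetry.transport (conjugation h) 𝒜)
      {i} (Symmetry.transport-slides (conjugation h) 𝒜 {i} {d} {∞} forth back sl)
      where
      h : SL
      h = proj₁ (carrying-∞ d)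
      uh≃hup : ∀ r → u ⟪ d ⟫ r ∙ h ≃ h ∙ up r
      uh≃hup = proj₂ (carrying-∞ d)
      forth : ∀ {y} → 𝟙 ─[ d ]─ y → 𝟙 ─[ ∞ ]─ h ⁻¹ ∙ y ∙ h
      forth {y} (s by y≃) = s by (begin
        h ⁻¹ ∙ y ∙ h              ≈⟨ ≃-∙ʳ (≃-∙ˡ (≃-trans y≃ (≃-identityʳ _))) ⟩
        h ⁻¹ ∙ u ⟪ d ⟫ s ∙ h      ≈⟨ ≃-assoc _ _ h ⟩
        h ⁻¹ ∙ (u ⟪ d ⟫ s ∙ h)    ≈⟨ ≃-∙ˡ (uh≃hup s) ⟩
        h ⁻¹ ∙ (h ∙ up s)         ≈⟨ x⁻¹∙xy h (up s) ⟩
        up s                      ≈⟨ ≃-identityʳ _ ⟨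
        up s ∙ 𝟙                  ∎)
        where open ≃-Reasoning
      back : ∀ {y} → 𝟙 ─[ ∞ ]─ y → 𝟙 ─[ d ]─ h ∙ y ∙ h ⁻¹
      back {y} (s by y≃) = s by (begin
        h ∙ y ∙ h ⁻¹              ≈⟨ ≃-∙ʳ (≃-∙ˡ (≃-trans y≃ (≃-identityʳ _))) ⟩
        h ∙ up s ∙ h ⁻¹           ≈⟨ ≃-∙ʳ (uh≃hup s) ⟨
        u ⟪ d ⟫ s ∙ h ∙ h ⁻¹      ≈⟨ xy∙y⁻¹ h _ ⟩
        u ⟪ d ⟫ s                 ≈⟨ ≃-identityʳ _ ⟨
        u ⟪ d ⟫ s ∙ 𝟙             ∎)
        where open ≃-Reasoning

    no-abelian-action : ¬ AbelianAction ι
    no-abelian-action 𝒜 = AbelianAction.not-slide-free 𝒜 (no-slide 𝒜)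

-- From a Cayley representation to an abelian action.

module _ {c ℓ k e d : Level} {q p : ℕ} (5≤q : 5 ℕ.≤ q) (2∤q : ¬ 2 ∣ q) (prime-power : IsPrimePower q) (p-prime : Prime p) (p∣q : p ∣ q)
         (F : FiniteField c ℓ q) (K : AbelianGroup k e) where
  open Geometry F 2∤q
  open Translations F 2∤q 5≤q
  open Orders F 2∤q prime-power p-prime p∣q
  private
    module K = AbelianGroup K
    module KP = GroupProperties K.group
    module G = Group (SL₂F F)
    X = Cay (SL₂F F) (t∪S F 2∤q p-prime)
    module X = Graph X

    -- Trace ±2 also admits the ratios ±I: ratio I is equality of vertices, and -I belongs to the
    -- connection set as t.
    ↔⇒~ : ∀ {x y} → x ↔ y → x G.≈ y ⊎ x X.~ y
    ↔⇒~ {x} {y} x↔y = [ (λ yx⁻¹≈ε → inj₁ (G.sym {y} {x} (G.trans {y} {G.ε G.∙ x} {x}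
          (G.trans {y} {(y G.∙ x G.⁻¹) G.∙ x} {G.ε G.∙ x} (G.sym {(y G.∙ x G.⁻¹) G.∙ x}
            {y} (GroupProperties.//-rightDividesˡ (SL₂F F) x y))
            (G.∙-congʳ {x} {y G.∙ x G.⁻¹} {G.ε} yx⁻¹≈ε)) (G.identityˡ x)))) , inj₂ ]′
      (Par⇒member {y G.∙ x G.⁻¹} (par (tr²≈4 (ratio x↔y))))

    ~⇒↔ : ∀ {x y} → x X.~ y → x ↔ y
    ~⇒↔ {x} {y} x~y = adjacent (par (tr²≈4 (member⇒Par {y G.∙ x G.⁻¹} x~y)))

  module _ (C : ConnectionSet K.group d) (iso : X ≅ Cay K.group C) where
    open ConnectionSet C
    open _≅_ iso using (to; from; to-cong; from-cong; inverseˡ; inverseʳ; adjacency)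
    to-from : ∀ z → to (from z) K.≈ z
    to-from z = inverseˡ (G.refl {from z})
    from-to : ∀ x → from (to x) G.≈ x
    from-to x = inverseʳ K.refl

    shift : K.Carrier → SL → SL
    shift z x = from (z K.∙ to x)

    -- The quotient h g⁻¹ is invariant under right translations; commutativity of K lets z act from
    -- the left.
    ~-shift : ∀ z {x y} → x X.~ y → shift z x X.~ shift z y
    ~-shift z {x}
      {y} x~y = Equivalence.from (adjacency (shift z x) (shift z y)) (respects (K.sym eq) (Equivalence.to (adjacency x y) x~y))
      where
      open SetoidReasoning K.setoid
      eq : to (shift z y) K.∙ to (shift z x) K.⁻¹ K.≈ to y K.∙ to x K.⁻¹
      eq = begin
        to (shift z y) K.∙ to (shift z x) K.⁻¹          ≈⟨ K.∙-cong (to-from _) (K.⁻¹-cong (to-from _)) ⟩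
        (z K.∙ to y) K.∙ (z K.∙ to x) K.⁻¹              ≈⟨ K.∙-cong (K.comm z (to y)) (K.⁻¹-cong (K.comm z (to x))) ⟩
        (to y K.∙ z) K.∙ (to x K.∙ z) K.⁻¹              ≈⟨ K.∙-congˡ (KP.⁻¹-anti-homo-∙ (to x) z) ⟩
        (to y K.∙ z) K.∙ (z K.⁻¹ K.∙ to x K.⁻¹)         ≈⟨ K.assoc (to y) z _ ⟩
        to y K.∙ (z K.∙ (z K.⁻¹ K.∙ to x K.⁻¹))         ≈⟨ K.∙-congˡ (KP.\\-leftDividesˡ z (to x K.⁻¹)) ⟩
        to y K.∙ to x K.⁻¹                              ∎

    from-≃ : ∀ {z w} → z K.≈ w → from z ≃ from w
    from-≃ {z} {w} e = ≈⇒≃ {from z} {from w} (from-cong {z} {w} e)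

    shift-≈ : ∀ z {x y} → x G.≈ y → shift z x ≃ shift z y
    shift-≈ z {x} {y} x≈y = from-≃ (K.∙-congˡ (to-cong {x} {y} x≈y))

    shift-↔ : ∀ z {x y} → x ↔ y → shift z x ↔ shift z y
    shift-↔ z {x} {y} x↔y = [ (λ x≈y → ↔-resp ≃-refl (shift-≈ z {x} {y} x≈y) (↔-refl (shift z x)))
                            , (λ x~y → ~⇒↔ {shift z x} {shift z y} (~-shift z {x} {y} x~y)) ]′ (↔⇒~ {x} {y} x↔y)

    shift-shift : ∀ z w x → shift z (shift w x) ≃ from ((z K.∙ w) K.∙ to x)
    shift-shift z w x = from-≃ (K.trans (K.∙-congˡ (to-from _)) (K.sym (K.assoc z w (to x))))

    from-≈to : ∀ {z} x → z K.≈ to x → from z ≃ x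
    from-≈to {z} x z≈ = ≃-trans (from-≃ z≈) (≈⇒≃ {from (to x)} {x} (from-to x))

    undo : ∀ z w x → z K.∙ w K.≈ K.ε → shift z (shift w x) ≃ x
    undo z w x zw≈ε = ≃-trans (shift-shift z w x) (from-≈to x (K.trans (K.∙-congʳ zw≈ε) (K.identityˡ (to x))))

    -- The isomorphism knows nothing of signs. But points equal up to sign have the same closed
    -- neighbourhood, shifts preserve this, and `twin` turns it back into equality up to sign.
    shift-≃ : ∀ z {x y} → x ≃ y → shift z x ≃ shift z y
    shift-≃ z {x} {y} x≃y = twin λ w w↔ → ↔-resp (undo z (z K.⁻¹) w (K.inverseʳ z)) ≃-refl
      (shift-↔ z (↔-resp ≃-refl x≃y (↔-resp ≃-refl (undo (z K.⁻¹) z x (K.inverseˡ z)) (shift-↔ (z K.⁻¹) w↔))))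

    action : AbelianAction k
    action = record
      { Index = K.Carrier
      ; act = shift
      ; act⁻¹ = λ z → shift (z K.⁻¹)
      ; act-cong = shift-≃
      ; act⁻¹-cong = λ z → shift-≃ (z K.⁻¹)
      ; act-↔ = shift-↔
      ; act⁻¹-↔ = λ z → shift-↔ (z K.⁻¹)
      ; act-comm = λ z w x → ≃-trans (shift-shift z w x) (≃-trans (from-≃ (K.∙-congʳ (K.comm z w)))
        (≃-sym (shift-shift w z x)))
      ; act⁻¹-act = λ z x → undo (z K.⁻¹) z x (K.inverseˡ z)
      ; act-act⁻¹ = λ z x → undo z (z K.⁻¹) x (K.inverseʳ z)
      ; transitive = λ x y → to y K.∙ to x K.⁻¹ , from-≈to y (KP.//-rightDividesˡ (to x) (to y))
      }

    no-isomorphism : ⊥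
    no-isomorphism = NoAction.no-abelian-action F 2∤q 5≤q action

theorem6p10 :
    {c ℓ k e d : Level} {q p : ℕ} →
    5 ≤ q → (2∤q : ¬ 2 ∣ q) → IsPrimePower q →
    (p-prime : Prime p) → p ∣ q →
    (F : FiniteField c ℓ q) →
    (K : AbelianGroup k e) →
    ¬ IsCayleyGraphOf (Cay (SL₂F F) (t∪S F 2∤q p-prime)) (AbelianGroup.group K) d
theorem6p10 5≤q 2∤q prime-power p-prime p∣q F K (C , iso) =
  no-isomorphism 5≤q 2∤q prime-power p-prime p∣q F K C iso
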